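{- Let $\mathbb{P}^2 = \{(p,q) \in \mathbb{Z}^2 : p \text{ and } q \text{ are both prime}\} \subseteq \mathbb{R}^2$. For every positive integer $N$, there exists an empty polygon in $\mathbb{P}^2$ with at least $N$ vertices.
   Context: A (convex) polygon $P \subseteq \mathbb{R}^2$ is called an empty polygon in a set $S \subseteq \mathbb{R}^2$ if $P \cap S$ is exactly the set of vertices of $P$, i.e. every vertex of $P$ lies in $S$ and no other point of $P$ lies in $S$. -}

module Defs where

open import Data.Nat using (ℕ; zero; suc)
open import Data.Nat.Primality using (Prime)
open import Data.Fin using (Fin; zero; suc)
open import Data.Product using (Σ; ∃; _×_; _,_; proj₁; proj₂)
open import Data.Integer using (+_)
open import Data.Rational using (ℚ; 0ℚ; 1ℚ; _+_; _*_; _≤_; _/_)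
open import Relation.Binary.PropositionalEquality using (_≡_)
open import Relation.Nullary using (¬_)

-- Points of ℤ² (here with natural coordinates suffice for vertices in ℙ²,
-- since primes are positive); a lattice point viewed in ℚ² ⊆ ℝ².
Point : Set
Point = ℕ × ℕ

toℚ : ℕ → ℚ
toℚ n = + n / 1

∑ : {k : ℕ} → (Fin k → ℚ) → ℚ
∑ {zero}  f = 0ℚ
∑ {suc k} f = f zero + ∑ (λ i → f (suc i))

InP² : Point → Set
InP² (p , q) = Prime p × Prime q

ConvComb : {k : ℕ} → (Fin k → Point) → (Fin k → ℚ) → Point → Set
ConvComb {k} v w x =
  (∀ i → 0ℚ ≤ w i) ×
  (∑ w ≡ 1ℚ) ×
  (∑ (λ i → w i * toℚ (proj₁ (v i))) ≡ toℚ (proj₁ x)) ×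
  (∑ (λ i → w i * toℚ (proj₂ (v i))) ≡ toℚ (proj₂ x))

InHull : {k : ℕ} → (Fin k → Point) → Point → Set
InHull v x = ∃ λ w → ConvComb v w x

-- v i is not in the convex hull of the other listed points
-- (so the v i are pairwise distinct and exactly the vertices of conv v)
IsVertex : {k : ℕ} → (Fin k → Point) → Fin k → Set
IsVertex v i = ¬ (∃ λ w → w i ≡ 0ℚ × ConvComb v w (v i))

EmptyPolygonInP² : {k : ℕ} → (Fin k → Point) → Set
EmptyPolygonInP² v =
  (∀ i → IsVertex v i) ×
  (∀ i → InP² (v i)) ×
  (∀ x → InP² x → InHull v x → ∃ λ i → v i ≡ x)

-- The polygon has vertices (xᵢ , yᵢ), i ≤ n, for two runs of consecutive primes whose gaps satisfy
-- y-gapᵢ = x-gapᵢ + d Λ ^ i with d ≥ 1. If Λ exceeds every ratio of x-gaps, the slopes increase; if d Σ Λ ^ i is smaller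
-- than every x-gap, the strip y₀ − x₀ ≤ Y − X ≤ yₙ − xₙ meets the prime grid in the vertices only.
-- Two such runs exist by the pigeonhole principle on gap patterns: a pattern of n gaps bounded by W lies on a line of
-- direction (1 , Λ , Λ² , …), and the lines, cut into segments of length τ, are fewer than W ^ n by almost a factor W.
-- Brun's pure sieve shows that below Y each pattern starts at O(Y / (log Y) ^ (n + 1 − ε)) places, while Chebyshev's bound
-- gives about Y / log Y starting places, so that some segment contains two different patterns.
module Submission where

open import Defs
open import Level using (0ℓ)
open import Data.Fin using (Fin; zero; suc; toℕ; fromℕ<)
import Data.Fin.Properties as Finₚ
import Data.Integer as ℤ
import Data.Integer.Properties as ℤₚ
open import Data.List using (List; []; _∷_; _++_; map; length; upTo; cartesianProductWith)
open import Data.List.Membership.Propositional using (_∈_)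
open import Data.List.Membership.Propositional.Properties using (∈-map⁺; ∈-cartesianProductWith⁺; ∈-upTo⁺; ∈-++⁺ˡ; ∈-++⁺ʳ)
open import Data.List.Properties using (≡-dec; map-id; length-++; length-map; length-upTo; ∷-injectiveˡ; ∷-injectiveʳ)
open import Data.List.Relation.Unary.All as All using (All; []; _∷_)
open import Data.List.Relation.Unary.All.Properties using (¬Any⇒All¬)
open import Data.List.Relation.Unary.AllPairs using (AllPairs; []; _∷_)
open import Data.List.Relation.Unary.Any as Any using (Any; here; there)
open import Data.Nat using (ℕ; zero; suc; pred; _+_; _*_; _∸_; _^_; _!; _≤_; _<_; _≤?_; _<?_; z≤n; s≤s; z<s; NonZero; nonTrivial⇒n>1; n>1⇒nonTrivial; >-nonZero; >-nonZero⁻¹)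
open import Data.Nat.Coprimality as Coprimality using (Coprime; coprime-Bézout; coprime-divisor; prime⇒coprime)
open import Data.Nat.Divisibility
open import Data.Nat.DivMod using (_/_; _%_; m≡m%n+[m/n]*n; m%n<n; m<n*o⇒m/o<n; m/n*n≤m; m/n/o≡m/[n*o]; /-congʳ; m*n/n≡m; /-monoˡ-≤)
open import Data.Nat.GCD using (module Bézout)
open import Data.Nat.Induction using (<-rec)
open import Data.Nat.ListAction using (sum; product)
open import Data.Nat.ListAction.Properties using (∈⇒∣product)
open import Data.Nat.Primality
open import Data.Nat.Properties
open import Data.List.Membership.DecPropositional (≡-dec _≟_) using (_∈?_)
open import Data.Nat.Tactic.RingSolver using (solve-∀)
open import Data.Product using (Σ; ∃; ∃₂; _×_; _,_; proj₁; proj₂)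
open import Data.Rational as ℚ using (ℚ; 0ℚ; 1ℚ; toℚᵘ)
import Data.Rational.Properties as ℚₚ
open import Data.Rational.Solver using (module +-*-Solver)
open import Data.Rational.Unnormalised as ℚᵘ using (mkℚᵘ; *≡*; *≤*)
import Data.Rational.Unnormalised.Properties as ℚᵘₚ
open import Data.Sum using (_⊎_; inj₁; inj₂)
open import Function using (id)
open import Relation.Binary.Definitions using (tri<; tri≈; tri>)
open import Relation.Binary.PropositionalEquality using (_≡_; _≢_; refl; sym; trans; cong; cong₂; subst; module ≡-Reasoning)
open import Relation.Nullary using (¬_; Dec; yes; no; contradiction)
open import Relation.Nullary.Decidable using (_×-dec_; _→-dec_; ¬?; decidable-stable)
open import Relation.Unary using (Pred; Decidable)

-- The pigeonhole gains only the factor `τ`, a fixed power of log Y, so the sieve may lose no more.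
-- Its constant depends on the pattern; therefore the primes dividing k! or a difference of two
-- offsets are left unsieved. There are few of them, and they cost a power of log log Y. The cutoff
-- z is fixed by the value of ∏ p/(p - 1), which is to be about `X`; Euler's comparison with the
-- harmonic series then gives z ≤ 2^(2X). The rounding error of the sieve is about z to a power r of
-- order log X, so X log X must stay below log Y. This is the origin of the ε: with log Y = U^(a +
-- 1) and X = U^a, each of the n + 1 primes of a run costs one factor `U`. A gap below `g` would
-- spoil both the convexity and the strip; patterns with such a gap form a share of order g / W and
-- are discarded. Everything takes place in the natural numbers: ratios appear with cleared
-- denominators, differences are moved to the other side, and a linear form with integer
-- coefficients becomes a comparison of two natural ones.

private variable
  P Q R : Pred ℕ 0ℓ

-- Finite sums and counting

⟦_⟧ : {A : Set} → Dec A → ℕ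
⟦ yes _ ⟧ = 1
⟦ no _ ⟧ = 0

⟦⟧-mono : {A B : Set} (a : Dec A) (b : Dec B) → (A → B) → ⟦ a ⟧ ≤ ⟦ b ⟧
⟦⟧-mono (no _) _ _ = z≤n
⟦⟧-mono (yes x) (yes _) _ = ≤-refl
⟦⟧-mono (yes x) (no ¬b) f = contradiction (f x) ¬b

⟦⟧≤1 : {A : Set} (a : Dec A) → ⟦ a ⟧ ≤ 1
⟦⟧≤1 (yes _) = ≤-refl
⟦⟧≤1 (no _) = z≤n

⟦⟧-yes : {A : Set} (a : Dec A) → A → ⟦ a ⟧ ≡ 1
⟦⟧-yes (yes _) _ = refl
⟦⟧-yes (no ¬a) a = contradiction a ¬a

⟦⟧-no : {A : Set} (a : Dec A) → ¬ A → ⟦ a ⟧ ≡ 0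
⟦⟧-no (no _) _ = refl
⟦⟧-no (yes a) ¬a = contradiction a ¬a

Σ< : ℕ → (ℕ → ℕ) → ℕ
Σ< zero f = 0
Σ< (suc n) f = Σ< n f + f n

Σ<-mono : ∀ n {f g} → (∀ i → i < n → f i ≤ g i) → Σ< n f ≤ Σ< n g
Σ<-mono zero h = z≤n
Σ<-mono (suc n) h = +-mono-≤ (Σ<-mono n λ i i<n → h i (m<n⇒m<1+n i<n)) (h n ≤-refl)

Σ<-cong : ∀ n {f g} → (∀ i → i < n → f i ≡ g i) → Σ< n f ≡ Σ< n g
Σ<-cong zero h = refl
Σ<-cong (suc n) h = cong₂ _+_ (Σ<-cong n λ i i<n → h i (m<n⇒m<1+n i<n)) (h n ≤-refl)

Σ<-+ : ∀ n f g → Σ< n (λ i → f i + g i) ≡ Σ< n f + Σ< n g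
Σ<-+ zero f g = refl
Σ<-+ (suc n) f g rewrite Σ<-+ n f g = lem (Σ< n f) (Σ< n g) (f n) (g n)
  where
  lem : ∀ a b c d → a + b + (c + d) ≡ a + c + (b + d)
  lem = solve-∀

Σ<-0 : ∀ n → Σ< n (λ _ → 0) ≡ 0
Σ<-0 zero = refl
Σ<-0 (suc n) = trans (+-identityʳ _) (Σ<-0 n)

Σ<-const : ∀ n c → Σ< n (λ _ → c) ≡ n * c
Σ<-const zero c = refl
Σ<-const (suc n) c = trans (cong (_+ c) (Σ<-const n c)) (+-comm (n * c) c)

Σ<-* : ∀ n c f → Σ< n (λ i → c * f i) ≡ c * Σ< n f
Σ<-* zero c f = sym (*-zeroʳ c)
Σ<-* (suc n) c f = trans (cong (_+ c * f n) (Σ<-* n c f)) (sym (*-distribˡ-+ c _ _))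

Σ<-split : ∀ m n f → Σ< (m + n) f ≡ Σ< m f + Σ< n (λ i → f (m + i))
Σ<-split m zero f rewrite +-identityʳ m = sym (+-identityʳ _)
Σ<-split m (suc n) f rewrite +-suc m n | Σ<-split m n f = +-assoc (Σ< m f) _ _

count : Decidable P → ℕ → ℕ
count P? n = Σ< n (λ t → ⟦ P? t ⟧)

count-mono : (P? : Decidable P) (Q? : Decidable Q) → ∀ n → (∀ t → t < n → P t → Q t) →
             count P? n ≤ count Q? n
count-mono P? Q? n h = Σ<-mono n λ t t<n → ⟦⟧-mono (P? t) (Q? t) (h t t<n)

count-⊎ : (P? : Decidable P) (Q? : Decidable Q) (R? : Decidable R) → ∀ n →
          (∀ t → t < n → P t → Q t ⊎ R t) → count P? n ≤ count Q? n + count R? n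
count-⊎ {P} {Q} {R} P? Q? R? n h =
  ≤-trans (Σ<-mono n pointwise) (≤-reflexive (Σ<-+ n _ _))
  where
  pointwise : ∀ t → t < n → ⟦ P? t ⟧ ≤ ⟦ Q? t ⟧ + ⟦ R? t ⟧
  pointwise t t<n with P? t
  ... | no _ = z≤n
  ... | yes p with h t t<n p
  ...   | inj₁ q = ≤-trans (≤-reflexive (sym (⟦⟧-yes (Q? t) q))) (m≤m+n _ _)
  ...   | inj₂ r = ≤-trans (≤-reflexive (sym (⟦⟧-yes (R? t) r))) (m≤n+m _ _)

count≤ : (P? : Decidable P) → ∀ n → count P? n ≤ n
count≤ P? zero = z≤n
count≤ P? (suc n) = ≤-trans (+-mono-≤ (count≤ P? n) (⟦⟧≤1 (P? n))) (≤-reflexive (+-comm n 1))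

count-∃ : (P? : Decidable P) → ∀ n → count P? n ≡ 0 ⊎ ∃ λ t → t < n × P t
count-∃ P? zero = inj₁ refl
count-∃ P? (suc n) with P? n | count-∃ P? n
... | yes p | _ = inj₂ (n , ≤-refl , p)
... | no _ | inj₁ e = inj₁ (trans (+-identityʳ _) e)
... | no _ | inj₂ (t , t<n , p) = inj₂ (t , m<n⇒m<1+n t<n , p)

-- Multiples of a number in an interval.

ceiling-unique : ∀ q j m .{{_ : NonZero q}} → j * q ≤ q * m → q * m < j * q + q → m ≡ j
ceiling-unique q j m l u = ≤-antisym
  (≤-pred (*-cancelˡ-< q _ _ (<-≤-trans u (≤-reflexive (lem j q)))))
  (*-cancelˡ-≤ q (≤-trans (≤-reflexive (*-comm q j)) l))
  where
  lem : ∀ j q → j * q + q ≡ q * suc j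
  lem = solve-∀

module _ (q : ℕ) where

  -- Zero is counted, so the value is ⌈x / q⌉. At a multiple x = j q it equals j, hence it also
  -- serves as the index of a multiple.
  multiples : ℕ → ℕ
  multiples = count (q ∣?_)

  multiples-bounds : .{{_ : NonZero q}} → ∀ x → x ≤ q * multiples x × q * multiples x < x + q
  multiples-bounds zero rewrite *-zeroʳ q = z≤n , >-nonZero⁻¹ q
  multiples-bounds (suc x) with q ∣? x | multiples-bounds x
  ... | no q∤x | l , u rewrite +-identityʳ (multiples x) =
    ≤∧≢⇒< l (λ e → q∤x (divides (multiples x) (trans e (*-comm q _)))) , m<n⇒m<1+n u
  ... | yes q∣x@(divides j refl) | l , u = ≤-trans (≤-reflexive (+-comm 1 x)) (≤-trans (+-monoʳ-≤ x (>-nonZero⁻¹ q)) (≤-reflexive (sym e))) , s≤s (≤-reflexive e)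
    where
    mj = ceiling-unique q j (multiples x) l u
    e : q * (multiples x + 1) ≡ j * q + q
    e rewrite mj = trans (*-distribˡ-+ q j 1) (cong₂ _+_ (*-comm q j) (*-identityʳ q))

  multiple-index : .{{_ : NonZero q}} → ∀ {x} → q ∣ x → x ≡ q * multiples x
  multiple-index {x} (divides j refl) = trans (*-comm j q) (cong (q *_) (sym
    (ceiling-unique q j (multiples x) (proj₁ (multiples-bounds x)) (proj₂ (multiples-bounds x)))))

  -- Difference of two ceilings, at c + Y and at c: the count is Y / q up to an error of 1, which
  -- becomes `q` once the denominator is cleared.
  class-count : .{{_ : NonZero q}} → ∀ c Y →
    q * count (λ t → q ∣? (t + c)) Y ≤ Y + q × Y ≤ q * count (λ t → q ∣? (t + c)) Y + q
  class-count c Y = upper , lower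
    where
    N = count (λ t → q ∣? (t + c)) Y
    eq : multiples (c + Y) ≡ multiples c + N
    eq = trans (Σ<-split c Y _) (cong (multiples c +_) (Σ<-cong Y λ i _ → cong (λ x → ⟦ q ∣? x ⟧) (+-comm c i)))
    eq' : q * multiples (c + Y) ≡ q * multiples c + q * N
    eq' = trans (cong (q *_) eq) (*-distribˡ-+ q _ _)
    upper : q * N ≤ Y + q
    upper = +-cancelˡ-≤ c _ _ (begin
      c + q * N ≤⟨ +-monoˡ-≤ _ (proj₁ (multiples-bounds c)) ⟩
      q * multiples c + q * N ≡⟨ eq' ⟨
      q * multiples (c + Y) ≤⟨ <⇒≤ (proj₂ (multiples-bounds (c + Y))) ⟩
      c + Y + q ≡⟨ +-assoc c Y q ⟩
      c + (Y + q) ∎) where open ≤-Reasoning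
    lower : Y ≤ q * N + q
    lower = +-cancelˡ-≤ c _ _ (begin
      c + Y ≤⟨ proj₁ (multiples-bounds (c + Y)) ⟩
      q * multiples (c + Y) ≡⟨ eq' ⟩
      q * multiples c + q * N ≤⟨ +-monoˡ-≤ _ (<⇒≤ (proj₂ (multiples-bounds c))) ⟩
      c + q + q * N ≡⟨ lem c q (q * N) ⟩
      c + (q * N + q) ∎)
      where
      open ≤-Reasoning
      lem : ∀ a b c → a + b + c ≡ a + (c + b)
      lem = solve-∀

-- Brun's sieve

inverse-mod : ∀ {p q} .{{_ : NonZero p}} .{{_ : NonZero q}} → Coprime q p → ∃₂ λ u v → 1 + u * p ≡ v * q
inverse-mod {suc p} {suc q} cop with coprime-Bézout cop
... | Bézout.+- x y eq = y , x , eq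
... | Bézout.-+ x zero ()
-- Here `x * suc q` ≡ -1 modulo `suc p`. Multiplying by `p` ≡ -1 corrects the sign, and `suc p` is
-- added to keep the other coefficient natural.
... | Bézout.-+ x (suc y) eq = (1 + y) * p + q , x * p + suc p ,
  +-cancelʳ-≡ p _ _ (trans (lem₁ p q y) (trans (cong (λ e → e * p + suc p * suc q) (sym eq)) (lem₂ p q x)))
  where
  lem₁ : ∀ p q y → 1 + ((1 + y) * p + q) * suc p + p ≡ suc y * suc p * p + suc p * suc q
  lem₁ = solve-∀
  lem₂ : ∀ p q x → (1 + x * suc q) * p + suc p * suc q ≡ (x * p + suc p) * suc q + p
  lem₂ = solve-∀

crt : ∀ {p q} .{{_ : NonZero p}} .{{_ : NonZero q}} → Coprime q p → ∀ c h →
      ∃ λ c′ → (∃ λ i → c′ ≡ c + i * q) × (∃ λ j → c′ ≡ h + j * p)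
crt {suc p} {q} cop c h with inverse-mod cop
... | u , v , eq = c + v * w * q , (v * w , refl) , (c + u * w ,
  trans (trans (lem₁ c v w q) (cong (λ e → c + e * w) (sym eq))) (lem₂ c u h p))
  where
  -- As `p` ≡ -1 modulo `suc p`, this is h - c; since v q ≡ 1, adding v w q carries c to h.
  w = h + c * p
  lem₁ : ∀ c v w q → c + v * w * q ≡ c + v * q * w
  lem₁ = solve-∀
  lem₂ : ∀ c u h p → c + (1 + u * suc p) * (h + c * p) ≡ h + (c + u * (h + c * p)) * suc p
  lem₂ = solve-∀

∣-shift : ∀ {p} t h j → p ∣ t + h → p ∣ t + (h + j * p)
∣-shift {p} t h j p∣ = subst (p ∣_) (+-assoc t h _) (∣m∣n⇒∣m+n p∣ (n∣m*n j))

∣-unshift : ∀ {p} t h j → p ∣ t + (h + j * p) → p ∣ t + h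
∣-unshift {p} t h j p∣ = ∣m+n∣m⇒∣n (subst (p ∣_) (trans (sym (+-assoc t h _)) (+-comm (t + h) _)) p∣) (n∣m*n j)

coprime-*-∣ : ∀ {q p x} → Coprime q p → q ∣ x → p ∣ x → q * p ∣ x
coprime-*-∣ {q} {p} cop (divides a refl) p∣ with coprime-divisor (Coprimality.sym cop) (subst (p ∣_) (*-comm a q) p∣)
... | divides b refl = divides b (trans (*-assoc b p q) (cong (b *_) (*-comm p q)))

coprime-*ˡ : ∀ {a b c} → Coprime a c → Coprime b c → Coprime (a * b) c
coprime-*ˡ {a} ac bc {d} (d∣ab , d∣c) =
  bc (coprime-divisor (λ (e∣d , e∣a) → ac (e∣a , ∣-trans e∣d d∣c)) d∣ab , d∣c)

coprime-*ʳ : ∀ {a b c} → Coprime a b → Coprime a c → Coprime a (b * c)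
coprime-*ʳ ab ac = Coprimality.sym (coprime-*ˡ (Coprimality.sym ab) (Coprimality.sym ac))

module Sieve (H : List ℕ) (Y : ℕ) where

  k : ℕ
  k = length H

  free : ℕ → ℕ → ℕ
  free p t = ⟦ All.all? (λ h → ¬? (p ∣? (t + h))) H ⟧

  sift : List ℕ → ℕ → ℕ
  sift [] t = 1
  sift (p ∷ Q) t = free p t * sift Q t

  -- The condition modulo `q` records the primes at which a shift has already been hit: `q` grows
  -- along the recursion while `Q` shrinks.
  S : ℕ → ℕ → List ℕ → ℕ
  S q c Q = Σ< Y (λ t → ⟦ q ∣? (t + c) ⟧ * sift Q t)

  -- Then `p` divides at most one of the numbers t + h, so there are no overlaps at `p` and it
  -- removes exactly `k` residue classes.
  Separates : ℕ → Set
  Separates p = AllPairs (λ h h′ → ∀ t → p ∣ t + h → ¬ p ∣ t + h′) H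

  sift≤1 : ∀ Q t → sift Q t ≤ 1
  sift≤1 [] t = ≤-refl
  sift≤1 (p ∷ Q) t = *-mono-≤ (⟦⟧≤1 (All.all? (λ h → ¬? (p ∣? (t + h))) H)) (sift≤1 Q t)

  hits : ℕ → ℕ → List ℕ → ℕ
  hits p t L = sum (map (λ h → ⟦ p ∣? (t + h) ⟧) L)

  free+hits : ∀ p t → Separates p → 1 ≡ free p t + hits p t H
  free+hits p t = go H
    where
    no-hits : ∀ L → All (λ h → ¬ p ∣ t + h) L → hits p t L ≡ 0
    no-hits [] [] = refl
    no-hits (h ∷ L) (n ∷ ns) = cong₂ _+_ (⟦⟧-no (p ∣? (t + h)) n) (no-hits L ns)
    go : ∀ L → AllPairs (λ h h′ → ∀ t → p ∣ t + h → ¬ p ∣ t + h′) L →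
         1 ≡ ⟦ All.all? (λ h → ¬? (p ∣? (t + h))) L ⟧ + hits p t L
    go [] [] = refl
    go (h ∷ L) (s ∷ ss) with p ∣? (t + h) | go L ss
    ... | yes d | _ = cong suc (sym (no-hits L (All.map (λ f → f t d) s)))
    ... | no ¬d | e with All.all? (λ h → ¬? (p ∣? (t + h))) L
    ...   | yes _ = e
    ...   | no _ = e

  S-hit : ℕ → ℕ → ℕ → ℕ → List ℕ → ℕ
  S-hit q c p h Q = Σ< Y (λ t → ⟦ q ∣? (t + c) ⟧ * ⟦ p ∣? (t + h) ⟧ * sift Q t)

  -- The two congruences combine to one class modulo q p, so the terms subtracted in the recursion
  -- are again values of `S`.
  S-hit-crt : ∀ {p q} .{{_ : NonZero p}} .{{_ : NonZero q}} → Coprime q p → ∀ c h Q →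
              ∃ λ c′ → S-hit q c p h Q ≡ S (q * p) c′ Q
  S-hit-crt {p} {q} cop c h Q with crt cop c h
  ... | c′ , (i , e₁) , (j , e₂) = c′ , Σ<-cong Y λ t _ → cong (_* sift Q t) (eq t)
    where
    eq : ∀ t → ⟦ q ∣? (t + c) ⟧ * ⟦ p ∣? (t + h) ⟧ ≡ ⟦ (q * p) ∣? (t + c′) ⟧
    eq t with q ∣? (t + c) | p ∣? (t + h)
    ... | yes a | yes b = sym (⟦⟧-yes ((q * p) ∣? (t + c′)) (coprime-*-∣ cop
            (subst (λ x → q ∣ t + x) (sym e₁) (∣-shift t c i a)) (subst (λ x → p ∣ t + x) (sym e₂) (∣-shift t h j b))))
    ... | no ¬a | _ = sym (⟦⟧-no ((q * p) ∣? (t + c′)) λ d →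
            ¬a (∣-unshift t c i (subst (λ x → q ∣ t + x) e₁ (m*n∣⇒m∣ q p d))))
    ... | yes _ | no ¬b = sym (⟦⟧-no ((q * p) ∣? (t + c′)) λ d →
            ¬b (∣-unshift t h j (subst (λ x → p ∣ t + x) e₂ (m*n∣⇒n∣ q p d))))

  -- Buchstab's identity: insert 1 = `free` + `hits` at every t and exchange the sums.
  S-step : ∀ q c p Q → Separates p →
           S q c Q ≡ S q c (p ∷ Q) + sum (map (λ h → S-hit q c p h Q) H)
  S-step q c p Q sep = trans (Σ<-cong Y (λ t _ → pointwise t)) (trans (Σ<-+ Y _ _) (cong (S q c (p ∷ Q) +_) (swap H)))
    where
    w : ℕ → ℕ
    w t = ⟦ q ∣? (t + c) ⟧
    hit : ℕ → ℕ → ℕ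
    hit t h = w t * ⟦ p ∣? (t + h) ⟧ * sift Q t
    swap : ∀ L → Σ< Y (λ t → sum (map (hit t) L)) ≡ sum (map (λ h → Σ< Y (λ t → hit t h)) L)
    swap [] = Σ<-0 Y
    swap (h ∷ L) = trans (Σ<-+ Y _ _) (cong (Σ< Y (λ t → hit t h) +_) (swap L))
    distrib : ∀ t L → w t * hits p t L * sift Q t ≡ sum (map (hit t) L)
    distrib t [] = cong (_* sift Q t) (*-zeroʳ (w t))
    distrib t (h ∷ L) = trans (lem (w t) ⟦ p ∣? (t + h) ⟧ (hits p t L) (sift Q t)) (cong (hit t h +_) (distrib t L))
      where
      lem : ∀ a b c d → a * (b + c) * d ≡ a * b * d + a * c * d
      lem = solve-∀
    pointwise : ∀ t → w t * sift Q t ≡ w t * (free p t * sift Q t) + sum (map (hit t) H)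
    pointwise t = begin
      w t * sift Q t ≡⟨ cong (w t *_) (trans (sym (*-identityˡ _)) (cong (_* sift Q t) (free+hits p t sep))) ⟩
      w t * ((free p t + hits p t H) * sift Q t) ≡⟨ lem (w t) (free p t) (hits p t H) (sift Q t) ⟩
      w t * (free p t * sift Q t) + w t * hits p t H * sift Q t ≡⟨ cong (w t * (free p t * sift Q t) +_) (distrib t H) ⟩
      w t * (free p t * sift Q t) + sum (map (hit t) H) ∎
      where
      open ≡-Reasoning
      lem : ∀ a b c d → a * ((b + c) * d) ≡ a * (b * d) + a * c * d
      lem = solve-∀

  -- V / Π is the expected density ∏ (1 - k/p). F / Π = ∏ (1 + 2k/p) is Rankin's majorant: the terms
  -- of the expansion with at least r primes sum to at most 2⁻ʳ F / Π.
  V F : List ℕ → ℕ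
  V Q = product (map (_∸ k) Q)
  F Q = product (map (_+ 2 * k) Q)

  Π : List ℕ → ℕ
  Π = product

  -- An expansion truncated at r primes has at most `E Q ^ r` terms, each with a rounding error of
  -- at most 1.
  E : List ℕ → ℕ
  E Q = 1 + k * length Q

  Π≤F : ∀ Q → Π Q ≤ F Q
  Π≤F [] = ≤-refl
  Π≤F (p ∷ Q) = *-mono-≤ (m≤m+n p _) (Π≤F Q)

  V≤Π : ∀ Q → V Q ≤ Π Q
  V≤Π [] = ≤-refl
  V≤Π (p ∷ Q) = *-mono-≤ (m∸n≤m p k) (V≤Π Q)

  S≤class : ∀ q c Q → S q c Q ≤ S q c []
  S≤class q c Q = Σ<-mono Y λ t _ → *-monoʳ-≤ ⟦ q ∣? (t + c) ⟧ (sift≤1 Q t)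

  S[]-upper : ∀ q .{{_ : NonZero q}} c → q * S q c [] ≤ Y + q
  S[]-upper q c = ≤-trans (≤-reflexive (cong (q *_) (Σ<-cong Y λ t _ → *-identityʳ _))) (proj₁ (class-count q c Y))

  S[]-lower : ∀ q .{{_ : NonZero q}} c → Y ≤ q * S q c [] + q
  S[]-lower q c = ≤-trans (proj₂ (class-count q c Y)) (≤-reflexive (cong (λ x → q * x + q) (Σ<-cong Y λ t _ → sym (*-identityʳ _))))

  Admissible : ℕ → Set
  Admissible p = NonZero p × k ≤ p × Separates p

  -- S q c Q is Y/q · V/Π up to Y/q · 2⁻ʳ F/Π and the rounding error E ^ r; denominators are cleared.
  Upper Lower : ℕ → ℕ → ℕ → List ℕ → Set
  Upper r q c Q = S q c Q * (q * Π Q) * 2 ^ r ≤ Y * (V Q * 2 ^ r + F Q) + q * Π Q * 2 ^ r * E Q ^ r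
  Lower r q c Q = Y * (V Q * 2 ^ r) ≤ S q c Q * (q * Π Q) * 2 ^ r + Y * F Q + q * Π Q * 2 ^ r * E Q ^ r

  -- Bonferroni's inequalities, by recursion on the depth `r` and on `Q`. By Buchstab's identity an
  -- upper bound at depth r + 1 for `p ∷ Q` needs lower bounds at depth r for the hits, and
  -- conversely. At depth 0 the sieve is dropped and the term `F` dominates.
  brun : ∀ r q c Q .{{_ : NonZero q}} → All Admissible Q → AllPairs Coprime Q → All (Coprime q) Q →
         Upper r q c Q × Lower r q c Q
  brun zero q c Q adm cop copq = upper , lower
    where
    open ≤-Reasoning
    upper : Upper 0 q c Q
    upper = begin
      S q c Q * (q * Π Q) * 1 ≤⟨ *-monoˡ-≤ 1 (*-monoˡ-≤ (q * Π Q) (S≤class q c Q)) ⟩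
      S q c [] * (q * Π Q) * 1 ≡⟨ lem (S q c []) q (Π Q) ⟩
      q * S q c [] * Π Q ≤⟨ *-monoˡ-≤ (Π Q) (S[]-upper q c) ⟩
      (Y + q) * Π Q ≡⟨ *-distribʳ-+ (Π Q) Y q ⟩
      Y * Π Q + q * Π Q ≤⟨ +-mono-≤ (*-monoʳ-≤ Y (≤-trans (Π≤F Q) (m≤n+m (F Q) (V Q * 1)))) (≤-reflexive (lem₂ (q * Π Q))) ⟩
      Y * (V Q * 1 + F Q) + q * Π Q * 1 * 1 ∎
      where
      lem : ∀ s q p → s * (q * p) * 1 ≡ q * s * p
      lem = solve-∀
      lem₂ : ∀ s → s ≡ s * 1 * 1
      lem₂ = solve-∀
    lower : Lower 0 q c Q
    lower = begin
      Y * (V Q * 1) ≡⟨ cong (Y *_) (*-identityʳ (V Q)) ⟩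
      Y * V Q ≤⟨ *-monoʳ-≤ Y (≤-trans (V≤Π Q) (Π≤F Q)) ⟩
      Y * F Q ≤⟨ m≤n+m _ _ ⟩
      S q c Q * (q * Π Q) * 1 + Y * F Q ≤⟨ m≤m+n _ _ ⟩
      S q c Q * (q * Π Q) * 1 + Y * F Q + q * Π Q * 1 * 1 ∎
  brun (suc r) q c [] [] [] [] rewrite *-zeroʳ k | ^-zeroˡ (suc r) | *-identityʳ q = upper , lower
    where
    open ≤-Reasoning
    T = 2 * 2 ^ r
    upper : S q c [] * q * T ≤ Y * (1 * T + 1) + q * T * 1
    upper = begin
      S q c [] * q * T ≤⟨ *-monoˡ-≤ T (≤-trans (≤-reflexive (*-comm (S q c []) q)) (S[]-upper q c)) ⟩
      (Y + q) * T ≤⟨ m≤m+n _ Y ⟩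
      (Y + q) * T + Y ≡⟨ lem Y q T ⟩
      Y * (1 * T + 1) + q * T * 1 ∎
      where
      lem : ∀ y q t → (y + q) * t + y ≡ y * (1 * t + 1) + q * t * 1
      lem = solve-∀
    lower : Y * (1 * T) ≤ S q c [] * q * T + Y * 1 + q * T * 1
    lower = begin
      Y * (1 * T) ≡⟨ cong (Y *_) (*-identityˡ T) ⟩
      Y * T ≤⟨ *-monoˡ-≤ T (S[]-lower q c) ⟩
      (q * S q c [] + q) * T ≤⟨ m≤m+n _ Y ⟩
      (q * S q c [] + q) * T + Y ≡⟨ lem Y q T (S q c []) ⟩
      S q c [] * q * T + Y * 1 + q * T * 1 ∎
      where
      lem : ∀ y q t s → (q * s + q) * t + y ≡ s * q * t + y * 1 + q * t * 1
      lem = solve-∀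
  brun (suc r) q c (p ∷ Q) ((nz , k≤p , sep) ∷ adm) (copp ∷ cop) (qp ∷ copq) = upper , lower
    where
    open ≤-Reasoning
    instance
      p≢0 : NonZero p
      p≢0 = nz
      qp≢0 : NonZero (q * p)
      qp≢0 = m*n≢0 q p
    p′ = p ∸ k
    p≡ : p ≡ p′ + k
    p≡ = sym (m∸n+n≡m k≤p)
    T = 2 ^ r
    A = q * p * Π Q * T
    e = E Q ^ r
    s = S q c Q
    s′ = S q c (p ∷ Q)
    hit : ℕ → ℕ
    hit h = S-hit q c p h Q
    s-eq : s ≡ s′ + sum (map hit H)
    s-eq = S-step q c p Q sep
    copqp : All (Coprime (q * p)) Q
    copqp = zip copq copp
      where
      zip : ∀ {L} → All (Coprime q) L → All (Coprime p) L → All (Coprime (q * p)) L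
      zip [] [] = []
      zip (a ∷ as) (b ∷ bs) = coprime-*ˡ a b ∷ zip as bs

    hit-bounds : ∀ h → hit h * A ≤ Y * (V Q * T + F Q) + A * e × Y * (V Q * T) ≤ hit h * A + Y * F Q + A * e
    hit-bounds h with S-hit-crt qp c h Q
    ... | c′ , eq with brun r (q * p) c′ Q adm cop copqp
    ...   | u , l rewrite eq =
            ≤-trans (≤-reflexive (sym (*-assoc (S (q * p) c′ Q) _ T))) u ,
            ≤-trans l (+-monoˡ-≤ _ (+-monoˡ-≤ _ (≤-reflexive (*-assoc (S (q * p) c′ Q) _ T))))

    hits-upper : ∀ L → sum (map hit L) * A ≤ length L * (Y * (V Q * T + F Q) + A * e)
    hits-upper [] = z≤n
    hits-upper (h ∷ L) = ≤-trans (≤-reflexive (*-distribʳ-+ A (hit h) _)) (+-mono-≤ (proj₁ (hit-bounds h)) (hits-upper L))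

    hits-lower : ∀ L → length L * (Y * (V Q * T)) ≤ sum (map hit L) * A + length L * (Y * F Q + A * e)
    hits-lower [] = z≤n
    hits-lower (h ∷ L) = ≤-trans (+-mono-≤ (proj₂ (hit-bounds h)) (hits-lower L))
      (≤-reflexive (lem (hit h) A (Y * F Q) (A * e) (sum (map hit L)) (length L * (Y * F Q + A * e))))
      where
      lem : ∀ h a f e s l → h * a + f + e + (s * a + l) ≡ (h + s) * a + (f + e + l)
      lem = solve-∀

    -- The terms without `p` at depth r + 1, together with those of the `k` hits at depth r, fit
    -- into the count for `p ∷ Q`.
    error : E Q ^ suc r + k * e ≤ E (p ∷ Q) ^ suc r
    error = begin
      E Q * e + k * e ≡⟨ *-distribʳ-+ e (E Q) k ⟨
      (E Q + k) * e ≤⟨ *-mono-≤ (≤-reflexive (lem k (length Q))) (^-monoˡ-≤ r (+-monoʳ-≤ 1 (*-monoʳ-≤ k (n≤1+n (length Q))))) ⟩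
      E (p ∷ Q) * E (p ∷ Q) ^ r ∎
      where
      lem : ∀ k l → 1 + k * l + k ≡ 1 + k * suc l
      lem = solve-∀

    upper : Upper (suc r) q c (p ∷ Q)
    -- The main terms of the `k` hits are added to both sides, so that (p - k) V = p V - k V is used
    -- without subtraction; `lower` proceeds likewise.
    upper = +-cancelʳ-≤ (k * (2 * (Y * (V Q * T)))) _ _ (begin
      s′ * (q * (p * Π Q)) * (2 * T) + k * (2 * (Y * (V Q * T)))
        ≡⟨ lem₁ s′ q p (Π Q) T k (Y * (V Q * T)) ⟩
      2 * (s′ * A) + 2 * (k * (Y * (V Q * T)))
        ≤⟨ +-monoʳ-≤ (2 * (s′ * A)) (*-monoʳ-≤ 2 (hits-lower H)) ⟩
      2 * (s′ * A) + 2 * (sum (map hit H) * A + k * (Y * F Q + A * e))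
        ≡⟨ lem₂ s′ A (sum (map hit H)) k (Y * F Q) e ⟩
      2 * ((s′ + sum (map hit H)) * A) + 2 * (k * (Y * F Q)) + 2 * A * (k * e)
        ≡⟨ cong (λ x → 2 * (x * A) + 2 * (k * (Y * F Q)) + 2 * A * (k * e)) s-eq ⟨
      2 * (s * A) + 2 * (k * (Y * F Q)) + 2 * A * (k * e)
        ≡⟨ cong (λ x → x + 2 * (k * (Y * F Q)) + 2 * A * (k * e)) (lem₃ s q p (Π Q) T) ⟩
      p * (s * (q * Π Q) * (2 * T)) + 2 * (k * (Y * F Q)) + 2 * A * (k * e)
        ≤⟨ +-monoˡ-≤ _ (+-monoˡ-≤ _ (*-monoʳ-≤ p (proj₁ (brun (suc r) q c Q adm cop copq)))) ⟩
      p * (Y * (V Q * (2 * T) + F Q) + q * Π Q * (2 * T) * E Q ^ suc r) + 2 * (k * (Y * F Q)) + 2 * A * (k * e)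
        ≡⟨ lem₄ p Y (V Q) T (F Q) q (Π Q) (E Q ^ suc r) k e ⟩
      p * (Y * V Q * (2 * T)) + Y * ((p + 2 * k) * F Q) + q * (p * Π Q) * (2 * T) * (E Q ^ suc r + k * e)
        ≤⟨ +-mono-≤ (+-monoˡ-≤ _ (*-monoˡ-≤ _ (≤-reflexive p≡))) (*-monoʳ-≤ (q * (p * Π Q) * (2 * T)) error) ⟩
      (p′ + k) * (Y * V Q * (2 * T)) + Y * ((p + 2 * k) * F Q) + q * (p * Π Q) * (2 * T) * E (p ∷ Q) ^ suc r
        ≡⟨ lem₅ p′ k Y (V Q) T ((p + 2 * k) * F Q) (q * (p * Π Q) * (2 * T) * E (p ∷ Q) ^ suc r) ⟩
      Y * (p′ * V Q * (2 * T) + (p + 2 * k) * F Q) + q * (p * Π Q) * (2 * T) * E (p ∷ Q) ^ suc r + k * (2 * (Y * (V Q * T))) ∎)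
      where
      lem₁ : ∀ s q p P t k v → s * (q * (p * P)) * (2 * t) + k * (2 * v) ≡ 2 * (s * (q * p * P * t)) + 2 * (k * v)
      lem₁ = solve-∀
      lem₂ : ∀ s a h k f e → 2 * (s * a) + 2 * (h * a + k * (f + a * e)) ≡ 2 * ((s + h) * a) + 2 * (k * f) + 2 * a * (k * e)
      lem₂ = solve-∀
      lem₃ : ∀ s q p P t → 2 * (s * (q * p * P * t)) ≡ p * (s * (q * P) * (2 * t))
      lem₃ = solve-∀
      lem₄ : ∀ p y v t f q P g k e → p * (y * (v * (2 * t) + f) + q * P * (2 * t) * g) + 2 * (k * (y * f)) + 2 * (q * p * P * t) * (k * e)
             ≡ p * (y * v * (2 * t)) + y * ((p + 2 * k) * f) + q * (p * P) * (2 * t) * (g + k * e)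
      lem₄ = solve-∀
      lem₅ : ∀ p k y v t f g → (p + k) * (y * v * (2 * t)) + y * f + g ≡ y * (p * v * (2 * t) + f) + g + k * (2 * (y * (v * t)))
      lem₅ = solve-∀

    lower : Lower (suc r) q c (p ∷ Q)
    lower = +-cancelʳ-≤ (k * (2 * (Y * (V Q * T)))) _ _ (begin
      Y * (p′ * V Q * (2 * T)) + k * (2 * (Y * (V Q * T)))
        ≡⟨ lem₁ p′ k Y (V Q) T ⟩
      (p′ + k) * (Y * (V Q * (2 * T)))
        ≡⟨ cong (_* (Y * (V Q * (2 * T)))) p≡ ⟨
      p * (Y * (V Q * (2 * T)))
        ≤⟨ *-monoʳ-≤ p (proj₂ (brun (suc r) q c Q adm cop copq)) ⟩
      p * (s * (q * Π Q) * (2 * T) + Y * F Q + q * Π Q * (2 * T) * E Q ^ suc r)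
        ≡⟨ lem₂ p s q (Π Q) T (Y * F Q) (E Q ^ suc r) ⟩
      2 * (s * A) + p * (Y * F Q) + q * (p * Π Q) * (2 * T) * E Q ^ suc r
        ≡⟨ cong (λ x → 2 * (x * A) + p * (Y * F Q) + q * (p * Π Q) * (2 * T) * E Q ^ suc r) s-eq ⟩
      2 * ((s′ + sum (map hit H)) * A) + p * (Y * F Q) + q * (p * Π Q) * (2 * T) * E Q ^ suc r
        ≡⟨ lem₃ s′ (sum (map hit H)) A (p * (Y * F Q)) (q * (p * Π Q) * (2 * T) * E Q ^ suc r) ⟩
      2 * (s′ * A) + 2 * (sum (map hit H) * A) + p * (Y * F Q) + q * (p * Π Q) * (2 * T) * E Q ^ suc r
        ≤⟨ +-monoˡ-≤ _ (+-monoˡ-≤ _ (+-monoʳ-≤ (2 * (s′ * A)) (*-monoʳ-≤ 2 (hits-upper H)))) ⟩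
      2 * (s′ * A) + 2 * (k * (Y * (V Q * T + F Q) + A * e)) + p * (Y * F Q) + q * (p * Π Q) * (2 * T) * E Q ^ suc r
        ≡⟨ lem₄ s′ q p (Π Q) T k Y (V Q) (F Q) e (E Q ^ suc r) ⟩
      s′ * (q * (p * Π Q)) * (2 * T) + Y * ((p + 2 * k) * F Q) + q * (p * Π Q) * (2 * T) * (E Q ^ suc r + k * e) + k * (2 * (Y * (V Q * T)))
        ≤⟨ +-monoˡ-≤ _ (+-monoʳ-≤ (s′ * (q * (p * Π Q)) * (2 * T) + Y * ((p + 2 * k) * F Q)) (*-monoʳ-≤ (q * (p * Π Q) * (2 * T)) error)) ⟩
      s′ * (q * (p * Π Q)) * (2 * T) + Y * ((p + 2 * k) * F Q) + q * (p * Π Q) * (2 * T) * E (p ∷ Q) ^ suc r + k * (2 * (Y * (V Q * T))) ∎)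
      where
      lem₁ : ∀ p k y v t → y * (p * v * (2 * t)) + k * (2 * (y * (v * t))) ≡ (p + k) * (y * (v * (2 * t)))
      lem₁ = solve-∀
      lem₂ : ∀ p s q P t f g → p * (s * (q * P) * (2 * t) + f + q * P * (2 * t) * g) ≡ 2 * (s * (q * p * P * t)) + p * f + q * (p * P) * (2 * t) * g
      lem₂ = solve-∀
      lem₃ : ∀ s h a f g → 2 * ((s + h) * a) + f + g ≡ 2 * (s * a) + 2 * (h * a) + f + g
      lem₃ = solve-∀
      lem₄ : ∀ s q p P t k y v f e g → 2 * (s * (q * p * P * t)) + 2 * (k * (y * (v * t + f) + q * p * P * t * e)) + p * (y * f) + q * (p * P) * (2 * t) * g
             ≡ s * (q * (p * P)) * (2 * t) + y * ((p + 2 * k) * f) + q * (p * P) * (2 * t) * (g + k * e) + k * (2 * (y * (v * t)))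
      lem₄ = solve-∀

-- Products over primes and Euler's lower bound

prime>1 : ∀ {p} → Prime p → 1 < p
prime>1 {p} pp = nonTrivial⇒n>1 p {{prime⇒nonTrivial pp}}

prime-divisor : ∀ m → 1 < m → ∃ λ p → Prime p × p ∣ m
prime-divisor = <-rec (λ m → 1 < m → ∃ λ p → Prime p × p ∣ m) step
  where
  step : ∀ m → (∀ {d} → d < m → 1 < d → ∃ λ p → Prime p × p ∣ d) → 1 < m → ∃ λ p → Prime p × p ∣ m
  step m rec m>1 with prime? m
  ... | yes pm = m , pm , ∣-refl
  ... | no ¬pm with ¬prime⇒composite {{n>1⇒nonTrivial m>1}} ¬pm
  ...   | composite {d} d<m d∣m with rec d<m (nonTrivial⇒n>1 d)
  ...     | p , pp , p∣d = p , pp , ∣-trans p∣d d∣m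

prime-coprime : ∀ {p q} → Prime p → Prime q → q < p → Coprime p q
prime-coprime {p} {q} pp pq q<p = prime⇒coprime pp {{prime⇒nonZero pq}} q<p

*-^ : ∀ m n o → (m * n) ^ o ≡ m ^ o * n ^ o
*-^ m n zero = refl
*-^ m n (suc o) = trans (cong (m * n *_) (*-^ m n o)) (lem m n (m ^ o) (n ^ o))
  where
  lem : ∀ a b c d → a * b * (c * d) ≡ a * c * (b * d)
  lem = solve-∀

select : Decidable P → ℕ → List ℕ
select P? zero = []
select P? (suc z) with P? (suc z)
... | yes _ = suc z ∷ select P? z
... | no _ = select P? z

select-all : (P? : Decidable P) → ∀ z → All (λ p → P p × p ≤ z) (select P? z)
select-all P? zero = []
select-all P? (suc z) with P? (suc z) | All.map (λ (a , b) → a , m≤n⇒m≤1+n b) (select-all P? z)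
... | yes a | as = (a , ≤-refl) ∷ as
... | no _ | as = as

select-pairs : (P? : Decidable P) → ∀ {T : ℕ → ℕ → Set} → (∀ {p q} → P p → P q → q < p → T p q) →
               ∀ z → AllPairs T (select P? z)
select-pairs P? f zero = []
select-pairs P? f (suc z) with P? (suc z)
... | yes a = All.map (λ (b , le) → f a b (s≤s le)) (select-all P? z) ∷ select-pairs P? f z
... | no _ = select-pairs P? f z

length-select : (P? : Decidable P) → (∀ {p} → P p → 1 < p) → ∀ z → length (select P? z) ≤ pred z
length-select P? >1 zero = z≤n
length-select P? >1 (suc z) with P? (suc z)
... | yes a = ≤-trans (s≤s (length-select P? >1 z)) (≤-reflexive (suc-pred z {{>-nonZero (≤-pred (>1 a))}}))
... | no _ = ≤-trans (length-select P? >1 z) pred[n]≤n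

length-select≤ : (P? : Decidable P) → ∀ z → length (select P? z) ≤ z
length-select≤ P? zero = z≤n
length-select≤ P? (suc z) with P? (suc z)
... | yes _ = s≤s (length-select≤ P? z)
... | no _ = m≤n⇒m≤1+n (length-select≤ P? z)

φ : List ℕ → ℕ
φ Q = product (map pred Q)

-- Worst case: the elements are 2, 3, …, B + 1.
product≤φ : (P? : Decidable P) → (∀ {p} → P p → 1 < p) → ∀ z →
            product (select P? z) ≤ suc (length (select P? z)) * φ (select P? z)
product≤φ P? >1 zero = s≤s z≤n
product≤φ P? >1 (suc z) with P? (suc z)
... | no _ = product≤φ P? >1 z
... | yes a = begin
  suc z * product L ≤⟨ *-monoʳ-≤ (suc z) (product≤φ P? >1 z) ⟩
  suc z * (suc l * φ L) ≡⟨ lem₁ z l (φ L) ⟩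
  (l * z + z + suc l) * φ L ≤⟨ *-monoˡ-≤ (φ L) (+-monoʳ-≤ (l * z + z) l<z) ⟩
  (l * z + z + z) * φ L ≡⟨ lem₂ z l (φ L) ⟩
  suc (suc l) * (z * φ L) ∎
  where
  open ≤-Reasoning
  L = select P? z
  l = length L
  l<z : l < z
  l<z = ≤-trans (s≤s (length-select P? >1 z)) (≤-reflexive (suc-pred z {{>-nonZero (≤-pred (>1 a))}}))
  lem₁ : ∀ z l f → suc z * (suc l * f) ≡ (l * z + z + suc l) * f
  lem₁ = solve-∀
  lem₂ : ∀ z l f → (l * z + z + z) * f ≡ suc (suc l) * (z * f)
  lem₂ = solve-∀

coprime-product : ∀ {p Q} → All (Coprime p) Q → Coprime p (product Q)
coprime-product [] = Coprimality.sym (λ (d∣1 , _) → ∣1⇒≡1 d∣1)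
coprime-product (c ∷ cs) = coprime-*ʳ c (coprime-product cs)

product-∣ : ∀ {Q D} → AllPairs Coprime Q → All (_∣ D) Q → product Q ∣ D
product-∣ [] [] = 1∣ _
product-∣ (c ∷ cs) (d ∷ ds) = coprime-*-∣ (coprime-product c) d (product-∣ cs ds)

2^length≤product : ∀ {Q} → All (1 <_) Q → 2 ^ length Q ≤ product Q
2^length≤product [] = ≤-refl
2^length≤product (p ∷ ps) = *-mono-≤ p (2^length≤product ps)

φ>0 : ∀ {Q} → All (1 <_) Q → 0 < φ Q
φ>0 [] = z<s
φ>0 (s≤s p ∷ ps) = *-mono-≤ p (φ>0 ps)

φ≤product : ∀ Q → φ Q ≤ product Q
φ≤product [] = ≤-refl
φ≤product (p ∷ ps) = *-mono-≤ (pred[n]≤n {p}) (φ≤product ps)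

primes≤ : ℕ → List ℕ
primes≤ = select prime?

-- Euler: ∏_{p ≤ z} p/(p − 1) ≥ Σ_{m} 1/m over z-smooth m; the weight ⌊D/m⌋ replaces 1/m.
module Euler (D N : ℕ) where

  weight : ℕ → ℕ
  weight zero = 0
  weight (suc m) = D / suc m

  Smooth : ℕ → ℕ → Set
  Smooth z m = ∀ {p} → p < suc m → Prime p × p ∣ m → p ≤ z

  smooth? : ∀ z → Decidable (Smooth z)
  smooth? z m = allUpTo? (λ p → (prime? p ×-dec p ∣? m) →-dec p ≤? z) (suc m)

  g : ℕ → ℕ → ℕ
  g z m = ⟦ smooth? z m ⟧ * weight m

  T : ℕ → ℕ
  T z = Σ< N (g z)

  weight-* : ∀ p m → p * weight (p * m) ≤ weight m
  weight-* zero m = z≤n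
  weight-* (suc p) zero rewrite *-zeroʳ p = ≤-reflexive (*-zeroʳ p)
  weight-* (suc p) (suc m) = ≤-trans (≤-reflexive (cong (suc p *_) e)) (≤-trans (≤-reflexive (*-comm (suc p) (D / suc m / suc p))) (m/n*n≤m (D / suc m) (suc p)))
    where
    e : D / (suc p * suc m) ≡ D / suc m / suc p
    e = trans (/-congʳ {m = D} (*-comm (suc p) (suc m))) (sym (m/n/o≡m/[n*o] D (suc m) (suc p)))

  smooth-divisor : ∀ {z p m} → 0 < m → p ∣ m → Smooth z m → Prime p → p ≤ z
  smooth-divisor {m = suc m} _ p∣m sm pp = sm (s≤s (∣⇒≤ p∣m)) (pp , p∣m)

  Σ<-multiples : ∀ p f n → Σ< n (λ m → ⟦ p ∣? m ⟧ * f (multiples p m)) ≡ Σ< (multiples p n) f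
  Σ<-multiples p f zero = refl
  Σ<-multiples p f (suc n) with p ∣? n | Σ<-multiples p f n
  ... | yes _ | e rewrite +-comm (multiples p n) 1 | +-identityʳ (f (multiples p n)) = cong (_+ f (multiples p n)) e
  ... | no _ | e rewrite +-identityʳ (multiples p n) = trans (+-identityʳ _) e

  Σ<-≤ : ∀ {m n} f → m ≤ n → Σ< m f ≤ Σ< n f
  Σ<-≤ {m} {n} f m≤n = subst (λ x → Σ< m f ≤ Σ< x f) (m+[n∸m]≡n m≤n) (≤-trans (m≤m+n _ _) (≤-reflexive (sym (Σ<-split m (n ∸ m) f))))

  -- Division by `p` sends the p-smooth multiples of `p` injectively to p-smooth numbers and
  -- multiplies the weight by at least `p`.
  multiples-part : ∀ p .{{_ : NonZero p}} → p * Σ< N (λ m → ⟦ p ∣? m ⟧ * g p m) ≤ T p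
  multiples-part p = begin
    p * Σ< N (λ m → ⟦ p ∣? m ⟧ * g p m) ≡⟨ Σ<-* N p _ ⟨
    Σ< N (λ m → p * (⟦ p ∣? m ⟧ * g p m)) ≤⟨ Σ<-mono N (λ m _ → pointwise m) ⟩
    Σ< N (λ m → ⟦ p ∣? m ⟧ * g p (multiples p m)) ≡⟨ Σ<-multiples p (g p) N ⟩
    Σ< (multiples p N) (g p) ≤⟨ Σ<-≤ (g p) (count≤ (p ∣?_) N) ⟩
    T p ∎
    where
    open ≤-Reasoning
    pointwise : ∀ m → p * (⟦ p ∣? m ⟧ * g p m) ≤ ⟦ p ∣? m ⟧ * g p (multiples p m)
    pointwise zero with p ∣? 0
    ... | yes _ = ≤-trans (≤-reflexive (lem p ⟦ smooth? p 0 ⟧)) z≤n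
      where
      lem : ∀ p s → p * (1 * (s * 0)) ≡ 0
      lem = solve-∀
    ... | no ¬d = contradiction (p ∣0) ¬d
    pointwise m@(suc _) with p ∣? m
    ... | no _ = ≤-reflexive (*-zeroʳ p)
    ... | yes p∣m = ≤-trans (≤-reflexive (lem p ⟦ smooth? p m ⟧ (weight m)))
            (*-monoʳ-≤ 1 (*-mono-≤ (⟦⟧-mono (smooth? p m) (smooth? p m′) sm)
              (subst (λ x → p * weight x ≤ weight m′) (sym e) (weight-* p m′))))
      where
      m′ = multiples p m
      e : m ≡ p * m′
      e = multiple-index p p∣m
      m′∣m : m′ ∣ m
      m′∣m = divides p e
      sm : Smooth p m → Smooth p m′
      sm f _ (pq , q∣m′) = smooth-divisor z<s (∣-trans q∣m′ m′∣m) f pq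
      lem : ∀ p s w → p * (1 * (s * w)) ≡ 1 * (s * (p * w))
      lem = solve-∀

  -- With p = z + 1, a p-smooth number is z-smooth or a multiple of p, and the multiples carry at
  -- most a share 1/p of T p. Hence the prime contributes at most its Euler factor p/(p - 1).
  T-prime : ∀ z → Prime (suc z) → z * T (suc z) ≤ suc z * T z
  T-prime z pp = +-cancelˡ-≤ (T p) _ _ (begin
    p * T p ≤⟨ *-monoʳ-≤ p (≤-trans (Σ<-mono N λ m _ → pointwise m) (≤-reflexive (Σ<-+ N _ _))) ⟩
    p * (T z + M) ≡⟨ *-distribˡ-+ p (T z) M ⟩
    p * T z + p * M ≤⟨ +-monoʳ-≤ (p * T z) (multiples-part p) ⟩
    p * T z + T p ≡⟨ +-comm (p * T z) (T p) ⟩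
    T p + p * T z ∎)
    where
    open ≤-Reasoning
    p = suc z
    M = Σ< N (λ m → ⟦ p ∣? m ⟧ * g p m)
    pointwise : ∀ m → g p m ≤ g z m + ⟦ p ∣? m ⟧ * g p m
    pointwise m with p ∣? m
    ... | yes _ = ≤-trans (≤-reflexive (sym (*-identityˡ (g p m)))) (m≤n+m _ (g z m))
    ... | no ¬d = ≤-trans (*-monoˡ-≤ (weight m) (⟦⟧-mono (smooth? p m) (smooth? z m) sm)) (m≤m+n _ _)
      where
      sm : Smooth p m → Smooth z m
      sm f {q} q< (pq , q∣m) = ≤-pred (≤∧≢⇒< (f q< (pq , q∣m)) (λ { refl → ¬d q∣m }))

  T-composite : ∀ z → ¬ Prime (suc z) → T (suc z) ≤ T z
  T-composite z ¬p = Σ<-mono N λ m _ → *-monoˡ-≤ (weight m) (⟦⟧-mono (smooth? (suc z) m) (smooth? z m)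
    λ f q< (pq , q∣m) → ≤-pred (≤∧≢⇒< (f q< (pq , q∣m)) (λ { refl → ¬p pq })))

  T-0 : T 0 ≤ D
  T-0 = ≤-trans (Σ<-mono N λ m _ → pointwise m) (delta N)
    where
    e : ℕ → ℕ
    e 1 = D
    e _ = 0
    delta : ∀ n → Σ< n e ≤ D
    delta 0 = z≤n
    delta 1 = z≤n
    delta 2 = ≤-refl
    delta (suc (suc (suc n))) = ≤-trans (≤-reflexive (+-identityʳ _)) (delta (suc (suc n)))
    pointwise : ∀ m → g 0 m ≤ e m
    pointwise 0 = ≤-reflexive (*-zeroʳ ⟦ smooth? 0 0 ⟧)
    pointwise 1 = ≤-trans (*-mono-≤ (⟦⟧≤1 (smooth? 0 1)) (≤-trans (≤-reflexive (sym (*-identityʳ (D / 1)))) (m/n*n≤m D 1))) (≤-reflexive (*-identityˡ D))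
    pointwise m@(suc (suc _)) with prime-divisor m (s≤s (s≤s z≤n))
    ... | p , pp , p∣m = ≤-reflexive (cong (_* weight m) (⟦⟧-no (smooth? 0 m)
            λ f → <⇒≱ (prime>1 pp) (≤-trans (smooth-divisor z<s p∣m f pp) z≤n)))

  euler : ∀ z → φ (primes≤ z) * T z ≤ product (primes≤ z) * D
  euler zero = *-monoʳ-≤ 1 T-0
  euler (suc z) with prime? (suc z)
  ... | no ¬p = ≤-trans (*-monoʳ-≤ (φ (primes≤ z)) (T-composite z ¬p)) (euler z)
  ... | yes p = begin
    z * φ (primes≤ z) * T (suc z) ≡⟨ lem₁ z (φ (primes≤ z)) (T (suc z)) ⟩
    φ (primes≤ z) * (z * T (suc z)) ≤⟨ *-monoʳ-≤ (φ (primes≤ z)) (T-prime z p) ⟩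
    φ (primes≤ z) * (suc z * T z) ≡⟨ lem₂ z (φ (primes≤ z)) (T z) ⟩
    suc z * (φ (primes≤ z) * T z) ≤⟨ *-monoʳ-≤ (suc z) (euler z) ⟩
    suc z * (product (primes≤ z) * D) ≡⟨ *-assoc (suc z) (product (primes≤ z)) D ⟨
    suc z * product (primes≤ z) * D ∎
    where
    open ≤-Reasoning
    lem₁ : ∀ a b c → a * b * c ≡ b * (a * c)
    lem₁ = solve-∀
    lem₂ : ∀ a b c → b * (suc a * c) ≡ suc a * (b * c)
    lem₂ = solve-∀

  T-all : ∀ z → N ≤ suc z → Σ< N weight ≤ T z
  T-all z N≤z = Σ<-mono N λ m m<N → ≤-reflexive (trans (sym (*-identityˡ (weight m)))
    (cong (_* weight m) (sym (⟦⟧-yes (smooth? z m) λ p< _ → ≤-pred (≤-trans p< (≤-trans m<N N≤z))))))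

-- Oresme's dyadic blocks: the block starting at 2^j has 2^j terms, each at least 2^(Z - j). With
-- the numerator 2^(Z + 1) this lower bound is an integer, so the floors cost nothing.
harmonic : ∀ Z j → j ≤ suc Z → j * 2 ^ Z ≤ Σ< (2 ^ j) (Euler.weight (2 ^ suc Z) 0)
harmonic Z zero _ = z≤n
harmonic Z (suc j) (s≤s j≤Z) = begin
  2 ^ Z + j * 2 ^ Z ≡⟨ +-comm (2 ^ Z) _ ⟩
  j * 2 ^ Z + 2 ^ Z ≤⟨ +-mono-≤ (harmonic Z j (m≤n⇒m≤1+n j≤Z)) block ⟩
  Σ< (2 ^ j) w + Σ< (2 ^ j) (λ i → w (2 ^ j + i)) ≡⟨ Σ<-split (2 ^ j) (2 ^ j) w ⟨
  Σ< (2 ^ j + 2 ^ j) w ≡⟨ cong (λ x → Σ< (2 ^ j + x) w) (+-identityʳ (2 ^ j)) ⟨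
  Σ< (2 ^ suc j) w ∎
  where
  open ≤-Reasoning
  w = Euler.weight (2 ^ suc Z) 0
  Z≡ : Z ≡ j + (Z ∸ j)
  Z≡ = sym (m+[n∸m]≡n j≤Z)
  weight-≥ : ∀ m c → 0 < m → c * m ≤ 2 ^ suc Z → c ≤ w m
  weight-≥ (suc m) c _ le = ≤-trans (≤-reflexive (sym (m*n/n≡m c (suc m)))) (/-monoˡ-≤ (suc m) le)
  bound : ∀ i → i < 2 ^ j → 2 ^ (Z ∸ j) ≤ w (2 ^ j + i)
  bound i i< = weight-≥ (2 ^ j + i) _ (≤-trans (m^n>0 2 j) (m≤m+n _ i)) (begin
    2 ^ (Z ∸ j) * (2 ^ j + i) ≤⟨ *-monoʳ-≤ (2 ^ (Z ∸ j)) (+-monoʳ-≤ (2 ^ j) (<⇒≤ i<)) ⟩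
    2 ^ (Z ∸ j) * (2 ^ j + 2 ^ j) ≡⟨ lem (2 ^ (Z ∸ j)) (2 ^ j) ⟩
    2 * (2 ^ j * 2 ^ (Z ∸ j)) ≡⟨ cong (2 *_) (^-distribˡ-+-* 2 j (Z ∸ j)) ⟨
    2 * 2 ^ (j + (Z ∸ j)) ≡⟨ cong (λ x → 2 * 2 ^ x) Z≡ ⟨
    2 * 2 ^ Z ∎)
    where
    lem : ∀ a b → a * (b + b) ≡ 2 * (b * a)
    lem = solve-∀
  block : 2 ^ Z ≤ Σ< (2 ^ j) (λ i → w (2 ^ j + i))
  block = begin
    2 ^ Z ≡⟨ cong (2 ^_) Z≡ ⟩
    2 ^ (j + (Z ∸ j)) ≡⟨ ^-distribˡ-+-* 2 j (Z ∸ j) ⟩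
    2 ^ j * 2 ^ (Z ∸ j) ≡⟨ Σ<-const (2 ^ j) _ ⟨
    Σ< (2 ^ j) (λ _ → 2 ^ (Z ∸ j)) ≤⟨ Σ<-mono (2 ^ j) bound ⟩
    Σ< (2 ^ j) (λ i → w (2 ^ j + i)) ∎

euler-bound : ∀ Z → Z * φ (primes≤ (2 ^ Z)) ≤ 2 * product (primes≤ (2 ^ Z))
euler-bound zero = z≤n
euler-bound Z@(suc Z′) = *-cancelʳ-≤ _ _ (2 ^ Z′) {{m^n≢0 2 Z′}} (begin
  Z * f * 2 ^ Z′ ≡⟨ lem Z f (2 ^ Z′) ⟩
  f * (Z * 2 ^ Z′) ≤⟨ *-monoʳ-≤ f (≤-trans (harmonic Z′ Z ≤-refl) (≤-trans (≤-reflexive weights) (T-all z (n≤1+n z)))) ⟩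
  f * T z ≤⟨ euler z ⟩
  product (primes≤ z) * (2 * 2 ^ Z′) ≡⟨ lem₂ (product (primes≤ z)) (2 ^ Z′) ⟩
  2 * product (primes≤ z) * 2 ^ Z′ ∎)
  where
  open ≤-Reasoning
  z = 2 ^ Z
  f = φ (primes≤ z)
  open Euler (2 ^ Z) z
  weights : Σ< z (Euler.weight (2 ^ Z) 0) ≡ Σ< z weight
  weights = Σ<-cong z λ { zero _ → refl ; (suc m) _ → refl }
  lem : ∀ a b c → a * b * c ≡ b * (a * c)
  lem = solve-∀
  lem₂ : ∀ a b → a * (2 * b) ≡ 2 * a * b
  lem₂ = solve-∀

-- The least z with ∏ p/(p − 1) ≥ X does not overshoot by more than a factor 2, since p/(p − 1) ≤ 2.
level : ∀ X → 0 < X → ∃ λ z → z ≤ 2 ^ (2 * X) × X * φ (primes≤ z) ≤ product (primes≤ z) × product (primes≤ z) ≤ 2 * X * φ (primes≤ z)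
level X X>0 with go (2 ^ (2 * X))
  where
  go : ∀ z → (∃ λ y → y ≤ z × X * φ (primes≤ y) ≤ product (primes≤ y) × product (primes≤ y) ≤ 2 * X * φ (primes≤ y))
           ⊎ product (primes≤ z) < X * φ (primes≤ z)
  go zero with 1 <? X * 1
  ... | yes l = inj₂ l
  ... | no ¬l = inj₁ (0 , ≤-refl , ≮⇒≥ ¬l , ≤-trans (*-mono-≤ X>0 ≤-refl) (*-monoˡ-≤ 1 (m≤n*m X 2)))
  go (suc z) with go z
  ... | inj₁ (y , y≤z , p) = inj₁ (y , m≤n⇒m≤1+n y≤z , p)
  ... | inj₂ l with prime? (suc z)
  ...   | no _ = inj₂ l
  ...   | yes pp with suc z * product (primes≤ z) <? X * (z * φ (primes≤ z))
  ...     | yes l′ = inj₂ l′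
  ...     | no ¬l = inj₁ (suc z , ≤-refl , found)
    where
    found : X * φ (primes≤ (suc z)) ≤ product (primes≤ (suc z)) × product (primes≤ (suc z)) ≤ 2 * X * φ (primes≤ (suc z))
    found with prime? (suc z)
    ... | no ¬p = contradiction pp ¬p
    ... | yes _ = ≮⇒≥ ¬l , (begin
      suc z * product (primes≤ z) ≤⟨ *-mono-≤ {suc z} {2 * z} (+-mono-≤ (≤-pred (prime>1 pp)) (≤-reflexive (sym (+-identityʳ z)))) (<⇒≤ l) ⟩
      2 * z * (X * φ (primes≤ z)) ≡⟨ lem z X (φ (primes≤ z)) ⟩
      2 * X * (z * φ (primes≤ z)) ∎)
      where
      open ≤-Reasoning
      lem : ∀ a b c → 2 * a * (b * c) ≡ 2 * b * (a * c)
      lem = solve-∀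
... | inj₁ r = r
-- At 2^(2X) the product is at least `X` by `euler-bound`, so the search cannot come back empty.
... | inj₂ l = contradiction (euler-bound (2 * X)) (<⇒≱ (≤-trans (*-monoʳ-< 2 l) (≤-reflexive (sym (*-assoc 2 X _)))))

-- Counting prime tuples

-- Cleared form of 1 - k/p ≤ (1 - 1/p)^k; it bounds the density `V` by a power of `φ`.
bernoulli : ∀ p .{{_ : NonZero p}} k → (p ∸ k) * p ^ k ≤ pred p ^ k * p
bernoulli p zero = ≤-reflexive (*-comm p 1)
bernoulli p@(suc p′) (suc k) = begin
  (p ∸ suc k) * (p * p ^ k) ≡⟨ *-assoc (p ∸ suc k) p (p ^ k) ⟨
  (p ∸ suc k) * p * p ^ k ≤⟨ *-monoˡ-≤ (p ^ k) step ⟩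
  p′ * (p ∸ k) * p ^ k ≡⟨ *-assoc p′ (p ∸ k) (p ^ k) ⟩
  p′ * ((p ∸ k) * p ^ k) ≤⟨ *-monoʳ-≤ p′ (bernoulli p k) ⟩
  p′ * (p′ ^ k * p) ≡⟨ *-assoc p′ (p′ ^ k) p ⟨
  p′ * p′ ^ k * p ∎
  where
  open ≤-Reasoning
  step : (p′ ∸ k) * p ≤ p′ * (p ∸ k)
  step with k ≤? p′
  ... | yes k≤p′ = ≤-trans (≤-reflexive (*-suc (p′ ∸ k) p′)) (≤-trans (+-monoˡ-≤ _ (m∸n≤m p′ k))
        (≤-reflexive (trans (lem p′ (p′ ∸ k)) (cong (p′ *_) (sym (+-∸-assoc 1 k≤p′))))))
    where
    lem : ∀ a b → a + b * a ≡ a * suc b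
    lem = solve-∀
  ... | no k≰p′ rewrite m≤n⇒m∸n≡0 (<⇒≤ (≰⇒> k≰p′)) = z≤n

-- Cleared form of 1 + m/p ≤ (1 - 1/p)^(-m), applied to `F` with m = 2k.
bernoulli′ : ∀ p m → (p + m) * pred p ^ m ≤ p ^ m * p
bernoulli′ p zero = ≤-reflexive (lem p)
  where
  lem : ∀ p → (p + 0) * 1 ≡ 1 * p
  lem = solve-∀
bernoulli′ zero (suc m) = ≤-reflexive (*-zeroʳ (suc m))
bernoulli′ p@(suc p′) (suc m) = begin
  (p + suc m) * (p′ * p′ ^ m) ≤⟨ m≤m+n _ ((m + 1) * p′ ^ m) ⟩
  (p + suc m) * (p′ * p′ ^ m) + (m + 1) * p′ ^ m ≡⟨ lem p′ m (p′ ^ m) ⟩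
  p * ((p + m) * p′ ^ m) ≤⟨ *-monoʳ-≤ p (bernoulli′ p m) ⟩
  p * (p ^ m * p) ≡⟨ *-assoc p (p ^ m) p ⟨
  p * p ^ m * p ∎
  where
  open ≤-Reasoning
  lem : ∀ p m x → (suc p + suc m) * (p * x) + (m + 1) * x ≡ suc p * ((suc p + m) * x)
  lem = solve-∀

coprime-1 : ∀ Q → All (Coprime 1) Q
coprime-1 [] = []
coprime-1 (_ ∷ Q) = (λ (d∣1 , _) → ∣1⇒≡1 d∣1) ∷ coprime-1 Q

module _ (D : ℕ) where

  -- In the application `D` is k! times the product of the differences of the shifts, so the primes
  -- left out of the sieve are those up to k and those at which two shifts can collide.
  Sifting Dividing : ℕ → Set
  Sifting p = Prime p × ¬ p ∣ D
  Dividing p = Prime p × p ∣ D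

  sifting? : Decidable Sifting
  sifting? p = prime? p ×-dec ¬? (p ∣? D)

  dividing? : Decidable Dividing
  dividing? p = prime? p ×-dec (p ∣? D)

  sifting≤ dividing≤ : ℕ → List ℕ
  sifting≤ = select sifting?
  dividing≤ = select dividing?

  sifting-dividing : ∀ f z → product (map f (primes≤ z)) ≡ product (map f (sifting≤ z)) * product (map f (dividing≤ z))
  sifting-dividing f zero = refl
  sifting-dividing f (suc z) with prime? (suc z) | suc z ∣? D | sifting-dividing f z
  ... | no _ | _ | e = e
  ... | yes _ | yes _ | e = trans (cong (f (suc z) *_) e) (lem (f (suc z)) (product (map f (sifting≤ z))) _)
    where
    lem : ∀ a b c → a * (b * c) ≡ b * (a * c)
    lem = solve-∀
  ... | yes _ | no _ | e = trans (cong (f (suc z) *_) e) (sym (*-assoc (f (suc z)) _ _))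

  sifting-dividing-product : ∀ z → product (primes≤ z) ≡ product (sifting≤ z) * product (dividing≤ z)
  sifting-dividing-product z = trans (cong product (sym (map-id (primes≤ z))))
    (trans (sifting-dividing id z) (cong₂ (λ a b → product a * product b) (map-id (sifting≤ z)) (map-id (dividing≤ z))))

  module _ (z : ℕ) where

    sifting>1 : All (1 <_) (sifting≤ z)
    sifting>1 = All.map (λ ((p , _) , _) → prime>1 p) (select-all sifting? z)

    dividing>1 : All (1 <_) (dividing≤ z)
    dividing>1 = All.map (λ ((p , _) , _) → prime>1 p) (select-all dividing? z)

    -- Distinct primes dividing `D` have a product of at most `D`, and each of them is at least 2.
    dividing-count : ∀ B → 0 < D → D ≤ 2 ^ B → length (dividing≤ z) ≤ B
    dividing-count B D>0 D≤ = ≮⇒≥ λ B< → <⇒≱ (^-monoʳ-< 2 (s≤s (s≤s z≤n)) B<) (begin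
      2 ^ length (dividing≤ z) ≤⟨ 2^length≤product dividing>1 ⟩
      product (dividing≤ z) ≤⟨ ∣⇒≤ {{>-nonZero D>0}} (product-∣ (select-pairs dividing? (λ (p , _) (q , _) → prime-coprime p q) z) (All.map (λ ((_ , d) , _) → d) (select-all dividing? z))) ⟩
      D ≤⟨ D≤ ⟩
      2 ^ B ∎)
      where open ≤-Reasoning

    module _ (X B : ℕ) (D>0 : 0 < D) (D≤ : D ≤ 2 ^ B)
             (X-lower : X * φ (primes≤ z) ≤ product (primes≤ z))
             (X-upper : product (primes≤ z) ≤ 2 * X * φ (primes≤ z)) where

      private
        Πg = product (sifting≤ z)
        Πb = product (dividing≤ z)
        φg = φ (sifting≤ z)
        φb = φ (dividing≤ z)
        instance
          φb≢0 : NonZero φb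
          φb≢0 = >-nonZero (φ>0 dividing>1)
          φg≢0 : NonZero φg
          φg≢0 = >-nonZero (φ>0 sifting>1)
          Πb≢0 : NonZero Πb
          Πb≢0 = >-nonZero (≤-trans (φ>0 dividing>1) (φ≤product (dividing≤ z)))
          Πg≢0 : NonZero Πg
          Πg≢0 = >-nonZero (≤-trans (φ>0 sifting>1) (φ≤product (sifting≤ z)))

      -- Dropping at most `B` primes divides the product ∏ p/(p - 1) by at most B + 1, according to
      -- `product≤φ`.
      sifting-lower : φg * X ≤ Πg * suc B
      sifting-lower = *-cancelʳ-≤ _ _ φb (begin
        φg * X * φb ≡⟨ lem φg X φb ⟩
        X * (φg * φb) ≡⟨ cong (X *_) (sifting-dividing pred z) ⟨
        X * φ (primes≤ z) ≤⟨ X-lower ⟩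
        product (primes≤ z) ≡⟨ sifting-dividing-product z ⟩
        Πg * Πb ≤⟨ *-monoʳ-≤ Πg (≤-trans (product≤φ dividing? (λ (p , _) → prime>1 p) z) (*-monoˡ-≤ φb (s≤s (dividing-count B D>0 D≤)))) ⟩
        Πg * (suc B * φb) ≡⟨ *-assoc Πg (suc B) φb ⟨
        Πg * suc B * φb ∎)
        where
        open ≤-Reasoning
        lem : ∀ a b c → a * b * c ≡ b * (a * c)
        lem = solve-∀

      sifting-upper : Πg ≤ 2 * X * φg
      sifting-upper = *-cancelʳ-≤ _ _ Πb (begin
        Πg * Πb ≡⟨ sifting-dividing-product z ⟨
        product (primes≤ z) ≤⟨ X-upper ⟩
        2 * X * φ (primes≤ z) ≡⟨ cong (2 * X *_) (sifting-dividing pred z) ⟩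
        2 * X * (φg * φb) ≤⟨ *-monoʳ-≤ (2 * X) (*-monoʳ-≤ φg (φ≤product (dividing≤ z))) ⟩
        2 * X * (φg * Πb) ≡⟨ *-assoc (2 * X) φg Πb ⟨
        2 * X * φg * Πb ∎)
        where open ≤-Reasoning

      module _ (H : List ℕ) (Y r : ℕ) where

        open Sieve H Y

        module _ (k>0 : 0 < k) (adm : ∀ {p} → Prime p → ¬ p ∣ D → k ≤ p × Separates p)
                 (r-large : (2 * X) ^ (2 * k) * X ^ k ≤ 2 ^ r)
                 (Y-large : X ^ k * (1 + k * 2 ^ (2 * X)) ^ r ≤ Y)
                 (z≤ : z ≤ 2 ^ (2 * X)) where

          private
            G = sifting≤ z

          V-bound : V G * X ^ k ≤ Πg * suc B ^ k
          V-bound = *-cancelʳ-≤ _ _ (Πg ^ k) {{m^n≢0 Πg k}} (begin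
            V G * X ^ k * Πg ^ k ≡⟨ lem₁ (V G) (X ^ k) (Πg ^ k) ⟩
            V G * Πg ^ k * X ^ k ≤⟨ *-monoˡ-≤ (X ^ k) (V≤ sifting>1) ⟩
            φg ^ k * Πg * X ^ k ≡⟨ lem₁ (φg ^ k) Πg (X ^ k) ⟩
            φg ^ k * X ^ k * Πg ≡⟨ cong (_* Πg) (*-^ φg X k) ⟨
            (φg * X) ^ k * Πg ≤⟨ *-monoˡ-≤ Πg (^-monoˡ-≤ k sifting-lower) ⟩
            (Πg * suc B) ^ k * Πg ≡⟨ cong (_* Πg) (*-^ Πg (suc B) k) ⟩
            Πg ^ k * suc B ^ k * Πg ≡⟨ lem₂ (Πg ^ k) (suc B ^ k) Πg ⟩
            Πg * suc B ^ k * Πg ^ k ∎)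
            where
            open ≤-Reasoning
            lem₁ : ∀ a b c → a * b * c ≡ a * c * b
            lem₁ = solve-∀
            lem₂ : ∀ a b c → a * b * c ≡ c * b * a
            lem₂ = solve-∀
            lem₃ : ∀ a b c d → a * b * (c * d) ≡ a * c * (b * d)
            lem₃ = solve-∀
            V≤ : ∀ {Q} → All (1 <_) Q → V Q * product Q ^ k ≤ φ Q ^ k * product Q
            V≤ {[]} [] = ≤-reflexive (lem (1 ^ k))
              where
              lem : ∀ a → 1 * a ≡ a * 1
              lem = solve-∀
            V≤ {p ∷ Q} (s≤s p>0 ∷ ps) = begin
              (p ∸ k) * V Q * (p * product Q) ^ k ≡⟨ cong ((p ∸ k) * V Q *_) (*-^ p (product Q) k) ⟩
              (p ∸ k) * V Q * (p ^ k * product Q ^ k) ≡⟨ lem₃ (p ∸ k) (V Q) (p ^ k) (product Q ^ k) ⟩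
              (p ∸ k) * p ^ k * (V Q * product Q ^ k) ≤⟨ *-mono-≤ (bernoulli p k) (V≤ ps) ⟩
              pred p ^ k * p * (φ Q ^ k * product Q) ≡⟨ lem₃ (pred p ^ k) p (φ Q ^ k) (product Q) ⟩
              pred p ^ k * φ Q ^ k * (p * product Q) ≡⟨ cong (_* (p * product Q)) (*-^ (pred p) (φ Q) k) ⟨
              (pred p * φ Q) ^ k * (p * product Q) ∎

          -- F / Π is at most (2X)^(2k), and `r` is so large that 2⁻ʳ times this drops below X^(-k),
          -- the order aimed at for the main term.
          F-bound : F G * X ^ k ≤ Πg * 2 ^ r
          F-bound = ≤-trans (*-monoˡ-≤ (X ^ k) F≤Π) (≤-trans (≤-reflexive (*-assoc Πg _ _)) (*-monoʳ-≤ Πg r-large))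
            where
            open ≤-Reasoning
            lem₁ : ∀ a b c → a * b * c ≡ c * a * b
            lem₁ = solve-∀
            lem₃ : ∀ a b c d → a * b * (c * d) ≡ a * c * (b * d)
            lem₃ = solve-∀
            F≤ : ∀ Q → F Q * φ Q ^ (2 * k) ≤ product Q ^ (2 * k) * product Q
            F≤ [] = ≤-reflexive (lem (1 ^ (2 * k)))
              where
              lem : ∀ a → 1 * a ≡ a * 1
              lem = solve-∀
            F≤ (p ∷ Q) = begin
              (p + 2 * k) * F Q * (pred p * φ Q) ^ (2 * k) ≡⟨ cong ((p + 2 * k) * F Q *_) (*-^ (pred p) (φ Q) (2 * k)) ⟩
              (p + 2 * k) * F Q * (pred p ^ (2 * k) * φ Q ^ (2 * k)) ≡⟨ lem₃ (p + 2 * k) (F Q) (pred p ^ (2 * k)) (φ Q ^ (2 * k)) ⟩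
              (p + 2 * k) * pred p ^ (2 * k) * (F Q * φ Q ^ (2 * k)) ≤⟨ *-mono-≤ (bernoulli′ p (2 * k)) (F≤ Q) ⟩
              p ^ (2 * k) * p * (product Q ^ (2 * k) * product Q) ≡⟨ lem₃ (p ^ (2 * k)) p (product Q ^ (2 * k)) (product Q) ⟩
              p ^ (2 * k) * product Q ^ (2 * k) * (p * product Q) ≡⟨ cong (_* (p * product Q)) (*-^ p (product Q) (2 * k)) ⟨
              (p * product Q) ^ (2 * k) * (p * product Q) ∎
            F≤Π : F G ≤ Πg * (2 * X) ^ (2 * k)
            F≤Π = *-cancelʳ-≤ _ _ (φg ^ (2 * k)) {{m^n≢0 φg (2 * k)}} (begin
              F G * φg ^ (2 * k) ≤⟨ F≤ G ⟩
              Πg ^ (2 * k) * Πg ≤⟨ *-monoˡ-≤ Πg (^-monoˡ-≤ (2 * k) sifting-upper) ⟩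
              (2 * X * φg) ^ (2 * k) * Πg ≡⟨ cong (_* Πg) (*-^ (2 * X) φg (2 * k)) ⟩
              (2 * X) ^ (2 * k) * φg ^ (2 * k) * Πg ≡⟨ lem₁ ((2 * X) ^ (2 * k)) (φg ^ (2 * k)) Πg ⟩
              Πg * (2 * X) ^ (2 * k) * φg ^ (2 * k) ∎)

          E-bound : E G ≤ 1 + k * 2 ^ (2 * X)
          E-bound = s≤s (*-monoʳ-≤ k (≤-trans (length-select≤ sifting? z) z≤))

          -- Brun's upper bound with modulus 1, that is, without a congruence. The main term gives
          -- `suc B ^ k`; truncation and rounding give 1 each.
          sifted-bound : S 1 0 G * X ^ k ≤ Y * (suc B ^ k + 2)
          sifted-bound = *-cancelʳ-≤ _ _ (Πg * 2 ^ r) {{m*n≢0 Πg (2 ^ r) {{Πg≢0}} {{m^n≢0 2 r}}}} (begin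
            S 1 0 G * X ^ k * (Πg * T) ≡⟨ lem₁ (S 1 0 G) (X ^ k) Πg T ⟩
            S 1 0 G * (1 * Πg) * T * X ^ k ≤⟨ *-monoˡ-≤ (X ^ k) (proj₁ (brun r 1 0 G admissible (select-pairs sifting? (λ (p , _) (q , _) → prime-coprime p q) z) (coprime-1 G))) ⟩
            (Y * (V G * T + F G) + 1 * Πg * T * E G ^ r) * X ^ k ≡⟨ lem₂ Y (V G) T (F G) Πg (E G ^ r) (X ^ k) ⟩
            Y * (V G * X ^ k * T + F G * X ^ k) + Πg * T * (X ^ k * E G ^ r) ≤⟨ +-mono-≤ (*-monoʳ-≤ Y (+-mono-≤ (*-monoˡ-≤ T V-bound) F-bound)) (*-monoʳ-≤ (Πg * T) (≤-trans (*-monoʳ-≤ (X ^ k) (^-monoˡ-≤ r E-bound)) Y-large)) ⟩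
            Y * (Πg * suc B ^ k * T + Πg * T) + Πg * T * Y ≡⟨ lem₃ Y Πg (suc B ^ k) T ⟩
            Y * (suc B ^ k + 2) * (Πg * T) ∎)
            where
            open ≤-Reasoning
            T = 2 ^ r
            lem₁ : ∀ s x p r → s * x * (p * r) ≡ s * (1 * p) * r * x
            lem₁ = solve-∀
            lem₂ : ∀ y v r f p e x → (y * (v * r + f) + 1 * p * r * e) * x ≡ y * (v * x * r + f * x) + p * r * (x * e)
            lem₂ = solve-∀
            lem₃ : ∀ y p b r → y * (p * b * r + p * r) + p * r * y ≡ y * (b + 2) * (p * r)
            lem₃ = solve-∀
            admissible : All Admissible G
            admissible = All.map (λ ((p , p∤D) , _) → prime⇒nonZero p , adm p p∤D) (select-all sifting? z)

          sift≡1 : ∀ t → z < t → All (λ h → Prime (t + h)) H → ∀ {Q} → All (λ p → Sifting p × p ≤ z) Q → sift Q t ≡ 1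
          sift≡1 t z<t ps [] = refl
          sift≡1 t z<t ps {p ∷ Q} (((pp , _) , p≤z) ∷ gs) =
            cong₂ _*_ (⟦⟧-yes (All.all? (λ h → ¬? (p ∣? (t + h))) H) (All.map ¬∣ ps)) (sift≡1 t z<t ps gs)
            where
            ¬∣ : ∀ {h} → Prime (t + h) → ¬ p ∣ t + h
            ¬∣ {h} pth d with prime⇒irreducible pth d
            ... | inj₁ refl = contradiction (prime>1 pp) (n≮n 1)
            ... | inj₂ refl = <⇒≱ z<t (≤-trans (m≤m+n t h) p≤z)

          -- For t > z the numbers t + h are primes beyond z and survive the sieve. The at most z +
          -- 1 smaller values of t raise the constant from 2 to 3.
          tuple-count : ∀ {P : Pred ℕ 0ℓ} (P? : Decidable P) → (∀ t → P t → All (λ h → Prime (t + h)) H) → 0 < r →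
                        count P? Y * X ^ k ≤ Y * (suc B ^ k + 3)
          tuple-count {P} P? primes r>0 = begin
            count P? Y * X ^ k ≤⟨ *-monoˡ-≤ (X ^ k) (≤-trans (Σ<-mono Y λ t _ → pointwise t) (≤-trans (≤-reflexive (Σ<-+ Y _ _)) (+-monoˡ-≤ _ (small Y)))) ⟩
            (suc z + S 1 0 G) * X ^ k ≡⟨ *-distribʳ-+ (X ^ k) (suc z) _ ⟩
            suc z * X ^ k + S 1 0 G * X ^ k ≤⟨ +-mono-≤ small-bound sifted-bound ⟩
            Y + Y * (suc B ^ k + 2) ≡⟨ lem Y (suc B ^ k) ⟩
            Y * (suc B ^ k + 3) ∎
            where
            open ≤-Reasoning
            lem : ∀ y b → y + y * (b + 2) ≡ y * (b + 3)
            lem = solve-∀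
            small : ∀ n → count (_≤? z) n ≤ suc z
            small zero = z≤n
            small (suc n) with n ≤? z
            ... | yes n≤z = ≤-trans (+-monoˡ-≤ 1 (count≤ (_≤? z) n)) (≤-trans (≤-reflexive (+-comm n 1)) (s≤s n≤z))
            ... | no _ = ≤-trans (≤-reflexive (+-identityʳ _)) (small n)
            pointwise : ∀ t → ⟦ P? t ⟧ ≤ ⟦ t ≤? z ⟧ + ⟦ 1 ∣? (t + 0) ⟧ * sift G t
            pointwise t with P? t | t ≤? z
            ... | no _ | _ = z≤n
            ... | yes _ | yes _ = s≤s z≤n
            ... | yes pt | no t≰z = ≤-reflexive (sym (cong₂ _*_ (⟦⟧-yes (1 ∣? (t + 0)) (1∣ _)) (sift≡1 t (≰⇒> t≰z) (primes t pt) (select-all sifting? z))))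
            small-bound : suc z * X ^ k ≤ Y
            small-bound = begin
              suc z * X ^ k ≡⟨ *-comm (suc z) (X ^ k) ⟩
              X ^ k * suc z ≤⟨ *-monoʳ-≤ (X ^ k) (s≤s (≤-trans z≤ (m≤n*m _ k {{>-nonZero k>0}}))) ⟩
              X ^ k * (1 + k * 2 ^ (2 * X)) ≡⟨ cong (X ^ k *_) (*-identityʳ _) ⟨
              X ^ k * (1 + k * 2 ^ (2 * X)) ^ 1 ≤⟨ *-monoʳ-≤ (X ^ k) (^-monoʳ-≤ (1 + k * 2 ^ (2 * X)) r>0) ⟩
              X ^ k * (1 + k * 2 ^ (2 * X)) ^ r ≤⟨ Y-large ⟩
              Y ∎

-- Chebyshev's lower bound

∈-select : (P? : Decidable P) → ∀ {p z} → P p → 0 < p → p ≤ z → p ∈ select P? z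
∈-select P? {p} {zero} _ p>0 p≤0 = contradiction p>0 (≤⇒≯ p≤0)
∈-select P? {p} {suc z} Pp p>0 p≤ with P? (suc z) | m≤n⇒m<n∨m≡n p≤
... | yes _ | inj₁ (s≤s p≤z) = there (∈-select P? Pp p>0 p≤z)
... | yes _ | inj₂ refl = here refl
... | no _ | inj₁ (s≤s p≤z) = ∈-select P? Pp p>0 p≤z
... | no ¬P | inj₂ refl = contradiction Pp ¬P

length-primes≤ : ∀ z → length (primes≤ z) ≡ count prime? (suc z)
length-primes≤ zero = refl
length-primes≤ (suc z) with prime? (suc z)
... | yes _ = trans (cong suc (length-primes≤ z)) (+-comm 1 _)
... | no _ = trans (length-primes≤ z) (sym (+-identityʳ _))

n<2^n : ∀ n → n < 2 ^ n
n<2^n zero = z<s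
n<2^n (suc n) = +-mono-≤ (m^n>0 2 n) (≤-trans (n<2^n n) (≤-reflexive (sym (+-identityʳ _))))

module _ (p n : ℕ) where

  private
    go : ℕ → ℕ
    go zero = 0
    go (suc f) with p ^ suc f ≤? n
    ... | yes _ = suc f
    ... | no _ = go f

    go-≤ : 0 < n → ∀ f → p ^ go f ≤ n
    go-≤ n>0 zero = n>0
    go-≤ n>0 (suc f) with p ^ suc f ≤? n
    ... | yes le = le
    ... | no _ = go-≤ n>0 f

    go-max : ∀ f e → e ≤ f → p ^ e ≤ n → e ≤ go f
    go-max zero e e≤ _ = e≤
    go-max (suc f) e e≤ le with p ^ suc f ≤? n | m≤n⇒m<n∨m≡n e≤
    ... | yes _ | _ = e≤
    ... | no _ | inj₁ (s≤s e≤f) = go-max f e e≤f le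
    ... | no ¬le | inj₂ refl = contradiction le ¬le

  ⌊log⌋ : ℕ
  ⌊log⌋ = go n

  ^⌊log⌋≤ : 0 < n → p ^ ⌊log⌋ ≤ n
  ^⌊log⌋≤ n>0 = go-≤ n>0 n

  ⌊log⌋-max : 1 < p → ∀ e → p ^ e ≤ n → e ≤ ⌊log⌋
  ⌊log⌋-max p>1 e le = go-max n e (<⇒≤ (≤-trans (n<2^n e) (≤-trans (^-monoˡ-≤ e p>1) le))) le

∤⇒coprime : ∀ {p u} → Prime p → ¬ p ∣ u → Coprime p u
∤⇒coprime pp ¬d (e∣p , e∣u) with prime⇒irreducible pp e∣p
... | inj₁ e = e
... | inj₂ refl = contradiction e∣u ¬d

coprime-^ : ∀ {p u} e → Coprime p u → Coprime (p ^ e) u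
coprime-^ zero c (d∣1 , _) = ∣1⇒≡1 d∣1
coprime-^ (suc e) c = coprime-*ˡ c (coprime-^ e c)

split-power : ∀ {p} → 1 < p → ∀ j → 0 < j → ∃₂ λ e u → j ≡ p ^ e * u × ¬ p ∣ u
split-power {p} p>1 = <-rec _ step
  where
  step : ∀ j → (∀ {i} → i < j → 0 < i → ∃₂ λ e u → i ≡ p ^ e * u × ¬ p ∣ u) → 0 < j → ∃₂ λ e u → j ≡ p ^ e * u × ¬ p ∣ u
  step j rec j>0 with p ∣? j
  ... | no ¬d = 0 , j , sym (*-identityˡ j) , ¬d
  ... | yes (divides zero refl) = contradiction j>0 (n≮n 0)
  ... | yes (divides i@(suc _) refl) with rec (m<m*n i p p>1) z<s
  ...   | e , u , eq , ¬d = suc e , u , trans (*-comm i p) (trans (cong (p *_) eq) (sym (*-assoc p (p ^ e) u))) , ¬d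

-- Split off the full power of one prime divisor of `j`; it is coprime to the remaining factor,
-- which is smaller.
prime-powers-∣ : ∀ D j → 0 < j → (∀ {p} e → Prime p → p ^ e ∣ j → p ^ e ∣ D) → j ∣ D
prime-powers-∣ D = <-rec (λ j → 0 < j → (∀ {p} e → Prime p → p ^ e ∣ j → p ^ e ∣ D) → j ∣ D) step
  where
  step : ∀ j → (∀ {i} → i < j → 0 < i → (∀ {p} e → Prime p → p ^ e ∣ i → p ^ e ∣ D) → i ∣ D) →
         0 < j → (∀ {p} e → Prime p → p ^ e ∣ j → p ^ e ∣ D) → j ∣ D
  step (suc zero) rec _ _ = 1∣ D
  step j@(suc (suc _)) rec _ h with prime-divisor j (s≤s (s≤s z≤n))
  ... | p , pp , p∣j with split-power (prime>1 pp) j z<s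
  ...   | zero , u , eq , ¬d = contradiction (subst (p ∣_) (trans eq (*-identityˡ u)) p∣j) ¬d
  ...   | suc e , zero , _ , ¬d = contradiction (p ∣0) ¬d
  ...   | suc e , u@(suc _) , eq , ¬d = subst (_∣ D) (sym eq)
            (coprime-*-∣ (coprime-^ (suc e) (∤⇒coprime pp ¬d)) (h (suc e) pp (divides u (trans eq (*-comm (p ^ suc e) u))))
              (rec (subst (u <_) (trans (*-comm u (p ^ suc e)) (sym eq)) (m<m*n u (p ^ suc e) (≤-trans (prime>1 pp) (m≤m*n p (p ^ e) {{m^n≢0 p e {{prime⇒nonZero pp}}}})))) z<s
                λ e′ pq d → h e′ pq (∣-trans d (divides (p ^ suc e) eq))))

-- The least common multiple of 1, ..., n, given by its factorization.
L : ℕ → ℕ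
L n = product (map (λ p → p ^ ⌊log⌋ p n) (primes≤ n))

∣L : ∀ n j → 0 < j → j ≤ n → j ∣ L n
∣L n j j>0 j≤n = prime-powers-∣ (L n) j j>0 dvd
  where
  dvd : ∀ {p} e → Prime p → p ^ e ∣ j → p ^ e ∣ L n
  dvd zero pp d = 1∣ _
  dvd {p} (suc e) pp d = ∣-trans (subst (p ^ suc e ∣_) eq (m∣m*n (p ^ (⌊log⌋ p n ∸ suc e))))
    (∈⇒∣product (∈-map⁺ (λ p → p ^ ⌊log⌋ p n) (∈-select prime? pp (<-trans z<s (prime>1 pp)) (≤-trans (m≤m*n p (p ^ e) {{m^n≢0 p e}}) pe≤n))))
    where
    instance
      p≢0 : NonZero p
      p≢0 = prime⇒nonZero pp
    pe≤n : p ^ suc e ≤ n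
    pe≤n = ≤-trans (∣⇒≤ {{>-nonZero j>0}} d) j≤n
    eq : p ^ suc e * p ^ (⌊log⌋ p n ∸ suc e) ≡ p ^ ⌊log⌋ p n
    eq = trans (sym (^-distribˡ-+-* p (suc e) _)) (cong (p ^_) (m+[n∸m]≡n (⌊log⌋-max p n (prime>1 pp) (suc e) pe≤n)))

L≤ : ∀ n → 0 < n → L n ≤ n ^ length (primes≤ n)
L≤ n n>0 = go (primes≤ n)
  where
  go : ∀ Q → product (map (λ p → p ^ ⌊log⌋ p n) Q) ≤ n ^ length Q
  go [] = ≤-refl
  go (p ∷ Q) = *-mono-≤ (^⌊log⌋≤ p n n>0) (go Q)

-- binom i j is the binomial coefficient (i + j choose j).
binom : ℕ → ℕ → ℕ
binom i zero = 1
binom zero (suc j) = 1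
binom (suc i) (suc j) = binom i (suc j) + binom (suc i) j

binom-sucʳ : ∀ i j → suc j * binom i (suc j) ≡ suc (i + j) * binom i j
binom-sucˡ : ∀ i j → suc i * binom (suc i) j ≡ suc (i + j) * binom i j

binom-sucʳ zero zero = refl
binom-sucʳ zero (suc j) = refl
binom-sucʳ (suc i) j = begin
  suc j * (binom i (suc j) + binom (suc i) j) ≡⟨ *-distribˡ-+ (suc j) (binom i (suc j)) _ ⟩
  suc j * binom i (suc j) + suc j * binom (suc i) j ≡⟨ cong (_+ suc j * binom (suc i) j) (trans (binom-sucʳ i j) (sym (binom-sucˡ i j))) ⟩
  suc i * binom (suc i) j + suc j * binom (suc i) j ≡⟨ lem i j (binom (suc i) j) ⟩
  suc (suc i + j) * binom (suc i) j ∎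
  where
  open ≡-Reasoning
  lem : ∀ i j b → suc i * b + suc j * b ≡ suc (suc i + j) * b
  lem = solve-∀

binom-sucˡ i zero rewrite +-identityʳ i = refl
binom-sucˡ i (suc j) = begin
  suc i * (binom i (suc j) + binom (suc i) j) ≡⟨ *-distribˡ-+ (suc i) (binom i (suc j)) _ ⟩
  suc i * binom i (suc j) + suc i * binom (suc i) j ≡⟨ cong (suc i * binom i (suc j) +_) (trans (binom-sucˡ i j) (sym (binom-sucʳ i j))) ⟩
  suc i * binom i (suc j) + suc j * binom i (suc j) ≡⟨ lem i j (binom i (suc j)) ⟩
  suc (i + suc j) * binom i (suc j) ∎
  where
  open ≡-Reasoning
  lem : ∀ i j b → suc i * b + suc j * b ≡ suc (i + suc j) * b
  lem = solve-∀

-- Leibniz's harmonic triangle: 1/((n+1) (n choose j+1)) = 1/(n (n−1 choose j)) − 1/((n+1) (n choose j)),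
-- so by induction on j every entry lies in (1/D) ℤ.
leibniz : ∀ D i j → (∀ k → 0 < k → k ≤ suc (i + j) → k ∣ D) → suc (i + j) * binom i j ∣ D
leibniz D i zero h = subst (_∣ D) (sym (*-identityʳ _)) (h (suc (i + 0)) z<s ≤-refl)
leibniz D i (suc j) h
  with leibniz D i j (λ k k>0 k≤ → h k k>0 (≤-trans k≤ (s≤s (+-monoʳ-≤ i (n≤1+n j)))))
     | leibniz D (suc i) j (λ k k>0 k≤ → h k k>0 (≤-trans k≤ (≤-reflexive (cong suc (sym (+-suc i j))))))
... | divides a D≡a | divides b D≡b = ∣m+n∣m⇒∣n (subst (N ∣_) (trans key (+-comm D (b * N))) (n∣m*n a)) (n∣m*n b)
  where
  open ≡-Reasoning
  y = binom i (suc j)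
  N = suc (i + suc j) * y
  x = binom (suc i) j
  lem₁ : ∀ j a s y → suc j * (a * (s * y)) ≡ a * (suc j * y) * s
  lem₁ = solve-∀
  lem₂ : ∀ i j D → D * suc (i + suc j) ≡ suc j * D + D * suc i
  lem₂ = solve-∀
  lem₃ : ∀ i b s x → b * (s * x) * suc i ≡ b * (suc i * x) * s
  lem₃ = solve-∀
  lem₄ : ∀ j D b s y → suc j * D + b * (suc j * y) * s ≡ suc j * (D + b * (s * y))
  lem₄ = solve-∀
  key : a * N ≡ D + b * N
  key = *-cancelˡ-≡ _ _ (suc j) (begin
    suc j * (a * N) ≡⟨ lem₁ j a (suc (i + suc j)) y ⟩
    a * (suc j * y) * suc (i + suc j) ≡⟨ cong (λ w → a * w * suc (i + suc j)) (binom-sucʳ i j) ⟩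
    a * (suc (i + j) * binom i j) * suc (i + suc j) ≡⟨ cong (_* suc (i + suc j)) D≡a ⟨
    D * suc (i + suc j) ≡⟨ lem₂ i j D ⟩
    suc j * D + D * suc i ≡⟨ cong (λ w → suc j * D + w * suc i) (trans D≡b (cong (λ w → b * (suc w * x)) (sym (+-suc i j)))) ⟩
    suc j * D + b * (suc (i + suc j) * x) * suc i ≡⟨ cong (suc j * D +_) (lem₃ i b (suc (i + suc j)) x) ⟩
    suc j * D + b * (suc i * x) * suc (i + suc j) ≡⟨ cong (λ w → suc j * D + b * w * suc (i + suc j)) (trans (binom-sucˡ i j) (sym (binom-sucʳ i j))) ⟩
    suc j * D + b * (suc j * y) * suc (i + suc j) ≡⟨ lem₄ j D b (suc (i + suc j)) y ⟩
    suc j * (D + b * N) ∎)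

-- From i to i + 1 the right-hand side grows by the factor 4 + 2/(i + 1).
central : ∀ i → 4 ^ i ≤ suc (i + i) * binom i i
central zero = ≤-refl
central (suc i) = *-cancelˡ-≤ (suc i * suc i) (begin
  suc i * suc i * (4 * 4 ^ i) ≤⟨ *-monoʳ-≤ (suc i * suc i) (*-monoʳ-≤ 4 (central i)) ⟩
  suc i * suc i * (4 * (suc (i + i) * b)) ≤⟨ m≤m+n _ (2 * suc i * (suc (i + i) * b)) ⟩
  suc i * suc i * (4 * (suc (i + i) * b)) + 2 * suc i * (suc (i + i) * b) ≡⟨ lem₁ i b ⟩
  suc (suc i + suc i) * (suc (suc i + i) * (suc (i + i) * b)) ≡⟨ cong (λ w → suc (suc i + suc i) * (suc (suc i + i) * w)) (binom-sucˡ i i) ⟨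
  suc (suc i + suc i) * (suc (suc i + i) * (suc i * binom (suc i) i)) ≡⟨ lem₂ i (suc (suc i + suc i)) (suc (suc i + i)) (binom (suc i) i) ⟩
  suc i * suc (suc i + suc i) * (suc (suc i + i) * binom (suc i) i) ≡⟨ cong (suc i * suc (suc i + suc i) *_) (binom-sucʳ (suc i) i) ⟨
  suc i * suc (suc i + suc i) * (suc i * binom (suc i) (suc i)) ≡⟨ lem₃ i (suc (suc i + suc i)) (binom (suc i) (suc i)) ⟩
  suc i * suc i * (suc (suc i + suc i) * binom (suc i) (suc i)) ∎)
  where
  open ≤-Reasoning
  b = binom i i
  lem₁ : ∀ i b → suc i * suc i * (4 * (suc (i + i) * b)) + 2 * suc i * (suc (i + i) * b) ≡ suc (suc i + suc i) * (suc (suc i + i) * (suc (i + i) * b))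
  lem₁ = solve-∀
  lem₂ : ∀ i s t x → s * (t * (suc i * x)) ≡ suc i * s * (t * x)
  lem₂ = solve-∀
  lem₃ : ∀ i s x → suc i * s * (suc i * x) ≡ suc i * suc i * (s * x)
  lem₃ = solve-∀

-- Nair's argument. For n = 2i + 1, one less than the given power of 2, 4^i ≤ (2i + 1) (2i choose i)
-- ≤ L n ≤ n^π by divisibility in the harmonic triangle; then exponents of 2 are compared.
chebyshev : ∀ M → 2 ^ M ≤ M * count prime? (2 ^ M) + 2
chebyshev zero = s≤s z≤n
chebyshev (suc M) = ≤-trans (≤-reflexive Y≡) (+-monoˡ-≤ 2 exponent)
  where
  open ≤-Reasoning
  i = pred (2 ^ M)
  n = suc (i + i)
  si : suc i ≡ 2 ^ M
  si = suc-pred (2 ^ M) {{m^n≢0 2 M}}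
  suc-n : suc n ≡ 2 ^ suc M
  suc-n = trans (lem i) (cong (2 *_) si)
    where
    lem : ∀ i → suc (suc (i + i)) ≡ 2 * suc i
    lem = solve-∀
  Y≡ : 2 ^ suc M ≡ 2 * i + 2
  Y≡ = trans (cong (2 *_) (sym si)) (lem i)
    where
    lem : ∀ i → 2 * suc i ≡ 2 * i + 2
    lem = solve-∀
  π = count prime? (2 ^ suc M)
  n>1 : 1 < 2
  n>1 = s≤s (s≤s z≤n)
  exponent : 2 * i ≤ suc M * π
  exponent = ≮⇒≥ λ lt → <⇒≱ (^-monoʳ-< 2 n>1 lt) (begin
    2 ^ (2 * i) ≡⟨ ^-*-assoc 2 2 i ⟨
    4 ^ i ≤⟨ central i ⟩
    n * binom i i ≤⟨ ∣⇒≤ {{>-nonZero L>0}} (leibniz (L n) i i (∣L n)) ⟩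
    L n ≤⟨ L≤ n z<s ⟩
    n ^ length (primes≤ n) ≡⟨ cong (n ^_) (trans (length-primes≤ n) (cong (count prime?) suc-n)) ⟩
    n ^ π ≤⟨ ^-monoˡ-≤ π (≤-trans (n≤1+n n) (≤-reflexive suc-n)) ⟩
    (2 ^ suc M) ^ π ≡⟨ ^-*-assoc 2 (suc M) π ⟩
    2 ^ (suc M * π) ∎)
    where
    L>0 : 0 < L n
    L>0 = go (primes≤ n) (All.map (λ (pp , _) → prime⇒nonZero pp) (select-all prime? n))
      where
      go : ∀ Q → All NonZero Q → 0 < product (map (λ p → p ^ ⌊log⌋ p n) Q)
      go [] [] = z<s
      go (p ∷ Q) (nz ∷ nzs) = *-mono-≤ (m^n>0 p {{nz}} (⌊log⌋ p n)) (go Q nzs)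

-- Runs of consecutive primes and the pigeonhole on their gaps

-- π x is the number of primes strictly below x.
π : ℕ → ℕ
π = count prime?

π-suc-prime : ∀ {t} → Prime t → π (suc t) ≡ suc (π t)
π-suc-prime {t} pt = trans (cong (π t +_) (⟦⟧-yes (prime? t) pt)) (+-comm (π t) 1)

π-suc-composite : ∀ {t} → ¬ Prime t → π (suc t) ≡ π t
π-suc-composite {t} ¬pt = trans (cong (π t +_) (⟦⟧-no (prime? t) ¬pt)) (+-identityʳ _)

π-mono : ∀ {s t} → s ≤ t → π s ≤ π t
π-mono {s} {t} s≤t = subst (λ u → π s ≤ π u) (m+[n∸m]≡n s≤t)
  (≤-trans (m≤m+n _ _) (≤-reflexive (sym (Σ<-split s (t ∸ s) _))))

-- The fuel makes the passage to the next prime total. When it runs out the value is a default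
-- without meaning; `Good` rules this out along the first `n` steps of a run.
search : ℕ → ℕ → ℕ
search zero t = t
search (suc f) t with prime? t
... | yes _ = t
... | no _ = search f (suc t)

search-spec : ∀ f t e → π t < π e → e ≤ t + f → let q = search f t in
              Prime q × t ≤ q × q < e × π q ≡ π t × (∀ r → t ≤ r → r < q → ¬ Prime r)
search-spec zero t e lt e≤ = contradiction (π-mono (≤-trans e≤ (≤-reflexive (+-identityʳ t)))) (<⇒≱ lt)
search-spec (suc f) t e lt e≤ with prime? t
... | yes pt = pt , ≤-refl , ≰⇒> (λ e≤t → <⇒≱ lt (π-mono e≤t)) , refl , λ r t≤r r<t → contradiction r<t (≤⇒≯ t≤r)
... | no ¬pt with search-spec f (suc t) e (subst (_< π e) (sym (π-suc-composite ¬pt)) lt) (≤-trans e≤ (≤-reflexive (+-suc t f)))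
...   | pq , t< , q<e , πq , gap = pq , <⇒≤ t< , q<e , trans πq (π-suc-composite ¬pt) , gap′
  where
  gap′ : ∀ r → t ≤ r → r < search f (suc t) → ¬ Prime r
  gap′ r t≤r r<q with m≤n⇒m<n∨m≡n t≤r
  ... | inj₁ t<r = gap r t<r r<q
  ... | inj₂ refl = ¬pt

module Runs (W n : ℕ) where

  next : ℕ → ℕ
  next t = search W (suc t)

  run : ℕ → ℕ → ℕ
  run t zero = t
  run t (suc i) = next (run t i)

  run-next : ∀ t i → run (next t) i ≡ run t (suc i)
  run-next t zero = refl
  run-next t (suc i) = cong next (run-next t i)

  -- The interval [t, t + W) then holds `t` and at least `n` further primes, so fuel `W` reaches
  -- every prime of the run.
  Good : ℕ → Set
  Good t = Prime t × π t + n < π (t + W)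

  good? : Decidable Good
  good? t = prime? t ×-dec (π t + n <? π (t + W))

  module _ {t} (good : Good t) where

    private
      next-spec : ∀ s i → i < n → Prime s → t ≤ s → π s ≡ π t + i →
                  Prime (next s) × s < next s × next s < t + W × π (next s) ≡ suc (π s) × (∀ r → s < r → r < next s → ¬ Prime r)
      next-spec s i i<n ps t≤s πs with search-spec W (suc s) (t + W)
        (≤-trans (≤-reflexive (cong suc (trans (π-suc-prime ps) (trans (cong suc πs) (sym (+-suc (π t) i)))))) (≤-trans (s≤s (+-monoʳ-≤ (π t) i<n)) (proj₂ good)))
        (≤-trans (+-monoˡ-≤ W t≤s) (n≤1+n _))
      ... | pq , s< , q< , πq , gap = pq , s< , q< , trans πq (π-suc-prime ps) , gap

    run-spec : ∀ i → i ≤ n → Prime (run t i) × t ≤ run t i × π (run t i) ≡ π t + i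
    run-spec zero _ = proj₁ good , ≤-refl , sym (+-identityʳ _)
    run-spec (suc i) i<n with run-spec i (<⇒≤ i<n)
    ... | ps , t≤s , πs with next-spec (run t i) i i<n ps t≤s πs
    ...   | pq , s<q , _ , πq , _ = pq , ≤-trans t≤s (<⇒≤ s<q) , trans πq (trans (cong suc πs) (sym (+-suc (π t) i)))

    run-step : ∀ i → i < n → run t i < run t (suc i) × run t (suc i) < t + W × (∀ r → run t i < r → r < run t (suc i) → ¬ Prime r)
    run-step i i<n with run-spec i (<⇒≤ i<n)
    ... | ps , t≤s , πs with next-spec (run t i) i i<n ps t≤s πs
    ...   | _ , s<q , q< , _ , gap = s<q , q< , gap

    run-< : ∀ i → i ≤ n → 0 < W → run t i < t + W
    run-< zero _ W>0 = m<m+n t W>0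
    run-< (suc i) i<n _ = proj₁ (proj₂ (run-step i i<n))

  -- A bad prime at u + m forces π(u + W) ≤ π(u + m) + n, so the truncated subtraction is genuine
  -- whenever the count increases. For m = W the right-hand side collapses to `n`.
  window : ∀ u m → Σ< m (λ i → ⟦ prime? (u + i) ×-dec (π (u + i + W) ≤? π (u + i) + n) ⟧) ≤ (π (u + m) + n) ∸ π (u + W)
  window u zero = z≤n
  window u (suc m) rewrite +-suc u m with prime? (u + m) | π (u + m + W) ≤? π (u + m) + n | window u m
  ... | no _ | _ | ih rewrite +-identityʳ (π (u + m)) = ≤-trans (≤-reflexive (+-identityʳ _)) ih
  ... | yes _ | no _ | ih = ≤-trans (≤-reflexive (+-identityʳ _)) (≤-trans ih (∸-monoˡ-≤ (π (u + W)) (+-monoˡ-≤ n (m≤m+n (π (u + m)) 1))))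
  ... | yes _ | yes bad | ih = ≤-trans (+-monoˡ-≤ 1 ih) (≤-reflexive (trans (+-comm _ 1) (trans (sym (+-∸-assoc 1 (≤-trans (π-mono (+-monoˡ-≤ W (m≤m+n u m))) bad)))
          (cong (_∸ π (u + W)) (lem (π (u + m)) n)))))
    where
    lem : ∀ a b → suc (a + b) ≡ a + 1 + b
    lem = solve-∀

  -- Only the last n primes of a window of length W can fail to be good.
  bad-count : ∀ q → count (λ t → prime? t ×-dec (π (t + W) ≤? π t + n)) (q * W) ≤ q * n
  bad-count zero = z≤n
  bad-count (suc q) = begin
    count bad? (W + q * W) ≡⟨ cong (count bad?) (+-comm W (q * W)) ⟩
    count bad? (q * W + W) ≡⟨ Σ<-split (q * W) W _ ⟩
    count bad? (q * W) + Σ< W (λ i → ⟦ bad? (q * W + i) ⟧) ≤⟨ +-mono-≤ (bad-count q) (≤-trans (window (q * W) W) (≤-reflexive (m+n∸m≡n (π (q * W + W)) n))) ⟩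
    q * n + n ≡⟨ +-comm (q * n) n ⟩
    n + q * n ∎
    where
    open ≤-Reasoning
    bad? : Decidable (λ t → Prime t × π (t + W) ≤ π t + n)
    bad? t = prime? t ×-dec (π (t + W) ≤? π t + n)

  good-count : ∀ q → π (q * W) ≤ count good? (q * W) + q * n
  good-count q = ≤-trans (count-⊎ prime? good? (λ t → prime? t ×-dec (π (t + W) ≤? π t + n)) (q * W) split) (+-monoʳ-≤ _ (bad-count q))
    where
    split : ∀ t → t < q * W → Prime t → Good t ⊎ (Prime t × π (t + W) ≤ π t + n)
    split t _ pt with π t + n <? π (t + W)
    ... | yes l = inj₁ (pt , l)
    ... | no ¬l = inj₂ (pt , ≮⇒≥ ¬l)

  gaps : ℕ → ℕ → List ℕ
  gaps zero t = []
  gaps (suc m) t = (next t ∸ t) ∷ gaps m (next t)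

  length-gaps : ∀ m t → length (gaps m t) ≡ m
  length-gaps zero t = refl
  length-gaps (suc m) t = cong suc (length-gaps m (next t))

-- Fibres of a key and boxes of patterns.

_≟ᴸ_ : (a b : List ℕ) → Dec (a ≡ b)
_≟ᴸ_ = ≡-dec _≟_

-- Pigeonhole principle in counting form, by induction on the list of possible keys. `X` is the
-- denominator of the bound for a single fibre.
fibres : (P? : Decidable P) (key : ℕ → List ℕ) (𝒦 : List (List ℕ)) → ∀ Y X Z → (∀ t → t < Y → P t → key t ∈ 𝒦) →
         (∀ κ → count (λ t → P? t ×-dec (key t ≟ᴸ κ)) Y * X ≤ Z) → count P? Y * X ≤ length 𝒦 * Z
fibres {P} P? key 𝒦 Y X Z key∈ bound = ≤-trans (*-monoˡ-≤ X (count-mono P? (λ t → P? t ×-dec (key t ∈? 𝒦)) Y (λ t t<Y p → p , key∈ t t<Y p))) (go 𝒦)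
  where
  go : ∀ L → count (λ t → P? t ×-dec (key t ∈? L)) Y * X ≤ length L * Z
  go [] = ≤-reflexive (cong (_* X) (trans (Σ<-cong Y λ t _ → ⟦⟧-no (P? t ×-dec (key t ∈? [])) λ ()) (Σ<-0 Y)))
  go (κ ∷ L) = begin
    count (λ t → P? t ×-dec (key t ∈? (κ ∷ L))) Y * X
      ≤⟨ *-monoˡ-≤ X (count-⊎ (λ t → P? t ×-dec (key t ∈? (κ ∷ L))) (λ t → P? t ×-dec (key t ≟ᴸ κ)) (λ t → P? t ×-dec (key t ∈? L)) Y split) ⟩
    (count (λ t → P? t ×-dec (key t ≟ᴸ κ)) Y + count (λ t → P? t ×-dec (key t ∈? L)) Y) * X
      ≡⟨ *-distribʳ-+ X (count (λ t → P? t ×-dec (key t ≟ᴸ κ)) Y) _ ⟩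
    count (λ t → P? t ×-dec (key t ≟ᴸ κ)) Y * X + count (λ t → P? t ×-dec (key t ∈? L)) Y * X
      ≤⟨ +-mono-≤ (bound κ) (go L) ⟩
    Z + length L * Z ∎
    where
    open ≤-Reasoning
    split : ∀ t → t < Y → P t × key t ∈ κ ∷ L → (P t × key t ≡ κ) ⊎ (P t × key t ∈ L)
    split t _ (p , here e) = inj₁ (p , e)
    split t _ (p , there m) = inj₂ (p , m)

length-product : ∀ {A B C : Set} (f : A → B → C) xs ys → length (cartesianProductWith f xs ys) ≡ length xs * length ys
length-product f [] ys = refl
length-product f (x ∷ xs) ys = trans (length-++ (map (f x) ys)) (cong₂ _+_ (length-map (f x) ys) (length-product f xs ys))

box : ℕ → ℕ → List (List ℕ)
box m zero = [] ∷ []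
box m (suc l) = cartesianProductWith _∷_ (upTo m) (box m l)

length-box : ∀ m l → length (box m l) ≡ m ^ l
length-box m zero = refl
length-box m (suc l) = trans (length-product _∷_ (upTo m) (box m l)) (cong₂ _*_ (length-upTo m) (length-box m l))

∈-box : ∀ {m a} → All (_< m) a → a ∈ box m (length a)
∈-box [] = here refl
∈-box (a< ∷ as) = ∈-cartesianProductWith⁺ _∷_ (∈-upTo⁺ a<) (∈-box as)

-- Either the first entry is below `g` or a later one is. Lists with several small entries are
-- repeated, which is harmless for an upper bound.
small-box : ℕ → ℕ → ℕ → List (List ℕ)
small-box g m zero = []
small-box g m (suc l) = cartesianProductWith _∷_ (upTo g) (box m l) ++ cartesianProductWith _∷_ (upTo m) (small-box g m l)

length-small-box : ∀ g m l → length (small-box g m l) * m ≡ l * g * m ^ l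
length-small-box g m zero = refl
length-small-box g m (suc l) = begin
  length (small-box g m (suc l)) * m ≡⟨ cong (_* m) (trans (length-++ (cartesianProductWith _∷_ (upTo g) (box m l))) (cong₂ _+_
    (trans (length-product _∷_ (upTo g) (box m l)) (cong₂ _*_ (length-upTo g) (length-box m l)))
    (trans (length-product _∷_ (upTo m) (small-box g m l)) (cong (_* length (small-box g m l)) (length-upTo m))))) ⟩
  (g * m ^ l + m * s) * m ≡⟨ lem₁ g (m ^ l) m s ⟩
  g * m ^ l * m + m * (s * m) ≡⟨ cong (λ x → g * m ^ l * m + m * x) (length-small-box g m l) ⟩
  g * m ^ l * m + m * (l * g * m ^ l) ≡⟨ lem₂ g (m ^ l) m l ⟩
  suc l * g * (m * m ^ l) ∎
  where
  open ≡-Reasoning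
  s = length (small-box g m l)
  lem₁ : ∀ g x m s → (g * x + m * s) * m ≡ g * x * m + m * (s * m)
  lem₁ = solve-∀
  lem₂ : ∀ g x m l → g * x * m + m * (l * g * x) ≡ suc l * g * (m * x)
  lem₂ = solve-∀

∈-small-box : ∀ {g m a} → All (_< m) a → Any (_< g) a → a ∈ small-box g m (length a)
∈-small-box (_ ∷ as) (here a<g) = ∈-++⁺ˡ (∈-cartesianProductWith⁺ _∷_ (∈-upTo⁺ a<g) (∈-box as))
∈-small-box {g} {m} {_ ∷ a} (a< ∷ as) (there any) = ∈-++⁺ʳ (cartesianProductWith _∷_ (upTo g) (box m (length a))) (∈-cartesianProductWith⁺ _∷_ (∈-upTo⁺ a<) (∈-small-box as any))

module Keys (Λ τ : ℕ) .{{_ : NonZero τ}} where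

  -- Translation along the direction (1, Λ, Λ², ...). A key moves a pattern forward until its head
  -- reaches the next multiple of `τ`, not back to the previous one, so that only additions occur.
  shift : ℕ → List ℕ → List ℕ
  shift c [] = []
  shift c (a ∷ as) = (a + c) ∷ shift (c * Λ) as

  -- Lists with equal keys differ, in one direction or the other, by d Λ ^ i at position i for a common d < τ.
  key : List ℕ → List ℕ
  key [] = []
  key (a ∷ as) = a / τ ∷ shift ((τ ∸ a % τ) * Λ) as

  shift-cancel : ∀ c d as bs → shift (c + d) as ≡ shift c bs → bs ≡ shift d as
  shift-cancel c d [] [] _ = refl
  shift-cancel c d (a ∷ as) (b ∷ bs) e = cong₂ _∷_
    (+-cancelʳ-≡ c _ _ (trans (sym (∷-injectiveˡ e)) (lem a c d)))
    (shift-cancel (c * Λ) (d * Λ) as bs (trans (cong (λ u → shift u as) (sym (*-distribʳ-+ Λ c d))) (∷-injectiveʳ e)))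
    where
    lem : ∀ a c d → a + (c + d) ≡ a + d + c
    lem = solve-∀

  shift-injective : ∀ c as bs → shift c as ≡ shift c bs → as ≡ bs
  shift-injective c [] [] _ = refl
  shift-injective c (a ∷ as) (b ∷ bs) e = cong₂ _∷_ (+-cancelʳ-≡ c _ _ (∷-injectiveˡ e)) (shift-injective (c * Λ) as bs (∷-injectiveʳ e))

  private
    ordered : ∀ a as b bs → a % τ < b % τ → key (a ∷ as) ≡ key (b ∷ bs) → ∃ λ d → 0 < d × d < τ × b ∷ bs ≡ shift d (a ∷ as)
    ordered a as b bs lt e = d , m<n⇒0<n∸m lt , ≤-trans (s≤s (m∸n≤m (b % τ) (a % τ))) (m%n<n b τ) , cong₂ _∷_ b≡
      (shift-cancel ((τ ∸ b % τ) * Λ) (d * Λ) as bs (trans (cong (λ u → shift u as) (sym c≡)) (∷-injectiveʳ e)))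
      where
      d = b % τ ∸ a % τ
      b≡ : b ≡ a + d
      b≡ = begin
        b ≡⟨ m≡m%n+[m/n]*n b τ ⟩
        b % τ + b / τ * τ ≡⟨ cong₂ _+_ (m+[n∸m]≡n (<⇒≤ lt)) (cong (_* τ) (∷-injectiveˡ e)) ⟨
        a % τ + d + a / τ * τ ≡⟨ lem (a % τ) d (a / τ * τ) ⟩
        a % τ + a / τ * τ + d ≡⟨ cong (_+ d) (m≡m%n+[m/n]*n a τ) ⟨
        a + d ∎
        where
        open ≡-Reasoning
        lem : ∀ x y z → x + y + z ≡ x + z + y
        lem = solve-∀
      c≡ : (τ ∸ a % τ) * Λ ≡ (τ ∸ b % τ) * Λ + d * Λ
      c≡ = trans (cong (_* Λ) (+-cancelʳ-≡ (a % τ) _ _ (begin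
        τ ∸ a % τ + a % τ ≡⟨ m∸n+n≡m (<⇒≤ (m%n<n a τ)) ⟩
        τ ≡⟨ m∸n+n≡m (<⇒≤ (m%n<n b τ)) ⟨
        τ ∸ b % τ + b % τ ≡⟨ cong (τ ∸ b % τ +_) (m∸n+n≡m (<⇒≤ lt)) ⟨
        τ ∸ b % τ + (d + a % τ) ≡⟨ +-assoc (τ ∸ b % τ) d _ ⟨
        τ ∸ b % τ + d + a % τ ∎))) (*-distribʳ-+ Λ (τ ∸ b % τ) d)
        where open ≡-Reasoning

  Shifted : List ℕ → List ℕ → Set
  Shifted a b = ∃ λ d → 0 < d × d < τ × b ≡ shift d a

  collision : ∀ a b → key a ≡ key b → a ≢ b → Shifted a b ⊎ Shifted b a
  collision [] [] _ ne = contradiction refl ne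
  collision (a ∷ as) (b ∷ bs) e ne with <-cmp (a % τ) (b % τ)
  ... | tri< lt _ _ = inj₁ (ordered a as b bs lt e)
  ... | tri> _ _ gt = inj₂ (ordered b bs a as gt (sym e))
  ... | tri≈ _ eq _ = contradiction (cong₂ _∷_
          (trans (m≡m%n+[m/n]*n a τ) (trans (cong₂ (λ u v → u + v * τ) eq (∷-injectiveˡ e)) (sym (m≡m%n+[m/n]*n b τ))))
          (shift-injective _ as bs (trans (∷-injectiveʳ e) (cong (λ u → shift ((τ ∸ u) * Λ) bs) (sym eq))))) ne

  length-shift : ∀ c as → length (shift c as) ≡ length as
  length-shift c [] = refl
  length-shift c (a ∷ as) = cong suc (length-shift (c * Λ) as)

  shift-< : ∀ {W} c m as → 0 < Λ → length as ≤ m → All (_< W) as → All (_< W + c * Λ ^ m) (shift c as)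
  shift-< c m [] _ _ _ = []
  shift-< {W} c (suc m) (a ∷ as) Λ>0 (s≤s l) (a< ∷ as<) =
    +-mono-<-≤ a< (m≤m*n c (Λ ^ suc m) {{m^n≢0 Λ (suc m) {{>-nonZero Λ>0}}}}) ∷
    All.map (λ {x} → subst (λ u → x < W + u) (*-assoc c Λ (Λ ^ m))) (shift-< (c * Λ) m as Λ>0 l as<)

  keys : ℕ → ℕ → ℕ → List (List ℕ)
  keys q m l = cartesianProductWith _∷_ (upTo q) (box m l)

  length-keys : ∀ q m l → length (keys q m l) ≡ q * m ^ l
  length-keys q m l = trans (length-product _∷_ (upTo q) (box m l)) (cong₂ _*_ (length-upTo q) (length-box m l))

  ∈-keys : ∀ q l a → 0 < Λ → length a ≡ suc l → All (_< q * τ) a → key a ∈ keys q (q * τ + τ * Λ ^ suc l) l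
  ∈-keys q l (a ∷ as) Λ>0 refl (a< ∷ as<) = ∈-cartesianProductWith⁺ _∷_ (∈-upTo⁺ (m<n*o⇒m/o<n {n = q} a<))
    (subst (λ u → shift c as ∈ box (q * τ + τ * Λ ^ suc l) u) (length-shift c as)
      (∈-box (All.map (λ x< → ≤-trans x< (+-monoʳ-≤ (q * τ) bound)) (shift-< c l as Λ>0 ≤-refl as<))))
    where
    c = (τ ∸ a % τ) * Λ
    bound : c * Λ ^ l ≤ τ * Λ ^ suc l
    bound = ≤-trans (≤-reflexive (*-assoc (τ ∸ a % τ) Λ (Λ ^ l))) (*-monoˡ-≤ (Λ * Λ ^ l) (m∸n≤m τ (a % τ)))

-- Convex chains in the prime grid

toℚᵘ-toℚ : ∀ n → toℚᵘ (toℚ n) ℚᵘ.≃ mkℚᵘ (ℤ.+ n) 0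
toℚᵘ-toℚ n = ℚₚ.toℚᵘ-fromℚᵘ (mkℚᵘ (ℤ.+ n) 0)

toℚ-+ : ∀ m n → toℚ (m + n) ≡ toℚ m ℚ.+ toℚ n
toℚ-+ m n = ℚₚ.toℚᵘ-injective (begin
  toℚᵘ (toℚ (m + n)) ≈⟨ toℚᵘ-toℚ (m + n) ⟩
  mkℚᵘ (ℤ.+ (m + n)) 0 ≈⟨ *≡* (cong (ℤ._* ℤ.+ 1) (sym (cong₂ ℤ._+_ (ℤₚ.*-identityʳ (ℤ.+ m)) (ℤₚ.*-identityʳ (ℤ.+ n))))) ⟩
  mkℚᵘ (ℤ.+ m) 0 ℚᵘ.+ mkℚᵘ (ℤ.+ n) 0 ≈⟨ ℚᵘₚ.+-cong (toℚᵘ-toℚ m) (toℚᵘ-toℚ n) ⟨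
  toℚᵘ (toℚ m) ℚᵘ.+ toℚᵘ (toℚ n) ≈⟨ ℚₚ.toℚᵘ-homo-+ (toℚ m) (toℚ n) ⟨
  toℚᵘ (toℚ m ℚ.+ toℚ n) ∎)
  where open ℚᵘₚ.≃-Reasoning

toℚ-* : ∀ m n → toℚ (m * n) ≡ toℚ m ℚ.* toℚ n
toℚ-* m n = ℚₚ.toℚᵘ-injective (begin
  toℚᵘ (toℚ (m * n)) ≈⟨ toℚᵘ-toℚ (m * n) ⟩
  mkℚᵘ (ℤ.+ (m * n)) 0 ≈⟨ *≡* (cong (ℤ._* ℤ.+ 1) (ℤₚ.pos-* m n)) ⟩
  mkℚᵘ (ℤ.+ m) 0 ℚᵘ.* mkℚᵘ (ℤ.+ n) 0 ≈⟨ ℚᵘₚ.*-cong (toℚᵘ-toℚ m) (toℚᵘ-toℚ n) ⟨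
  toℚᵘ (toℚ m) ℚᵘ.* toℚᵘ (toℚ n) ≈⟨ ℚₚ.toℚᵘ-homo-* (toℚ m) (toℚ n) ⟨
  toℚᵘ (toℚ m ℚ.* toℚ n) ∎)
  where open ℚᵘₚ.≃-Reasoning

toℚ-mono-≤ : ∀ {m n} → m ≤ n → toℚ m ℚ.≤ toℚ n
toℚ-mono-≤ {m} {n} m≤n = ℚₚ.toℚᵘ-cancel-≤ (begin
  toℚᵘ (toℚ m) ≃⟨ toℚᵘ-toℚ m ⟩
  mkℚᵘ (ℤ.+ m) 0 ≤⟨ *≤* (ℤₚ.*-monoʳ-≤-nonNeg (ℤ.+ 1) (ℤ.+≤+ m≤n)) ⟩
  mkℚᵘ (ℤ.+ n) 0 ≃⟨ toℚᵘ-toℚ n ⟨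
  toℚᵘ (toℚ n) ∎)
  where open ℚᵘₚ.≤-Reasoning

toℚ-cancel-≤ : ∀ {m n} → toℚ m ℚ.≤ toℚ n → m ≤ n
toℚ-cancel-≤ {m} {n} le = ℤₚ.drop‿+≤+ (ℤₚ.*-cancelʳ-≤-pos _ _ (ℤ.+ 1) (ℚᵘₚ.drop-*≤* (begin
  mkℚᵘ (ℤ.+ m) 0 ≃⟨ toℚᵘ-toℚ m ⟨
  toℚᵘ (toℚ m) ≤⟨ ℚₚ.toℚᵘ-mono-≤ le ⟩
  toℚᵘ (toℚ n) ≃⟨ toℚᵘ-toℚ n ⟩
  mkℚᵘ (ℤ.+ n) 0 ∎)))
  where open ℚᵘₚ.≤-Reasoning

toℚ-mono-< : ∀ {m n} → m < n → toℚ m ℚ.< toℚ n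
toℚ-mono-< m<n = ℚₚ.≰⇒> λ le → <⇒≱ m<n (toℚ-cancel-≤ le)

-- Convex combinations and affine inequalities.

∑-cong : ∀ {k} {f g : Fin k → ℚ} → (∀ i → f i ≡ g i) → ∑ f ≡ ∑ g
∑-cong {zero} h = refl
∑-cong {suc k} h = cong₂ ℚ._+_ (h zero) (∑-cong (λ i → h (suc i)))

∑-+ : ∀ k (f g : Fin k → ℚ) → ∑ (λ i → f i ℚ.+ g i) ≡ ∑ f ℚ.+ ∑ g
∑-+ zero f g = refl
∑-+ (suc k) f g = trans (cong (f zero ℚ.+ g zero ℚ.+_) (∑-+ k (λ i → f (suc i)) (λ i → g (suc i))))
  (solve 4 (λ a b c d → (a :+ b) :+ (c :+ d) := (a :+ c) :+ (b :+ d)) refl (f zero) (g zero) (∑ (λ i → f (suc i))) (∑ (λ i → g (suc i))))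
  where open +-*-Solver

∑-* : ∀ k c (f : Fin k → ℚ) → ∑ (λ i → c ℚ.* f i) ≡ c ℚ.* ∑ f
∑-* zero c f = sym (ℚₚ.*-zeroʳ c)
∑-* (suc k) c f = trans (cong (c ℚ.* f zero ℚ.+_) (∑-* k c (λ i → f (suc i)))) (sym (ℚₚ.*-distribˡ-+ c (f zero) _))

∑-mono : ∀ {k} {f g : Fin k → ℚ} → (∀ i → f i ℚ.≤ g i) → ∑ f ℚ.≤ ∑ g
∑-mono {zero} h = ℚₚ.≤-refl
∑-mono {suc k} h = ℚₚ.+-mono-≤ (h zero) (∑-mono (λ i → h (suc i)))

∑-tight : ∀ {k} {f g : Fin k → ℚ} → (∀ i → f i ℚ.≤ g i) → ∑ g ℚ.≤ ∑ f → ∀ i → f i ≡ g i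
∑-tight {suc k} h le zero = ℚₚ.≤-antisym (h zero) (ℚₚ.≮⇒≥ λ lt →
  ℚₚ.<-irrefl refl (ℚₚ.<-≤-trans (ℚₚ.+-mono-<-≤ lt (∑-mono (λ i → h (suc i)))) le))
∑-tight {suc k} h le (suc i) = ∑-tight (λ j → h (suc j)) (ℚₚ.≮⇒≥ λ lt →
  ℚₚ.<-irrefl refl (ℚₚ.<-≤-trans (ℚₚ.+-mono-≤-< (h zero) lt) le)) i

∑-0 : ∀ k → ∑ {k} (λ _ → 0ℚ) ≡ 0ℚ
∑-0 zero = refl
∑-0 (suc k) = trans (ℚₚ.+-identityˡ _) (∑-0 k)

-- The coefficients are natural, so a half-plane is described by two forms: comparing `l $ p` with
-- `m $ p` gives the sign of an affine form with integer coefficients.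
record Affine : Set where
  constructor affine
  field a b c : ℕ

_$_ : Affine → Point → ℕ
affine a b c $ (x , y) = a * x + b * y + c

module _ {k} {v : Fin k → Point} {w : Fin k → ℚ} {x : Point} (cc : ConvComb v w x) where

  private
    w≥0 = proj₁ cc
    ∑w = proj₁ (proj₂ cc)
    ∑x = proj₁ (proj₂ (proj₂ cc))
    ∑y = proj₂ (proj₂ (proj₂ cc))

  combination : ∀ l → ∑ (λ i → w i ℚ.* toℚ (l $ v i)) ≡ toℚ (l $ x)
  combination l@(affine a b c) = begin
    ∑ (λ i → w i ℚ.* toℚ (l $ v i))
      ≡⟨ ∑-cong (λ i → trans (cong (w i ℚ.*_) (expand (v i))) (rearrange (w i) (X i) (Y i))) ⟩
    ∑ (λ i → toℚ a ℚ.* (w i ℚ.* X i) ℚ.+ toℚ b ℚ.* (w i ℚ.* Y i) ℚ.+ toℚ c ℚ.* w i)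
      ≡⟨ trans (∑-+ k (λ i → aX i ℚ.+ bY i) (λ i → toℚ c ℚ.* w i))
           (cong₂ ℚ._+_ (trans (∑-+ k aX bY) (cong₂ ℚ._+_ (∑-* k (toℚ a) (λ i → w i ℚ.* X i)) (∑-* k (toℚ b) (λ i → w i ℚ.* Y i)))) (∑-* k (toℚ c) w)) ⟩
    toℚ a ℚ.* ∑ (λ i → w i ℚ.* X i) ℚ.+ toℚ b ℚ.* ∑ (λ i → w i ℚ.* Y i) ℚ.+ toℚ c ℚ.* ∑ w
      ≡⟨ cong₂ ℚ._+_ (cong₂ (λ s t → toℚ a ℚ.* s ℚ.+ toℚ b ℚ.* t) ∑x ∑y) (trans (cong (toℚ c ℚ.*_) ∑w) (ℚₚ.*-identityʳ _)) ⟩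
    toℚ a ℚ.* toℚ (proj₁ x) ℚ.+ toℚ b ℚ.* toℚ (proj₂ x) ℚ.+ toℚ c
      ≡⟨ expand x ⟨
    toℚ (l $ x) ∎
    where
    open ≡-Reasoning
    X Y : Fin k → ℚ
    X i = toℚ (proj₁ (v i))
    Y i = toℚ (proj₂ (v i))
    aX bY : Fin k → ℚ
    aX i = toℚ a ℚ.* (w i ℚ.* X i)
    bY i = toℚ b ℚ.* (w i ℚ.* Y i)
    expand : ∀ p → toℚ (l $ p) ≡ toℚ a ℚ.* toℚ (proj₁ p) ℚ.+ toℚ b ℚ.* toℚ (proj₂ p) ℚ.+ toℚ c
    expand (p , q) = trans (toℚ-+ (a * p + b * q) c) (cong (ℚ._+ toℚ c) (trans (toℚ-+ (a * p) (b * q)) (cong₂ ℚ._+_ (toℚ-* a p) (toℚ-* b q))))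
    rearrange : ∀ s x y → s ℚ.* (toℚ a ℚ.* x ℚ.+ toℚ b ℚ.* y ℚ.+ toℚ c) ≡ toℚ a ℚ.* (s ℚ.* x) ℚ.+ toℚ b ℚ.* (s ℚ.* y) ℚ.+ toℚ c ℚ.* s
    rearrange s x y = solve 6 (λ s x y a b c → s :* (a :* x :+ b :* y :+ c) := a :* (s :* x) :+ b :* (s :* y) :+ c :* s) refl s x y (toℚ a) (toℚ b) (toℚ c)
      where open +-*-Solver

  private
    weighted : ∀ i {m n} → m ≤ n → w i ℚ.* toℚ m ℚ.≤ w i ℚ.* toℚ n
    weighted i m≤n = ℚₚ.*-monoˡ-≤-nonNeg (w i) {{ℚ.nonNegative (w≥0 i)}} (toℚ-mono-≤ m≤n)

  hull-≤ : ∀ l m → (∀ i → l $ v i ≤ m $ v i) → l $ x ≤ m $ x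
  hull-≤ l m h = toℚ-cancel-≤ (ℚₚ.≤-trans (ℚₚ.≤-reflexive (sym (combination l)))
    (ℚₚ.≤-trans (∑-mono λ i → weighted i (h i)) (ℚₚ.≤-reflexive (combination m))))

  -- Complementary slackness: a sum of termwise inequalities is tight only if every weighted term
  -- is.
  hull-tight : ∀ l m → (∀ i → l $ v i ≤ m $ v i) → l $ x ≡ m $ x → ∀ i → l $ v i < m $ v i → w i ≡ 0ℚ
  hull-tight l m h eq i lt = sym (ℚₚ.≤-antisym (w≥0 i) (ℚₚ.≮⇒≥ λ w>0 →
    ℚₚ.<⇒≢ (ℚₚ.*-monoʳ-<-pos (w i) {{ℚ.positive w>0}} (toℚ-mono-< lt))
      (∑-tight (λ j → weighted j (h j)) (ℚₚ.≤-reflexive (trans (combination m) (trans (cong toℚ (sym eq)) (sym (combination l))))) i)))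

-- Equality at `v i` forces the weights of all other points to vanish; as `w i` vanishes too, the
-- weights cannot sum to 1.
exposed⇒vertex : ∀ {k} (v : Fin k → Point) i l m → l $ v i ≡ m $ v i → (∀ j → j ≢ i → l $ v j < m $ v j) → IsVertex v i
exposed⇒vertex {k} v i l m eq lt (w , wi≡0 , cc) = 1≢0 (trans (sym (proj₁ (proj₂ cc))) (trans (∑-cong w≡0) (∑-0 k)))
  where
  1≢0 : 1ℚ ≢ 0ℚ
  1≢0 ()
  le : ∀ j → l $ v j ≤ m $ v j
  le j with j Finₚ.≟ i
  ... | yes refl = ≤-reflexive eq
  ... | no j≢i = <⇒≤ (lt j j≢i)
  w≡0 : ∀ j → w j ≡ 0ℚ
  w≡0 j with j Finₚ.≟ i
  ... | yes refl = wi≡0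
  ... | no j≢i = hull-tight cc l m le eq j (lt j j≢i)

record ConsecutivePrimes (n : ℕ) (x : ℕ → ℕ) : Set where
  field
    primes : ∀ i → i ≤ n → Prime (x i)
    no-primes : ∀ i → i < n → ∀ q → x i < q → q < x (suc i) → ¬ Prime q

module Chain (n : ℕ) (x y : ℕ → ℕ) (px : ConsecutivePrimes n x) (py : ConsecutivePrimes n y)
         (W g Λ d : ℕ) (d>0 : 0 < d) (g>0 : 0 < g) (W<Λg : W < Λ * g)
         (gap-≥ : ∀ i → i < n → x i + g ≤ x (suc i))
         (gap-< : ∀ i → i < n → x (suc i) < x i + W)
         (excess : ∀ i → i < n → y (suc i) + x i ≡ y i + x (suc i) + d * Λ ^ i)
         (total : y n + x 0 < y 0 + x n + g) where

  open ConsecutivePrimes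

  vertices : Fin (suc n) → Point
  vertices i = x (toℕ i) , y (toℕ i)

  gap-y : ∀ i → i < n → y i + g ≤ y (suc i)
  gap-y i i<n = +-cancelʳ-≤ (x i) _ _ (begin
    y i + g + x i ≡⟨ lem (y i) g (x i) ⟩
    y i + (x i + g) ≤⟨ +-monoʳ-≤ (y i) (gap-≥ i i<n) ⟩
    y i + x (suc i) ≤⟨ m≤m+n _ _ ⟩
    y i + x (suc i) + d * Λ ^ i ≡⟨ excess i i<n ⟨
    y (suc i) + x i ∎)
    where
    open ≤-Reasoning
    lem : ∀ a b c → a + b + c ≡ a + (c + b)
    lem = solve-∀

  mono : ∀ (f : ℕ → ℕ) → (∀ i → i < n → f i ≤ f (suc i)) → ∀ {i j} → i ≤ j → j ≤ n → f i ≤ f j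
  mono f h {j = zero} z≤n _ = ≤-refl
  mono f h {i} {suc j} i≤ j<n with m≤n⇒m<n∨m≡n i≤
  ... | inj₁ (s≤s i≤j) = ≤-trans (mono f h i≤j (<⇒≤ j<n)) (h j j<n)
  ... | inj₂ refl = ≤-refl

  x-mono : ∀ {i j} → i ≤ j → j ≤ n → x i ≤ x j
  x-mono = mono x λ i i<n → ≤-trans (m≤m+n _ g) (gap-≥ i i<n)

  y-mono : ∀ {i j} → i ≤ j → j ≤ n → y i ≤ y j
  y-mono = mono y λ i i<n → ≤-trans (m≤m+n _ g) (gap-y i i<n)

  difference-mono : ∀ {i j} → i ≤ j → j ≤ n → y i + x j ≤ y j + x i
  difference-mono {j = zero} z≤n _ = ≤-refl
  difference-mono {i} {suc j} i≤ j<n with m≤n⇒m<n∨m≡n i≤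
  ... | inj₂ refl = ≤-refl
  ... | inj₁ (s≤s i≤j) = +-cancelʳ-≤ (y j + x j) _ _ (begin
    y i + x (suc j) + (y j + x j) ≡⟨ lem₁ (y i) (x (suc j)) (y j) (x j) ⟩
    (y i + x j) + (y j + x (suc j)) ≤⟨ +-mono-≤ (difference-mono i≤j (<⇒≤ j<n)) (≤-trans (m≤m+n _ _) (≤-reflexive (sym (excess j j<n)))) ⟩
    (y j + x i) + (y (suc j) + x j) ≡⟨ lem₂ (y j) (x i) (y (suc j)) (x j) ⟩
    y (suc j) + x i + (y j + x j) ∎)
    where
    open ≤-Reasoning
    lem₁ : ∀ a b c d → a + b + (c + d) ≡ (a + d) + (c + b)
    lem₁ = solve-∀
    lem₂ : ∀ a b c d → (a + b) + (c + d) ≡ c + b + (a + d)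
    lem₂ = solve-∀

  -- Supporting line at the i-th vertex: W (Y − X) − d Λ ^ i X decreases along the chain before index i and
  -- increases afterwards. Below a t b compares its values at indices a and b without subtraction.
  module _ (i : ℕ) where

    private
      c = d * Λ ^ i

    Below : ℕ → ℕ → Set
    Below a b = W * y a + (W + c) * x b < W * y b + (W + c) * x a

    Below-trans : ∀ {a b e} → Below a b → Below b e → Below a e
    Below-trans {a} {b} {e} p q = +-cancelʳ-< (W * y b + (W + c) * x b) _ _
      (≤-trans (≤-reflexive (cong suc (lem (W * y a) ((W + c) * x e) (W * y b) ((W + c) * x b))))
        (≤-trans (+-mono-< p q) (≤-reflexive (lem₂ (W * y b) ((W + c) * x a) (W * y e) ((W + c) * x b)))))
      where
      lem : ∀ a b c d → a + b + (c + d) ≡ (a + d) + (c + b)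
      lem = solve-∀
      lem₂ : ∀ a b c d → (a + b) + (c + d) ≡ c + b + (a + d)
      lem₂ = solve-∀

    private
      step-left : ∀ j → j < n → W * y (suc j) + (W + c) * x j ≡ W * y j + W * x (suc j) + (W * (d * Λ ^ j) + c * x j)
      step-left j j<n = begin
        W * y (suc j) + (W + c) * x j ≡⟨ lem₁ W c (y (suc j)) (x j) ⟩
        W * (y (suc j) + x j) + c * x j ≡⟨ cong (λ u → W * u + c * x j) (excess j j<n) ⟩
        W * (y j + x (suc j) + d * Λ ^ j) + c * x j ≡⟨ lem₂ W (y j) (x (suc j)) (d * Λ ^ j) (c * x j) ⟩
        W * y j + W * x (suc j) + (W * (d * Λ ^ j) + c * x j) ∎
        where
        open ≡-Reasoning
        lem₁ : ∀ W c a b → W * a + (W + c) * b ≡ W * (a + b) + c * b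
        lem₁ = solve-∀
        lem₂ : ∀ W a b e f → W * (a + b + e) + f ≡ W * a + W * b + (W * e + f)
        lem₂ = solve-∀

      step-right : ∀ j → W * y j + (W + c) * x (suc j) ≡ W * y j + W * x (suc j) + c * x (suc j)
      step-right j = lem W c (y j) (x (suc j))
        where
        lem : ∀ W c a b → W * a + (W + c) * b ≡ W * a + W * b + c * b
        lem = solve-∀

      instance
        d≢0 : NonZero d
        d≢0 = >-nonZero d>0
        Λ≢0 : NonZero Λ
        Λ≢0 = >-nonZero (≮⇒≥ λ { (s≤s z≤n) → contradiction W<Λg λ () })

      c>0 : 0 < c
      c>0 = *-mono-≤ d>0 (m^n>0 Λ i)

    -- The supporting line has slope 1 + d Λ^i / W, which separates edge i - 1 from edge i. Along an
    -- edge j ≥ i, Y - X grows by d Λ^j ≥ d Λ^i while X grows by less than `W`.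
    up : ∀ j → i ≤ j → j < n → Below j (suc j)
    up j i≤j j<n = begin-strict
      W * y j + (W + c) * x (suc j) ≡⟨ step-right j ⟩
      W * y j + W * x (suc j) + c * x (suc j) <⟨ +-monoʳ-< (W * y j + W * x (suc j)) (begin-strict
        c * x (suc j) <⟨ *-monoʳ-< c {{>-nonZero c>0}} (gap-< j j<n) ⟩
        c * (x j + W) ≡⟨ lem c (x j) W ⟩
        W * c + c * x j ≤⟨ +-monoˡ-≤ (c * x j) (*-monoʳ-≤ W (*-monoʳ-≤ d (^-monoʳ-≤ Λ i≤j))) ⟩
        W * (d * Λ ^ j) + c * x j ∎) ⟩
      W * y j + W * x (suc j) + (W * (d * Λ ^ j) + c * x j) ≡⟨ step-left j j<n ⟨
      W * y (suc j) + (W + c) * x j ∎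
      where
      open ≤-Reasoning
      lem : ∀ a b c → a * (b + c) ≡ c * a + a * b
      lem = solve-∀

    -- For j < i the gap of X is at least `g`, and W d Λ^j < Λ g d Λ^j ≤ g d Λ^i.
    down : ∀ j → j < i → j < n → Below (suc j) j
    down j j<i j<n = begin-strict
      W * y (suc j) + (W + c) * x j ≡⟨ step-left j j<n ⟩
      W * y j + W * x (suc j) + (W * (d * Λ ^ j) + c * x j) <⟨ +-monoʳ-< (W * y j + W * x (suc j)) (begin-strict
        W * (d * Λ ^ j) + c * x j <⟨ +-monoˡ-< (c * x j) (*-monoˡ-< (d * Λ ^ j) {{m*n≢0 d (Λ ^ j) {{d≢0}} {{m^n≢0 Λ j}}}} W<Λg) ⟩
        Λ * g * (d * Λ ^ j) + c * x j ≡⟨ cong (_+ c * x j) (lem Λ g d (Λ ^ j)) ⟩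
        d * (Λ ^ suc j) * g + c * x j ≤⟨ +-monoˡ-≤ (c * x j) (*-monoˡ-≤ g (*-monoʳ-≤ d (^-monoʳ-≤ Λ j<i))) ⟩
        c * g + c * x j ≡⟨ trans (+-comm (c * g) _) (sym (*-distribˡ-+ c (x j) g)) ⟩
        c * (x j + g) ≤⟨ *-monoʳ-≤ c (gap-≥ j j<n) ⟩
        c * x (suc j) ∎) ⟩
      W * y j + W * x (suc j) + c * x (suc j) ≡⟨ step-right j ⟨
      W * y j + (W + c) * x (suc j) ∎
      where
      open ≤-Reasoning
      lem : ∀ Λ g d P → Λ * g * (d * P) ≡ d * (Λ * P) * g
      lem = solve-∀

    above-after : ∀ j → i < j → j ≤ n → Below i j
    above-after (suc j) (s≤s i≤j) j<n with m≤n⇒m<n∨m≡n i≤j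
    ... | inj₁ i<j = Below-trans {i} {j} {suc j} (above-after j i<j (<⇒≤ j<n)) (up j i≤j j<n)
    ... | inj₂ refl = up j i≤j j<n

    above-before : ∀ m j → m + j ≡ i → j < i → i ≤ n → Below i j
    above-before zero j refl j<i _ = contradiction j<i (n≮n _)
    above-before (suc m) j e j<i i≤n with m≤n⇒m<n∨m≡n j<i
    ... | inj₁ sj<i = Below-trans {i} {suc j} {j} (above-before m (suc j) (trans (+-suc m j) e) sj<i i≤n) (down j j<i (<-≤-trans j<i i≤n))
    ... | inj₂ refl = down j j<i i≤n

    above : ∀ j → j ≢ i → i ≤ n → j ≤ n → Below i j
    above j j≢i i≤n j≤n with <-cmp i j
    ... | tri< i<j _ _ = above-after j i<j j≤n
    ... | tri≈ _ i≡j _ = contradiction (sym i≡j) j≢i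
    ... | tri> _ _ j<i = above-before (i ∸ j) j (m∸n+n≡m (<⇒≤ j<i)) j<i i≤n

  vertices-exposed : ∀ i → IsVertex vertices i
  vertices-exposed i = exposed⇒vertex vertices i l m
    (lem (W + c) (x ι) W (y ι))
    λ j j≢i → ≤-trans (≤-reflexive (cong suc (lem₁ (W + c) (x (toℕ j)) (y (toℕ j)) (W * y ι))))
      (≤-trans (above ι (toℕ j) (λ e → j≢i (Finₚ.toℕ-injective e)) (≤-pred (Finₚ.toℕ<n i)) (≤-pred (Finₚ.toℕ<n j)))
        (≤-reflexive (lem₂ W (x (toℕ j)) (y (toℕ j)) ((W + c) * x ι))))
    where
    ι = toℕ i
    c = d * Λ ^ ι
    l = affine (W + c) 0 (W * y ι)
    m = affine 0 W ((W + c) * x ι)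
    lem : ∀ A x W y → A * x + 0 * y + W * y ≡ 0 * x + W * y + A * x
    lem = solve-∀
    lem₁ : ∀ A x y C → A * x + 0 * y + C ≡ C + A * x
    lem₁ = solve-∀
    lem₂ : ∀ W x y C → W * y + C ≡ 0 * x + W * y + C
    lem₂ = solve-∀

  locate : ∀ {z} → ConsecutivePrimes n z → ∀ m → m ≤ n → ∀ p → Prime p → z 0 ≤ p → p ≤ z m → ∃ λ i → i ≤ m × z i ≡ p
  locate cz zero _ p _ lo hi = 0 , z≤n , ≤-antisym lo hi
  locate {z} cz (suc m) m<n p pp lo hi with p ≤? z m
  ... | yes p≤ = let i , i≤ , e = locate cz m (<⇒≤ m<n) p pp lo p≤ in i , m≤n⇒m≤1+n i≤ , e
  ... | no p≰ with m≤n⇒m<n∨m≡n hi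
  ...   | inj₁ p< = contradiction pp (no-primes cz m m<n p (≰⇒> p≰) p<)
  ...   | inj₂ e = suc m , ≤-refl , sym e

  -- Leaving the chain changes Y - X by at least `g`, and by `total` the strip is narrower than `g`:
  -- for i < j the point (x i, y j) lies above it, for j < i below it.
  same-index : ∀ i j → i ≤ n → j ≤ n → y 0 + x i ≤ y j + x 0 → y j + x n ≤ y n + x i → i ≡ j
  same-index i j i≤n j≤n lower upper with <-cmp i j
  ... | tri≈ _ e _ = e
  ... | tri< i<j _ _ = contradiction (begin-strict
        y i + g + (x n + x 0) ≤⟨ +-monoˡ-≤ (x n + x 0) (≤-trans (gap-y i (<-≤-trans i<j j≤n)) (y-mono i<j j≤n)) ⟩
        y j + (x n + x 0) ≡⟨ +-assoc (y j) (x n) (x 0) ⟨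
        y j + x n + x 0 ≤⟨ +-monoˡ-≤ (x 0) upper ⟩
        y n + x i + x 0 ≡⟨ lem₁ (y n) (x i) (x 0) ⟩
        x i + (y n + x 0) <⟨ +-monoʳ-< (x i) total ⟩
        x i + (y 0 + x n + g) ≡⟨ lem₂ (x i) (y 0) (x n) g ⟩
        y 0 + x i + (x n + g) ≤⟨ +-monoˡ-≤ (x n + g) (difference-mono z≤n i≤n) ⟩
        y i + x 0 + (x n + g) ≡⟨ lem₃ (y i) (x 0) (x n) g ⟩
        y i + g + (x n + x 0) ∎) (n≮n _)
    where
    open ≤-Reasoning
    lem₁ : ∀ a b c → a + b + c ≡ b + (a + c)
    lem₁ = solve-∀
    lem₂ : ∀ a b c d → a + (b + c + d) ≡ b + a + (c + d)
    lem₂ = solve-∀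
    lem₃ : ∀ a b c d → a + b + (c + d) ≡ a + d + (c + b)
    lem₃ = solve-∀
  ... | tri> _ _ j<i = contradiction (begin-strict
        y 0 + (x j + g) + x n ≤⟨ +-monoˡ-≤ (x n) (+-monoʳ-≤ (y 0) (≤-trans (gap-≥ j (<-≤-trans j<i i≤n)) (x-mono j<i i≤n))) ⟩
        y 0 + x i + x n ≤⟨ +-monoˡ-≤ (x n) lower ⟩
        y j + x 0 + x n ≡⟨ lem₁ (y j) (x 0) (x n) ⟩
        y j + x n + x 0 ≤⟨ +-monoˡ-≤ (x 0) (difference-mono j≤n ≤-refl) ⟩
        y n + x j + x 0 ≡⟨ lem₂ (y n) (x j) (x 0) ⟩
        x j + (y n + x 0) <⟨ +-monoʳ-< (x j) total ⟩
        x j + (y 0 + x n + g) ≡⟨ lem₃ (x j) (y 0) (x n) g ⟩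
        y 0 + (x j + g) + x n ∎) (n≮n _)
    where
    open ≤-Reasoning
    lem₁ : ∀ a b c → a + b + c ≡ a + c + b
    lem₁ = solve-∀
    lem₂ : ∀ a b c → a + b + c ≡ b + (a + c)
    lem₂ = solve-∀
    lem₃ : ∀ a b c d → a + (b + c + d) ≡ b + (a + d) + c
    lem₃ = solve-∀

  empty-polygon : EmptyPolygonInP² vertices
  empty-polygon = vertices-exposed ,
    (λ i → primes px _ (≤-pred (Finₚ.toℕ<n i)) , primes py _ (≤-pred (Finₚ.toℕ<n i))) ,
    empty
    where
    empty : ∀ r → InP² r → InHull vertices r → ∃ λ i → vertices i ≡ r
    empty (p , q) (pp , pq) (w , cc) = conclude
      (locate px n ≤-refl p pp p-lower p-upper) (locate py n ≤-refl q pq q-lower q-upper)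
      where
      ≤n : ∀ (i : Fin (suc n)) → toℕ i ≤ n
      ≤n i = ≤-pred (Finₚ.toℕ<n i)
      unX : ∀ x y → 1 * x + 0 * y + 0 ≡ x
      unX = solve-∀
      unY : ∀ x y → 0 * x + 1 * y + 0 ≡ y
      unY = solve-∀
      unX+ : ∀ x y c → 1 * x + 0 * y + c ≡ c + x
      unX+ = solve-∀
      unY+ : ∀ x y c → 0 * x + 1 * y + c ≡ y + c
      unY+ = solve-∀
      bound : ∀ l m → (∀ j → j ≤ n → l $ (x j , y j) ≤ m $ (x j , y j)) → l $ (p , q) ≤ m $ (p , q)
      bound l m h = hull-≤ cc l m λ i → h (toℕ i) (≤n i)
      by : ∀ {a b c e : ℕ} → a ≡ c → b ≡ e → a ≤ b → c ≤ e
      by refl refl le = le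
      -- Six inequalities hold at every vertex and therefore at (p , q): four for the bounding box,
      -- which place p and q among the two runs, and two for the strip.
      p-lower : x 0 ≤ p
      p-lower = by refl (unX p q) (bound (affine 0 0 (x 0)) (affine 1 0 0) λ j j≤ → by refl (sym (unX (x j) (y j))) (x-mono z≤n j≤))
      p-upper : p ≤ x n
      p-upper = by (unX p q) refl (bound (affine 1 0 0) (affine 0 0 (x n)) λ j j≤ → by (sym (unX (x j) (y j))) refl (x-mono j≤ ≤-refl))
      q-lower : y 0 ≤ q
      q-lower = by refl (unY p q) (bound (affine 0 0 (y 0)) (affine 0 1 0) λ j j≤ → by refl (sym (unY (x j) (y j))) (y-mono z≤n j≤))
      q-upper : q ≤ y n
      q-upper = by (unY p q) refl (bound (affine 0 1 0) (affine 0 0 (y n)) λ j j≤ → by (sym (unY (x j) (y j))) refl (y-mono j≤ ≤-refl))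
      diff-lower : y 0 + p ≤ q + x 0
      diff-lower = by (unX+ p q (y 0)) (unY+ p q (x 0)) (bound (affine 1 0 (y 0)) (affine 0 1 (x 0)) λ j j≤ →
        by (sym (unX+ (x j) (y j) (y 0))) (sym (unY+ (x j) (y j) (x 0))) (difference-mono z≤n j≤))
      diff-upper : q + x n ≤ y n + p
      diff-upper = by (unY+ p q (x n)) (unX+ p q (y n)) (bound (affine 0 1 (x n)) (affine 1 0 (y n)) λ j j≤ →
        by (sym (unY+ (x j) (y j) (x n))) (sym (unX+ (x j) (y j) (y n))) (difference-mono j≤ ≤-refl))

      conclude : (∃ λ i → i ≤ n × x i ≡ p) → (∃ λ j → j ≤ n × y j ≡ q) → ∃ λ i → vertices i ≡ (p , q)
      conclude (i , i≤n , xi≡p) (j , j≤n , yj≡q) = fromℕ< (s≤s i≤n) , cong₂ _,_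
        (trans (cong x (Finₚ.toℕ-fromℕ< (s≤s i≤n))) xi≡p)
        (trans (cong y (trans (Finₚ.toℕ-fromℕ< (s≤s i≤n)) (same-index i j i≤n j≤n
          (by (cong (λ u → y 0 + u) (sym xi≡p)) (cong (λ u → u + x 0) (sym yj≡q)) diff-lower)
          (by (cong (λ u → u + x n) (sym yj≡q)) (cong (λ u → y n + u) (sym xi≡p)) diff-upper)))) yj≡q)

-- Gap patterns

offsets : ℕ → List ℕ → List ℕ
offsets o [] = o ∷ []
offsets o (a ∷ as) = o ∷ offsets (o + a) as

length-offsets : ∀ o as → length (offsets o as) ≡ suc (length as)
length-offsets o [] = refl
length-offsets o (a ∷ as) = cong suc (length-offsets (o + a) as)

offsets-increasing : ∀ o as → All (0 <_) as → AllPairs _<_ (offsets o as)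
offsets-increasing o [] [] = [] ∷ []
offsets-increasing o (a ∷ as) (a>0 ∷ as>0) = beyond (o + a) as as>0 (m<m+n o a>0) ∷ offsets-increasing (o + a) as as>0
  where
  beyond : ∀ {b} o as → All (0 <_) as → b < o → All (b <_) (offsets o as)
  beyond o [] [] b<o = b<o ∷ []
  beyond o (a ∷ as) (_ ∷ as>0) b<o = b<o ∷ beyond (o + a) as as>0 (≤-trans b<o (m≤m+n o a))

-- The Vandermonde product of the shifts: a prime dividing both t + h and t + h′ divides one of its
-- factors.
differences : List ℕ → ℕ
differences [] = 1
differences (h ∷ hs) = product (map (_∸ h) hs) * differences hs

differences>0 : ∀ {H} → AllPairs _<_ H → 0 < differences H
differences>0 [] = z<s
differences>0 {h ∷ _} (h< ∷ inc) = *-mono-≤ (go h<) (differences>0 inc)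
  where
  go : ∀ {hs} → All (h <_) hs → 0 < product (map (_∸ h) hs)
  go [] = z<s
  go (lt ∷ lts) = *-mono-≤ (m<n⇒0<n∸m lt) (go lts)

differences≤ : ∀ {H} W → 0 < W → All (_< W) H → differences H ≤ W ^ (length H * length H)
differences≤ W W>0 [] = ≤-refl
differences≤ {h ∷ hs} W W>0 (_ ∷ hs<) = begin
  product (map (_∸ h) hs) * differences hs ≤⟨ *-mono-≤ (go hs<) (differences≤ W W>0 hs<) ⟩
  W ^ l * W ^ (l * l) ≡⟨ ^-distribˡ-+-* W l (l * l) ⟨
  W ^ (l + l * l) ≤⟨ ^-monoʳ-≤ W {{>-nonZero W>0}} (≤-trans (m≤m+n _ (suc l)) (≤-reflexive (lem l))) ⟩
  W ^ (suc l * suc l) ∎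
  where
  open ≤-Reasoning
  l = length hs
  lem : ∀ l → l + l * l + suc l ≡ suc l * suc l
  lem = solve-∀
  go : ∀ {hs} → All (_< W) hs → product (map (_∸ h) hs) ≤ W ^ length hs
  go [] = ≤-refl
  go {h′ ∷ _} (lt ∷ lts) = *-mono-≤ (≤-trans (m∸n≤m h′ h) (<⇒≤ lt)) (go lts)

differences-separate : ∀ {p H} → AllPairs _<_ H → ¬ p ∣ differences H → AllPairs (λ h h′ → ∀ t → p ∣ t + h → ¬ p ∣ t + h′) H
differences-separate [] _ = []
differences-separate {p} {h ∷ hs} (h< ∷ inc) p∤ =
  go h< (λ d → p∤ (∣m⇒∣m*n (differences hs) d)) ∷ differences-separate inc (λ d → p∤ (∣n⇒∣m*n (product (map (_∸ h) hs)) d))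
  where
  go : ∀ {hs} → All (h <_) hs → ¬ p ∣ product (map (_∸ h) hs) → All (λ h′ → ∀ t → p ∣ t + h → ¬ p ∣ t + h′) hs
  go [] _ = []
  go {h′ ∷ hs′} (lt ∷ lts) p∤ = (λ t d d′ → p∤ (∣m⇒∣m*n _ (∣m+n∣m⇒∣n (subst (p ∣_) (e t) d′) d))) ∷ go lts (λ d → p∤ (∣n⇒∣m*n (h′ ∸ h) d))
    where
    e : ∀ t → t + h′ ≡ t + h + (h′ ∸ h)
    e t = trans (cong (t +_) (sym (m+[n∸m]≡n (<⇒≤ lt)))) (sym (+-assoc t h _))

≤⇒∣! : ∀ {p k} → 0 < p → p ≤ k → p ∣ k !
≤⇒∣! {suc p} {k} _ p≤k = ∣-trans (m∣m*n (p !)) (m≤n⇒m!∣n! p≤k)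

module Patterns (n w : ℕ) where

  W k : ℕ
  W = 2 ^ w
  k = suc n

  open Runs W n public

  W>0 : 0 < W
  W>0 = m^n>0 2 w

  gaps-spec : ∀ {t} → Good t → ∀ m i o → m + i ≡ n → run t i ≡ t + o →
              All (λ h → Prime (t + h)) (offsets o (gaps m (run t i))) × All (_< W) (offsets o (gaps m (run t i))) ×
              All (0 <_) (gaps m (run t i)) × All (_< W) (gaps m (run t i))
  gaps-spec {t} good m i o e s≡ = go m e s≡
    where
    i≤n : ∀ {m i} → m + i ≡ n → i ≤ n
    i≤n {m} {i} e = ≤-trans (m≤n+m i m) (≤-reflexive e)
    at : ∀ {i o} → i ≤ n → run t i ≡ t + o → Prime (t + o) × o < W
    at {i} {o} i≤ s≡ = subst Prime s≡ (proj₁ (run-spec good i i≤)) ,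
      +-cancelˡ-< t _ _ (≤-trans (≤-reflexive (cong suc (sym s≡))) (run-< good i i≤ W>0))
    go : ∀ m {i o} → m + i ≡ n → run t i ≡ t + o →
         All (λ h → Prime (t + h)) (offsets o (gaps m (run t i))) × All (_< W) (offsets o (gaps m (run t i))) ×
         All (0 <_) (gaps m (run t i)) × All (_< W) (gaps m (run t i))
    go zero {i} e s≡ with at (≤-reflexive e) s≡
    ... | p , l = p ∷ [] , l ∷ [] , [] , []
    go (suc m) {i} {o} e s≡ with at (i≤n {suc m} e) s≡ | run-step good i (≤-trans (s≤s (m≤n+m i m)) (≤-reflexive e))
    ... | p , l | s<q , q< , _ with go m {suc i} {o + (next (run t i) ∸ run t i)} (trans (+-suc m i) e)
                (trans (sym (m+[n∸m]≡n (<⇒≤ s<q))) (trans (cong (_+ (next (run t i) ∸ run t i)) s≡) (+-assoc t o _)))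
    ...   | ps , ls , g>0 , g< = p ∷ ps , l ∷ ls , m<n⇒0<n∸m s<q ∷ g>0 ,
            +-cancelˡ-< (run t i) _ _ (≤-trans (≤-reflexive (cong suc (m+[n∸m]≡n (<⇒≤ s<q)))) (≤-trans q< (+-monoˡ-≤ W (proj₁ (proj₂ (run-spec good i (i≤n {suc m} e))))))) ∷ g<

  good-gaps : ∀ {t} → Good t → All (λ h → Prime (t + h)) (offsets 0 (gaps n t)) × All (_< W) (offsets 0 (gaps n t)) ×
              All (0 <_) (gaps n t) × All (_< W) (gaps n t)
  good-gaps {t} good = gaps-spec good n 0 0 (+-identityʳ n) (sym (+-identityʳ t))

  -- Bounds log₂ of the excluded modulus: k! ≤ 2^(k!), and the product of the differences is at most
  -- W^(k²) with W = 2^w.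
  B : ℕ
  B = k ! + w * (k * k)

  module _ (X r Y : ℕ) (X>0 : 0 < X) (r>0 : 0 < r)
           (r-large : (2 * X) ^ (2 * k) * X ^ k ≤ 2 ^ r)
           (Y-large : X ^ k * (1 + k * 2 ^ (2 * X)) ^ r ≤ Y) where

    -- Only a pattern that occurs needs an argument, and an occurrence t₀ supplies what the sieve
    -- requires: positive gaps, offsets below `W`, and the right length.
    pattern-count : ∀ a → count (λ t → good? t ×-dec (gaps n t ≟ᴸ a)) Y * X ^ k ≤ Y * (suc B ^ k + 3)
    pattern-count a with count-∃ (λ t → good? t ×-dec (gaps n t ≟ᴸ a)) Y
    ... | inj₁ e = ≤-trans (≤-reflexive (cong (_* X ^ k) e)) z≤n
    ... | inj₂ (t₀ , _ , good₀ , e₀) = bound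
      where
      H = offsets 0 a
      spec = good-gaps good₀
      a>0 : All (0 <_) a
      a>0 = subst (All (0 <_)) e₀ (proj₁ (proj₂ (proj₂ spec)))
      H< : All (_< W) H
      H< = subst (λ a → All (_< W) (offsets 0 a)) e₀ (proj₁ (proj₂ spec))
      length-H : length H ≡ k
      length-H = trans (length-offsets 0 a) (cong suc (trans (cong length (sym e₀)) (length-gaps n t₀)))
      inc : AllPairs _<_ H
      inc = offsets-increasing 0 a a>0
      D = k ! * differences H
      D>0 : 0 < D
      D>0 = *-mono-≤ (1≤n! k) (differences>0 inc)
      D≤ : D ≤ 2 ^ B
      D≤ = begin
        k ! * differences H ≤⟨ *-mono-≤ (<⇒≤ (n<2^n (k !))) (differences≤ W W>0 H<) ⟩
        2 ^ (k !) * W ^ (length H * length H) ≡⟨ cong (2 ^ (k !) *_) (trans (cong (λ l → W ^ (l * l)) length-H) (^-*-assoc 2 w (k * k))) ⟩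
        2 ^ (k !) * 2 ^ (w * (k * k)) ≡⟨ ^-distribˡ-+-* 2 (k !) _ ⟨
        2 ^ B ∎
        where open ≤-Reasoning
      adm : ∀ {p} → Prime p → ¬ p ∣ D → k ≤ p × Sieve.Separates H Y p
      adm {p} pp p∤D = ≮⇒≥ (λ p<k → p∤D (∣m⇒∣m*n (differences H) (≤⇒∣! (<-trans z<s (prime>1 pp)) (<⇒≤ p<k)))) ,
        differences-separate inc (λ d → p∤D (∣n⇒∣m*n (k !) d))
      lvl = level X X>0
      bound : count (λ t → good? t ×-dec (gaps n t ≟ᴸ a)) Y * X ^ k ≤ Y * (suc B ^ k + 3)
      bound = subst (λ l → count (λ t → good? t ×-dec (gaps n t ≟ᴸ a)) Y * X ^ l ≤ Y * (suc B ^ l + 3)) length-H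
        (tuple-count D (proj₁ lvl) X B D>0 D≤ (proj₁ (proj₂ (proj₂ lvl))) (proj₂ (proj₂ (proj₂ lvl))) H Y r
          (subst (0 <_) (sym length-H) z<s)
          (λ pp p∤ → let a , b = adm pp p∤ in subst (_≤ _) (sym length-H) a , b)
          (subst (λ l → (2 * X) ^ (2 * l) * X ^ l ≤ 2 ^ r) (sym length-H) r-large)
          (subst (λ l → X ^ l * (1 + l * 2 ^ (2 * X)) ^ r ≤ Y) (sym length-H) Y-large)
          (proj₁ (proj₂ lvl))
          (λ t → good? t ×-dec (gaps n t ≟ᴸ a))
          (λ { t (good , refl) → proj₁ (good-gaps good) })
          r>0)

  module _ (Λ τ g : ℕ) .{{τ≢0 : NonZero τ}} where

    open Keys Λ τ

    Big : ℕ → Set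
    Big t = Good t × ¬ Any (_< g) (gaps n t)

    big? : Decidable Big
    big? t = good? t ×-dec ¬? (Any.any? (_<? g) (gaps n t))

    -- Both starting places are bounded by `Y`, which makes the property decidable, so a witness can
    -- be extracted from refuting its absence. Both are `Big` because the direction of the shift is
    -- not known beforehand.
    Collision : ℕ → Set
    Collision Y = ∃ λ s → s < Y × ∃ λ t → t < Y × Big s × Big t × key (gaps n s) ≡ key (gaps n t) × gaps n s ≢ gaps n t

    collision? : ∀ Y → Dec (Collision Y)
    collision? Y = anyUpTo? (λ s → anyUpTo? (λ t → big? s ×-dec big? t ×-dec (key (gaps n s) ≟ᴸ key (gaps n t)) ×-dec ¬? (gaps n s ≟ᴸ gaps n t)) Y) Y

    -- Without a collision each key belongs to a single pattern among the big starts, so the sieve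
    -- bounds its fibre; patterns with a gap below `g` are bounded one by one. The two summands of
    -- the factor count the keys and the patterns with a small gap.
    no-collision : ∀ Y X Z q n′ → n ≡ suc n′ → q * τ ≡ W → 0 < Λ → (∀ a → count (λ t → good? t ×-dec (gaps n t ≟ᴸ a)) Y * X ≤ Z) →
                   ¬ Collision Y → count good? Y * X ≤ (q * (q * τ + τ * Λ ^ n) ^ n′ + n * g * W ^ n′) * Z
    no-collision Y X Z q n′ refl qτ≡W Λ>0 pattern-≤ none = begin
      count good? Y * X
        ≤⟨ *-monoˡ-≤ X (count-⊎ good? big? small? Y split) ⟩
      (count big? Y + count small? Y) * X
        ≡⟨ *-distribʳ-+ X (count big? Y) (count small? Y) ⟩
      count big? Y * X + count small? Y * X
        ≤⟨ +-mono-≤ (fibres big? (λ t → key (gaps n t)) (keys q (q * τ + τ * Λ ^ n) n′) Y X Z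
             (λ t _ (good , _) → ∈-keys q n′ (gaps n t) Λ>0 (length-gaps n t) (subst (λ V → All (_< V) (gaps n t)) (sym qτ≡W) (proj₂ (proj₂ (proj₂ (good-gaps good))))))
             big-fibre)
           (fibres small? (gaps n) (small-box g W n) Y X Z
             (λ t _ (good , any) → subst (λ l → gaps n t ∈ small-box g W l) (length-gaps n t) (∈-small-box (proj₂ (proj₂ (proj₂ (good-gaps good)))) any))
             small-fibre) ⟩
      length (keys q (q * τ + τ * Λ ^ n) n′) * Z + length (small-box g W n) * Z
        ≡⟨ cong₂ (λ u v → u * Z + v * Z) (length-keys q (q * τ + τ * Λ ^ n) n′) small-length ⟩
      q * (q * τ + τ * Λ ^ n) ^ n′ * Z + n * g * W ^ n′ * Z
        ≡⟨ *-distribʳ-+ Z (q * (q * τ + τ * Λ ^ n) ^ n′) _ ⟨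
      (q * (q * τ + τ * Λ ^ n) ^ n′ + n * g * W ^ n′) * Z ∎
      where
      open ≤-Reasoning
      small? : Decidable (λ t → Good t × Any (_< g) (gaps n t))
      small? t = good? t ×-dec Any.any? (_<? g) (gaps n t)
      split : ∀ t → t < Y → Good t → Big t ⊎ (Good t × Any (_< g) (gaps n t))
      split t _ good with Any.any? (_<? g) (gaps n t)
      ... | yes any = inj₂ (good , any)
      ... | no ¬any = inj₁ (good , ¬any)
      small-length : length (small-box g W n) ≡ n * g * W ^ n′
      small-length = *-cancelʳ-≡ _ _ W {{>-nonZero W>0}} (trans (length-small-box g W n) (lem (n * g) W (W ^ n′)))
        where
        lem : ∀ a b c → a * (b * c) ≡ a * c * b
        lem = solve-∀
      small-fibre : ∀ κ → count (λ t → small? t ×-dec (gaps n t ≟ᴸ κ)) Y * X ≤ Z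
      small-fibre κ = ≤-trans (*-monoˡ-≤ X (count-mono (λ t → small? t ×-dec (gaps n t ≟ᴸ κ)) (λ t → good? t ×-dec (gaps n t ≟ᴸ κ)) Y
        λ t _ ((good , _) , e) → good , e)) (pattern-≤ κ)
      big-fibre : ∀ κ → count (λ t → big? t ×-dec (key (gaps n t) ≟ᴸ κ)) Y * X ≤ Z
      big-fibre κ with count-∃ (λ t → big? t ×-dec (key (gaps n t) ≟ᴸ κ)) Y
      ... | inj₁ e = ≤-trans (≤-reflexive (cong (_* X) e)) z≤n
      ... | inj₂ (s , s<Y , big-s , e) = ≤-trans (*-monoˡ-≤ X (count-mono (λ t → big? t ×-dec (key (gaps n t) ≟ᴸ κ)) (λ t → good? t ×-dec (gaps n t ≟ᴸ gaps n s)) Y same)) (pattern-≤ (gaps n s))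
        where
        same : ∀ t → t < Y → Big t × key (gaps n t) ≡ κ → Good t × gaps n t ≡ gaps n s
        same t t<Y (big-t , e′) = proj₁ big-t , decidable-stable (gaps n t ≟ᴸ gaps n s)
          λ ne → none (t , t<Y , s , s<Y , big-t , big-s , trans e′ (sym e) , ne)

    gaps-index : ∀ {P : ℕ → Set} m s → All P (gaps m s) → ∀ i → i < m → P (run s (suc i) ∸ run s i)
    gaps-index (suc m) s (p ∷ _) zero _ = p
    gaps-index {P} (suc m) s (_ ∷ ps) (suc i) (s≤s i<m) = subst P (cong₂ _∸_ (run-next s (suc i)) (run-next s i)) (gaps-index m (next s) ps i i<m)

    gaps-shift : ∀ m s t d → gaps m t ≡ shift d (gaps m s) → ∀ i → i < m →
                 run t (suc i) ∸ run t i ≡ run s (suc i) ∸ run s i + d * Λ ^ i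
    gaps-shift (suc m) s t d e zero _ = trans (∷-injectiveˡ e) (cong (next s ∸ s +_) (sym (*-identityʳ d)))
    gaps-shift (suc m) s t d e (suc i) (s≤s i<m) = begin
      run t (suc (suc i)) ∸ run t (suc i) ≡⟨ cong₂ _∸_ (run-next t (suc i)) (run-next t i) ⟨
      run (next t) (suc i) ∸ run (next t) i ≡⟨ gaps-shift m (next s) (next t) (d * Λ) (∷-injectiveʳ e) i i<m ⟩
      run (next s) (suc i) ∸ run (next s) i + d * Λ * Λ ^ i ≡⟨ cong₂ _+_ (cong₂ _∸_ (run-next s (suc i)) (run-next s i)) (*-assoc d Λ (Λ ^ i)) ⟩
      run s (suc (suc i)) ∸ run s (suc i) + d * Λ ^ suc i ∎
      where
      open ≡-Reasoning

    polygon : 1 < Λ → 0 < g → τ * Λ ^ n ≤ g → W < Λ * g → ∀ s t → Big s → Good t → Shifted (gaps n s) (gaps n t) →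
              Σ (Fin k → Point) EmptyPolygonInP²
    polygon Λ>1 g>0 τΛ≤g W< s t (good-s , big) good-t (d , d>0 , d<τ , e) =
      _ , Chain.empty-polygon n (run s) (run t) (consecutive good-s) (consecutive good-t) W g Λ d d>0 g>0 W< gap-≥ gap-< excess total
      where
      consecutive : ∀ {t} → Good t → ConsecutivePrimes n (run t)
      consecutive good = record
        { primes = λ i i≤n → proj₁ (run-spec good i i≤n)
        ; no-primes = λ i i<n → proj₂ (proj₂ (run-step good i i<n)) }
      gap-≥ : ∀ i → i < n → run s i + g ≤ run s (suc i)
      gap-≥ i i<n = ≤-trans (+-monoʳ-≤ (run s i) (≮⇒≥ (gaps-index n s (¬Any⇒All¬ _ big) i i<n)))
        (≤-reflexive (m+[n∸m]≡n (<⇒≤ (proj₁ (run-step good-s i i<n)))))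
      gap-< : ∀ i → i < n → run s (suc i) < run s i + W
      gap-< i i<n = ≤-trans (proj₁ (proj₂ (run-step good-s i i<n))) (+-monoˡ-≤ W (proj₁ (proj₂ (run-spec good-s i (<⇒≤ i<n)))))
      excess : ∀ i → i < n → run t (suc i) + run s i ≡ run t i + run s (suc i) + d * Λ ^ i
      excess i i<n = begin
        run t (suc i) + run s i ≡⟨ cong (_+ run s i) (m+[n∸m]≡n (<⇒≤ (proj₁ (run-step good-t i i<n)))) ⟨
        run t i + (run t (suc i) ∸ run t i) + run s i ≡⟨ cong (λ u → run t i + u + run s i) (gaps-shift n s t d e i i<n) ⟩
        run t i + (run s (suc i) ∸ run s i + d * Λ ^ i) + run s i ≡⟨ lem (run t i) (run s (suc i) ∸ run s i) (d * Λ ^ i) (run s i) ⟩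
        run t i + (run s i + (run s (suc i) ∸ run s i)) + d * Λ ^ i ≡⟨ cong (λ u → run t i + u + d * Λ ^ i) (m+[n∸m]≡n (<⇒≤ (proj₁ (run-step good-s i i<n)))) ⟩
        run t i + run s (suc i) + d * Λ ^ i ∎
        where
        open ≡-Reasoning
        lem : ∀ a b c e → a + (b + c) + e ≡ a + (e + b) + c
        lem = solve-∀
      -- The sum of d Λ^j over j < m is at most d Λ^m because Λ ≥ 2. For m = n the bounds d < τ and
      -- τ Λ^n ≤ g then yield `total`.
      partial : ∀ m → m ≤ n → run t m + s ≤ t + run s m + d * Λ ^ m
      partial zero _ = m≤m+n _ _
      partial (suc m) m<n = +-cancelʳ-≤ (run s m) _ _ (begin
        run t (suc m) + s + run s m ≡⟨ lem₁ (run t (suc m)) s (run s m) ⟩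
        run t (suc m) + run s m + s ≡⟨ cong (_+ s) (excess m m<n) ⟩
        run t m + run s (suc m) + d * Λ ^ m + s ≡⟨ lem₂ (run t m) (run s (suc m)) (d * Λ ^ m) s ⟩
        run t m + s + (run s (suc m) + d * Λ ^ m) ≤⟨ +-monoˡ-≤ _ (partial m (<⇒≤ m<n)) ⟩
        t + run s m + d * Λ ^ m + (run s (suc m) + d * Λ ^ m) ≡⟨ lem₃ t (run s m) d (Λ ^ m) (run s (suc m)) ⟩
        t + run s (suc m) + d * (2 * Λ ^ m) + run s m ≤⟨ +-monoˡ-≤ (run s m) (+-monoʳ-≤ (t + run s (suc m)) (*-monoʳ-≤ d (*-monoˡ-≤ (Λ ^ m) Λ>1))) ⟩
        t + run s (suc m) + d * Λ ^ suc m + run s m ∎)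
        where
        open ≤-Reasoning
        lem₁ : ∀ a b c → a + b + c ≡ a + c + b
        lem₁ = solve-∀
        lem₂ : ∀ a b c d → a + b + c + d ≡ a + d + (b + c)
        lem₂ = solve-∀
        lem₃ : ∀ t r d L x → t + r + d * L + (x + d * L) ≡ t + x + d * (2 * L) + r
        lem₃ = solve-∀
      total : run t n + s < t + run s n + g
      total = ≤-trans (s≤s (partial n ≤-refl)) (≤-trans (≤-reflexive (sym (+-suc _ _))) (+-monoʳ-≤ (t + run s n)
        (≤-trans (*-monoˡ-< (Λ ^ n) {{m^n≢0 Λ n {{>-nonZero (<-trans z<s Λ>1)}}}} d<τ) τΛ≤g)))

-- Choice of parameters

exponential-beats-polynomial : ∀ C k → ∃ λ v → 0 < v × (C * (v + 1)) ^ k ≤ 2 ^ v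
exponential-beats-polynomial C k = 2 ^ m , m^n>0 2 m , (begin
  (C * (2 ^ m + 1)) ^ k ≤⟨ ^-monoˡ-≤ k (*-mono-≤ (<⇒≤ (n<2^n C)) (≤-trans (+-monoʳ-≤ (2 ^ m) (m^n>0 2 m)) (≤-reflexive (cong (2 ^ m +_) (sym (+-identityʳ (2 ^ m))))))) ⟩
  (2 ^ C * 2 ^ suc m) ^ k ≡⟨ cong (_^ k) (^-distribˡ-+-* 2 C (suc m)) ⟨
  (2 ^ (C + suc m)) ^ k ≡⟨ ^-*-assoc 2 (C + suc m) k ⟩
  2 ^ ((C + suc m) * k) ≤⟨ ^-monoʳ-≤ 2 linear ⟩
  2 ^ (2 ^ m) ∎)
  where
  open ≤-Reasoning
  j m : ℕ
  -- The exponent to be beaten is linear in `m`. Doubling `j` gives 2^m ≥ (j + 1)², where one factor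
  -- covers the growth in `m` and the other covers k (C + 3).
  j = k * (C + 3)
  m = j + j
  linear : (C + suc m) * k ≤ 2 ^ m
  linear = begin
    (C + suc (j + j)) * k ≤⟨ m≤m+n _ ((C * j + j + 2) * k) ⟩
    (C + suc (j + j)) * k + (C * j + j + 2) * k ≡⟨ lem C j k ⟩
    suc j * (k * (C + 3)) ≤⟨ *-monoʳ-≤ (suc j) (n≤1+n j) ⟩
    suc j * suc j ≤⟨ *-mono-≤ (n<2^n j) (n<2^n j) ⟩
    2 ^ j * 2 ^ j ≡⟨ ^-distribˡ-+-* 2 j j ⟨
    2 ^ m ∎
    where
    lem : ∀ C j k → (C + suc (j + j)) * k + (C * j + j + 2) * k ≡ suc j * (k * (C + 3))
    lem = solve-∀

-- All quantities are powers of U = 2 ^ v: primes up to Y = 2 ^ M with M = U ^ (a + 1), windows of length W = U ^ (a + 2),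
-- sieve strength X = U ^ a, and Λ = τ = U ^ e. The factor U absorbs everything polynomial in v.
module Parameters (n′ e a f v : ℕ) (e-eq : e * (n′ + 3) ≡ a + 3) (f-eq : e + f ≡ a + 2) (a-eq : f + 5 + 3 * n′ ≡ a) (v>0 : 0 < v) where

  n k U E M w X C r : ℕ
  n = suc n′
  k = suc n
  U = 2 ^ v
  E = U ^ e
  M = U ^ suc a
  w = v * (a + 2)
  X = U ^ a
  -- One group of summands for each demand on `U`: k! and k² (a + 2), with part of the 5, dominate
  -- `B`; 10 k (a + 1) pays for the sieve error, 4 n for the bad starting places, and 5 gives 4 < U.
  C = k ! + k * k * (a + 2) + 10 * k * (a + 1) + 4 * n + 5
  -- Since 2X ≤ 2^(v (a + 1)), this makes 2^r at least (2X)^(2k) X^k.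
  r = 3 * k * (v * suc a)

  open Patterns n w hiding (k)

  module _ (C-small : (C * (v + 1)) ^ k ≤ U) where

    private
      instance
        U≢0 : NonZero U
        U≢0 = m^n≢0 2 v
        E≢0 : NonZero E
        E≢0 = m^n≢0 U e
        a≢0 : NonZero a
        a≢0 = >-nonZero (≤-trans (s≤s z≤n) (≤-trans (m≤n+m 5 f) (≤-trans (m≤m+n (f + 5) (3 * n′)) (≤-reflexive a-eq))))

      c = C * (v + 1)

      0<c : 0 < c
      0<c = *-mono-≤ {1} {C} {1} {v + 1} (m≤n⇒m≤o+n (k ! + k * k * (a + 2) + 10 * k * (a + 1) + 4 * n) (s≤s z≤n)) (m≤n+m 1 v)

      c≤U : c ≤ U
      c≤U = ≤-trans (≤-trans (≤-reflexive (sym (^-identityʳ c))) (^-monoʳ-≤ c {{>-nonZero 0<c}} {1} {k} (s≤s z≤n))) C-small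

      U-suc : ∀ i j → U ^ i * U ^ j ≡ U ^ (i + j)
      U-suc i j = sym (^-distribˡ-+-* U i j)

      W≡ : W ≡ U ^ (a + 2)
      W≡ = sym (^-*-assoc 2 v (a + 2))

      C≤c : C ≤ c
      C≤c = m≤m*n C (v + 1) {{>-nonZero (m≤n+m 1 v)}}

      4<U : 4 < U
      4<U = ≤-trans (m≤n+m 5 _) (≤-trans C≤c c≤U)

      4n≤U : 4 * n ≤ U
      4n≤U = ≤-trans (≤-trans (m≤n+m (4 * n) _) (m≤m+n _ 5)) (≤-trans C≤c c≤U)

      B-bound : suc B ^ k + 3 ≤ U
      B-bound = begin
        suc B * suc B ^ n + 3 * 1 ≤⟨ +-mono-≤ (*-monoʳ-≤ (suc B) (^-monoˡ-≤ n (m≤m+n (suc B) 3))) (*-monoʳ-≤ 3 (m^n>0 (suc B + 3) n)) ⟩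
        suc B * (suc B + 3) ^ n + 3 * (suc B + 3) ^ n ≡⟨ *-distribʳ-+ ((suc B + 3) ^ n) (suc B) 3 ⟨
        (suc B + 3) ^ k ≤⟨ ^-monoˡ-≤ k (≤-trans (m≤m+n _ _) (≤-reflexive (lem (k !) k a v (10 * k * (a + 1)) (4 * n)))) ⟩
        c ^ k ≤⟨ C-small ⟩
        U ∎
        where
        open ≤-Reasoning
        lem : ∀ K k a v y z → suc (K + v * (a + 2) * (k * k)) + 3 + (K * v + k * k * (a + 2) + (y + z) * (v + 1) + 5 * v + 1)
              ≡ (K + k * k * (a + 2) + y + z + 5) * (v + 1)
        lem = solve-∀

      10kv≤U : 10 * k * (v * suc a) ≤ U
      10kv≤U = ≤-trans (≤-trans (m≤m+n _ _) (≤-reflexive (lem (k !) k a v (4 * n)))) c≤U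
        where
        lem : ∀ K k a v z → 10 * k * (v * suc a) + (10 * k * (a + 1) + (K + k * k * (a + 2) + z + 5) * (v + 1))
              ≡ (K + k * k * (a + 2) + 10 * k * (a + 1) + z + 5) * (v + 1)
        lem = solve-∀

      U≤X : U ≤ X
      U≤X = ≤-trans (≤-reflexive (sym (^-identityʳ U))) (^-monoʳ-≤ U {1} {a} (>-nonZero⁻¹ a))

      k≤X : k ≤ X
      k≤X = ≤-trans (≤-trans (m≤m+n k _) (≤-trans (≤-reflexive (lem k (v * suc a ∸ 1))) (*-monoʳ-≤ (10 * k) (≤-reflexive (m+[n∸m]≡n (*-mono-≤ v>0 (s≤s (z≤n {a})))))))) (≤-trans 10kv≤U U≤X)
        where
        lem : ∀ k x → k + (9 * k + 10 * k * x) ≡ 10 * k * (1 + x)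
        lem = solve-∀

      w≤M : w ≤ M
      w≤M = ≤-trans (≤-trans (m≤m+n _ (v * (9 * a + 8 + 10 * n * suc a))) (≤-reflexive (lem v a n)))
              (≤-trans 10kv≤U (≤-trans (≤-reflexive (sym (^-identityʳ U))) (^-monoʳ-≤ U {1} {suc a} (s≤s z≤n))))
        where
        lem : ∀ v a n → v * (a + 2) + v * (9 * a + 8 + 10 * n * suc a) ≡ 10 * suc n * (v * suc a)
        lem = solve-∀

      r-large : (2 * X) ^ (2 * k) * X ^ k ≤ 2 ^ r
      r-large = begin
        (2 * X) ^ (2 * k) * X ^ k ≤⟨ *-monoʳ-≤ ((2 * X) ^ (2 * k)) (^-monoˡ-≤ k (m≤n*m X 2)) ⟩
        (2 * X) ^ (2 * k) * (2 * X) ^ k ≡⟨ ^-distribˡ-+-* (2 * X) (2 * k) k ⟨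
        (2 * X) ^ (2 * k + k) ≡⟨ cong (λ x → (2 * x) ^ (2 * k + k)) (^-*-assoc 2 v a) ⟩
        (2 ^ suc (v * a)) ^ (2 * k + k) ≡⟨ ^-*-assoc 2 (suc (v * a)) (2 * k + k) ⟩
        2 ^ (suc (v * a) * (2 * k + k)) ≤⟨ ^-monoʳ-≤ 2 (≤-trans (*-monoˡ-≤ (2 * k + k) (+-monoˡ-≤ (v * a) v>0)) (≤-reflexive (lem v a k))) ⟩
        2 ^ r ∎
        where
        open ≤-Reasoning
        lem : ∀ v a k → (v + v * a) * (2 * k + k) ≡ 3 * k * (v * suc a)
        lem = solve-∀

      -- On the scale of log₂ the sieve error is about 2 X r with `r` linear in `v`; the factor U =
      -- M / X pays for it.
      Y-large : X ^ k * (1 + k * 2 ^ (2 * X)) ^ r ≤ 2 ^ M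
      Y-large = begin
        X ^ k * (1 + k * Z) ^ r ≤⟨ *-mono-≤ (≤-reflexive (trans (^-*-assoc U a k) (^-*-assoc 2 v (a * k)))) (^-monoˡ-≤ r 1+kP≤) ⟩
        2 ^ (v * (a * k)) * (2 ^ (k + 2 * X)) ^ r ≡⟨ cong (2 ^ (v * (a * k)) *_) (^-*-assoc 2 (k + 2 * X) r) ⟩
        2 ^ (v * (a * k)) * 2 ^ ((k + 2 * X) * r) ≡⟨ ^-distribˡ-+-* 2 (v * (a * k)) _ ⟨
        2 ^ (v * (a * k) + (k + 2 * X) * r) ≤⟨ ^-monoʳ-≤ 2 exponent ⟩
        2 ^ M ∎
        where
        open ≤-Reasoning
        Z = 2 ^ (2 * X)
        1+kP≤ : 1 + k * Z ≤ 2 ^ (k + 2 * X)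
        1+kP≤ = begin
          1 + k * Z ≤⟨ +-monoˡ-≤ (k * Z) (m^n>0 2 (2 * X)) ⟩
          suc k * Z ≤⟨ *-monoˡ-≤ Z (n<2^n k) ⟩
          2 ^ k * Z ≡⟨ ^-distribˡ-+-* 2 k (2 * X) ⟨
          2 ^ (k + 2 * X) ∎
        lem₁ : ∀ v a k X → X * (v * (a * k)) + (X + 2 * X) * (3 * k * (v * suc a)) + X * (k * v) ≡ X * (10 * k * (v * suc a))
        lem₁ = solve-∀
        exponent : v * (a * k) + (k + 2 * X) * r ≤ M
        exponent = begin
          v * (a * k) + (k + 2 * X) * r ≤⟨ +-mono-≤ (m≤n*m (v * (a * k)) X {{m^n≢0 U a}}) (*-monoˡ-≤ r (+-monoˡ-≤ (2 * X) k≤X)) ⟩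
          X * (v * (a * k)) + (X + 2 * X) * r ≤⟨ m≤m+n _ (X * (k * v)) ⟩
          X * (v * (a * k)) + (X + 2 * X) * r + X * (k * v) ≡⟨ lem₁ v a k X ⟩
          X * (10 * k * (v * suc a)) ≤⟨ *-monoʳ-≤ X 10kv≤U ⟩
          X * U ≡⟨ *-comm X U ⟩
          M ∎

      r>0 : 0 < r
      r>0 = *-mono-≤ {1} {3 * k} (s≤s z≤n) (*-mono-≤ v>0 (s≤s (z≤n {a})))

      q Y G : ℕ
      q = 2 ^ (M ∸ w)
      Y = q * W
      G = count good? Y

      Y≡ : Y ≡ 2 ^ M
      Y≡ = trans (sym (^-distribˡ-+-* 2 (M ∸ w) w)) (cong (2 ^_) (m∸n+n≡m w≤M))

      W≡UM : W ≡ U * M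
      W≡UM = trans W≡ (cong (U ^_) (+-comm a 2))

      -- Chebyshev gives Y ≤ M π(Y) + 2. Each of the `q` windows has at most `n` bad starts;
      -- together they cost M q n ≤ Y / 4, because 4 n M ≤ U M = W.
      many-good : Y ≤ 2 * (M * G)
      many-good = *-cancelˡ-≤ 2 (+-cancelʳ-≤ (Y + Y) _ _ (begin
        2 * Y + (Y + Y) ≡⟨ lem₁ Y ⟩
        4 * Y ≤⟨ *-monoʳ-≤ 4 Y≤ ⟩
        4 * (M * (G + q * n) + 2) ≡⟨ lem₂ M G q n ⟩
        2 * (2 * (M * G)) + (q * (4 * n * M) + 8) ≤⟨ +-monoʳ-≤ (2 * (2 * (M * G))) (+-mono-≤ (*-monoʳ-≤ q (≤-trans (*-monoˡ-≤ M 4n≤U) (≤-reflexive (sym W≡UM)))) 8≤Y) ⟩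
        2 * (2 * (M * G)) + (Y + Y) ∎))
        where
        open ≤-Reasoning
        Y≤ : Y ≤ M * (G + q * n) + 2
        Y≤ = begin
          Y ≡⟨ Y≡ ⟩
          2 ^ M ≤⟨ chebyshev M ⟩
          M * π (2 ^ M) + 2 ≡⟨ cong (λ y → M * π y + 2) Y≡ ⟨
          M * π Y + 2 ≤⟨ +-monoˡ-≤ 2 (*-monoʳ-≤ M (good-count q)) ⟩
          M * (G + q * n) + 2 ∎
        8≤Y : 8 ≤ Y
        8≤Y = ≤-trans (^-monoʳ-≤ 2 {3} {M} (≤-trans (≤-trans (s≤s (s≤s (s≤s z≤n))) 4<U) (m≤m*n U X {{m^n≢0 U a}}))) (≤-reflexive (sym Y≡))
        lem₁ : ∀ y → 2 * y + (y + y) ≡ 4 * y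
        lem₁ = solve-∀
        lem₂ : ∀ M G q n → 4 * (M * (G + q * n) + 2) ≡ 2 * (2 * (M * G)) + (q * (4 * n * M) + 8)
        lem₂ = solve-∀

      Λ τ g : ℕ
      Λ = E
      τ = E
      g = E ^ k

      qτ≡W : U ^ f * τ ≡ W
      qτ≡W = trans (U-suc f e) (trans (cong (U ^_) (trans (+-comm f e) f-eq)) (sym W≡))

      g≡ : g ≡ U ^ suc f
      g≡ = trans (^-*-assoc U e k) (cong (U ^_) (+-cancelˡ-≡ e _ _ (trans (lem e n′) (trans e-eq (trans (+-suc a 2) (trans (cong suc (sym f-eq)) (sym (+-suc e f))))))))
        where
        lem : ∀ e n → e + e * suc (suc n) ≡ e * (n + 3)
        lem = solve-∀

      W<Λg : W < Λ * g
      W<Λg = begin-strict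
        W ≡⟨ W≡ ⟩
        U ^ (a + 2) <⟨ ^-monoʳ-< U (≤-trans (s≤s (s≤s z≤n)) 4<U) (+-monoʳ-< a ≤-refl) ⟩
        U ^ (a + 3) ≡⟨ cong (U ^_) e-eq ⟨
        U ^ (e * (n′ + 3)) ≡⟨ ^-*-assoc U e (n′ + 3) ⟨
        E ^ (n′ + 3) ≡⟨ cong (E ^_) (+-comm n′ 3) ⟩
        Λ * g ∎
        where open ≤-Reasoning

      Λ>1 : 1 < Λ
      Λ>1 = ≤-trans (≤-trans (s≤s (s≤s z≤n)) 4<U) (≤-trans (≤-reflexive (sym (^-identityʳ U))) (^-monoʳ-≤ U e>0))
        where
        e>0 : 0 < e
        e>0 = ≮⇒≥ λ { (s≤s z≤n) → contradiction e-eq (<⇒≢ (≤-trans (s≤s z≤n) (m≤n+m 3 a))) }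

      K : ℕ
      K = U ^ f * (U ^ f * τ + τ * Λ ^ n) ^ n′ + n * g * W ^ n′

      few-keys : K ≤ 2 * U ^ (f + 2 + (a + 3) * n′)
      few-keys = ≤-trans (+-mono-≤ first second) (≤-reflexive (cong (U ^ (f + 2 + (a + 3) * n′) +_) (sym (+-identityʳ _))))
        where
        open ≤-Reasoning
        width : U ^ f * τ + τ * Λ ^ n ≤ U ^ (a + 3)
        width = begin
          U ^ f * τ + g ≤⟨ +-mono-≤ (≤-reflexive (trans qτ≡W W≡)) (≤-trans (≤-reflexive g≡) (^-monoʳ-≤ U sf≤)) ⟩
          U ^ (a + 2) + U ^ (a + 2) ≡⟨ cong (U ^ (a + 2) +_) (+-identityʳ _) ⟨
          2 * U ^ (a + 2) ≤⟨ *-monoˡ-≤ (U ^ (a + 2)) (≤-trans (s≤s (s≤s z≤n)) 4<U) ⟩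
          U ^ suc (a + 2) ≡⟨ cong (U ^_) (+-suc a 2) ⟨
          U ^ (a + 3) ∎
          where
          sf≤ : suc f ≤ a + 2
          sf≤ = ≤-trans (≤-trans (≤-reflexive (+-comm 1 f)) (≤-trans (+-monoʳ-≤ f (s≤s z≤n)) (≤-trans (m≤m+n (f + 5) (3 * n′)) (≤-reflexive a-eq)))) (m≤m+n a 2)
        first : U ^ f * (U ^ f * τ + τ * Λ ^ n) ^ n′ ≤ U ^ (f + 2 + (a + 3) * n′)
        first = begin
          U ^ f * (U ^ f * τ + τ * Λ ^ n) ^ n′ ≤⟨ *-mono-≤ (^-monoʳ-≤ U (m≤m+n f 2)) (^-monoˡ-≤ n′ width) ⟩
          U ^ (f + 2) * (U ^ (a + 3)) ^ n′ ≡⟨ cong (U ^ (f + 2) *_) (^-*-assoc U (a + 3) n′) ⟩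
          U ^ (f + 2) * U ^ ((a + 3) * n′) ≡⟨ U-suc (f + 2) _ ⟩
          U ^ (f + 2 + (a + 3) * n′) ∎
        second : n * g * W ^ n′ ≤ U ^ (f + 2 + (a + 3) * n′)
        second = begin
          n * g * W ^ n′ ≤⟨ *-mono-≤ (*-mono-≤ (≤-trans (m≤n*m n 4) 4n≤U) (≤-reflexive g≡)) (^-monoˡ-≤ n′ (≤-trans (≤-reflexive W≡) (^-monoʳ-≤ U (+-monoʳ-≤ a (s≤s (s≤s z≤n)))))) ⟩
          U ^ suc (suc f) * (U ^ (a + 3)) ^ n′ ≡⟨ cong₂ _*_ (cong (U ^_) (+-comm 2 f)) (^-*-assoc U (a + 3) n′) ⟩
          U ^ (f + 2) * U ^ ((a + 3) * n′) ≡⟨ U-suc (f + 2) _ ⟩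
          U ^ (f + 2 + (a + 3) * n′) ∎

      -- Exponents of `U`: a + 1 from `M`, f + 2 + (a + 3) n′ from `K`, 1 from the sieve constant,
      -- and 1 to absorb the factor 4. By `a-eq` they add up to exactly a k; strictness comes from 4
      -- < U.
      too-few : 2 * M * K * (suc B ^ k + 3) < X ^ k
      too-few = begin-strict
        2 * M * K * (suc B ^ k + 3) ≤⟨ *-mono-≤ (*-monoʳ-≤ (2 * M) few-keys) B-bound ⟩
        2 * M * (2 * U ^ N) * U ≡⟨ lem₁ M (U ^ N) U ⟩
        4 * (U * (M * U ^ N)) <⟨ *-monoˡ-< (U * (M * U ^ N)) {{m*n≢0 U _ {{U≢0}} {{m*n≢0 M _ {{m^n≢0 U (suc a)}} {{m^n≢0 U N}}}}}} 4<U ⟩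
        U * (U * (M * U ^ N)) ≡⟨ cong (λ x → U * (U * x)) (U-suc (suc a) N) ⟩
        U ^ (2 + (suc a + N)) ≡⟨ cong (U ^_) (trans (lem₂ a f n′) (trans (cong (λ x → a + x + a * n′) a-eq) (lem₃ a n′))) ⟩
        U ^ (a * k) ≡⟨ ^-*-assoc U a k ⟨
        X ^ k ∎
        where
        open ≤-Reasoning
        N = f + 2 + (a + 3) * n′
        lem₁ : ∀ M x u → 2 * M * (2 * x) * u ≡ 4 * (u * (M * x))
        lem₁ = solve-∀
        lem₂ : ∀ a f n → 2 + (suc a + (f + 2 + (a + 3) * n)) ≡ a + (f + 5 + 3 * n) + a * n
        lem₂ = solve-∀
        lem₃ : ∀ a n → a + a + a * n ≡ a * suc (suc n)
        lem₃ = solve-∀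

    collision : Collision Λ τ g Y
    collision with collision? Λ τ g Y
    ... | yes c = c
    ... | no none = contradiction too-many (<⇒≱ too-few)
      where
      open ≤-Reasoning
      b = suc B ^ k + 3
      few-good : G * X ^ k ≤ K * (Y * b)
      few-good = no-collision Λ τ g Y (X ^ k) (Y * b) (U ^ f) n′ refl qτ≡W (m^n>0 U e)
        (pattern-count X r Y (m^n>0 U a) r>0 r-large (≤-trans Y-large (≤-reflexive (sym Y≡)))) none
      too-many : X ^ k ≤ 2 * M * K * b
      too-many = *-cancelˡ-≤ Y {{m*n≢0 q W {{m^n≢0 2 (M ∸ w)}} {{m^n≢0 2 w}}}} (begin
        Y * X ^ k ≤⟨ *-monoˡ-≤ (X ^ k) many-good ⟩
        2 * (M * G) * X ^ k ≡⟨ lem₁ M G (X ^ k) ⟩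
        2 * M * (G * X ^ k) ≤⟨ *-monoʳ-≤ (2 * M) few-good ⟩
        2 * M * (K * (Y * b)) ≡⟨ lem₂ (2 * M) K Y b ⟩
        Y * (2 * M * K * b) ∎)
        where
        lem₁ : ∀ m g x → 2 * (m * g) * x ≡ 2 * m * (g * x)
        lem₁ = solve-∀
        lem₂ : ∀ m k y b → m * (k * (y * b)) ≡ y * (m * k * b)
        lem₂ = solve-∀

    empty-polygon-exists : Σ (Fin k → Point) EmptyPolygonInP²
    empty-polygon-exists with collision
    ... | s , _ , t , _ , big-s , big-t , key≡ , gaps≢ with Keys.collision Λ τ (gaps n s) (gaps n t) key≡ gaps≢
    ...   | inj₁ sh = polygon Λ τ g Λ>1 (m^n>0 E k) ≤-refl W<Λg s t big-s (proj₁ big-t) sh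
    ...   | inj₂ sh = polygon Λ τ g Λ>1 (m^n>0 E k) ≤-refl W<Λg t s big-t (proj₁ big-s) sh

mainTheorem1 : (N : ℕ) → 1 ≤ N →
    ∃ λ (k : ℕ) → N ≤ k × Σ (Fin k → Point) (λ v → EmptyPolygonInP² v)
mainTheorem1 (suc n′) _ = suc (suc n′) , n≤1+n _ ,
  empty-polygon-exists (proj₂ (proj₂ choice))
  where
  -- N gaps give N + 1 vertices. The exponents solve three equations: e + f = a + 2 means U^f τ = W,
  -- e (n′ + 3) = a + 3 means Λ g = U W, and f + 5 + 3 n′ = a balances the pigeonhole. Together they
  -- force e = 3 n′ + 7.
  e a f : ℕ
  e = 3 * n′ + 7
  a = 3 * n′ * n′ + 16 * n′ + 18
  f = 3 * n′ * n′ + 13 * n′ + 13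
  k C : ℕ
  k = suc (suc n′)
  C = k ! + k * k * (a + 2) + 10 * k * (a + 1) + 4 * suc n′ + 5
  choice : ∃ λ v → 0 < v × (C * (v + 1)) ^ k ≤ 2 ^ v
  choice = exponential-beats-polynomial C k
  e-eq : ∀ n → (3 * n + 7) * (n + 3) ≡ 3 * n * n + 16 * n + 18 + 3
  e-eq = solve-∀
  f-eq : ∀ n → 3 * n + 7 + (3 * n * n + 13 * n + 13) ≡ 3 * n * n + 16 * n + 18 + 2
  f-eq = solve-∀
  a-eq : ∀ n → 3 * n * n + 13 * n + 13 + 5 + 3 * n ≡ 3 * n * n + 16 * n + 18
  a-eq = solve-∀
  open Parameters n′ e a f (proj₁ choice) (e-eq n′) (f-eq n′) (a-eq n′) (proj₁ (proj₂ choice)) using (empty-polygon-exists)
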